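{- The adaptivity gap of the Stochastic Boolean Function Evaluation problem on $k$-of-$n$ functions is exactly $2$. That is, let $\mathcal{I}$ be the class of all instances $(f,c,p)$ where $n\in\mathbb{N}$, $k\in\{1,\dots,n\}$, $f:\{0,1\}^n\to\{0,1\}$ is the $k$-of-$n$ function, $c\in\mathbb{R}_{\ge 0}^n$ and $p\in(0,1)^n$. Then $$\sup_{(f,c,p)\in\mathcal{I}} \frac{\mathrm{E}_p[\mathrm{cost}_c(\mathrm{OPT}_{\mathrm{NA}}(f,c,p))]}{\mathrm{E}_p[\mathrm{cost}_c(\mathrm{OPT}(f,c,p))]} = 2,$$ where the supremum is over the instances whose denominator is positive.
   Context: The $k$-of-$n$ function is $f:\{0,1\}^n\to\{0,1\}$ with $f(x)=1$ iff $x_1+\dots+x_n\ge k$. The variables $x_1,\dots,x_n$ are independent Boolean random variables with $\Pr[x_i=1]=p_i\in(0,1)$; testing $x_i$ reveals its value and costs $c_i\ge 0$. A state is a vector $s\in\{0,1,\bullet\}^n$, where $s_i$ is the known value of $x_i$ or $\bullet$ if $x_i$ is not yet tested; initially all entries are $\bullet$. A vector $x\in\{0,1\}^n$ follows from $s$ if $s_i\in\{x_i,\bullet\}$ for all $i$. The function $f$ is determined by $s$ if $f$ takes the same value on all $x\in\{0,1\}^n$ following from $s$. A policy is a function $\pi:\{0,1,\bullet\}^n\setminus\{0,1\}^n\to\{1,\dots,n\}$ with $s_{\pi(s)}=\bullet$ for every such $s$; in state $s$ the variable $x_{\pi(s)}$ is tested. Testing continues exactly until $f$ is determined by the current state. If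 $S$ is the (random) set of indices tested until then, $\mathrm{cost}_c(\pi)=\sum_{i\in S}c_i$, and $\mathrm{E}_p$ denotes expectation over $x$. A policy is non-adaptive if $\pi(s)$ depends only on the number of unknown variables in $s$; equivalently, it tests the variables in a fixed order (a permutation of $\{1,\dots,n\}$) until $f$ is determined. $\mathrm{OPT}(f,c,p)$ is a policy, and $\mathrm{OPT}_{\mathrm{NA}}(f,c,p)$ a non-adaptive policy, minimizing the expected cost among all policies and among all non-adaptive policies, respectively. -}

module Defs where

open import Data.Bool.Base using (Bool; true; false; if_then_else_)
import Data.Bool.Properties as Bool
open import Data.Fin.Base using (Fin; zero; suc)
import Data.Fin.Properties as Fin
open import Data.List.Base as List using (List)
open import Data.Maybe.Base using (Maybe; just; nothing; is-just; is-nothing)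
import Data.Maybe.Properties as Maybe
open import Data.Nat.Base as ℕ using (ℕ; zero; suc)
import Data.Nat.Properties as ℕ
open import Data.Product.Base using (Σ; Σ-syntax; ∃-syntax; _×_; _,_)
open import Data.Rational.Base as ℚ using (ℚ; 0ℚ; 1ℚ; ½)
import Data.Rational.Properties as ℚ
open import Data.Rational.Solver using (module +-*-Solver)
open import Data.Sum.Base using (_⊎_; inj₁; inj₂)
open import Data.Unit.Base using (⊤)
open import Data.Vec.Base as Vec using (Vec; []; _∷_; lookup; _[_]≔_)
import Data.Vec.Functional as Vector
open import Data.Vec.Functional using (Vector)
open import Data.Vec.Membership.Propositional.Properties using (∈-lookup)
import Data.Vec.Properties as Vec
open import Data.Vec.Relation.Unary.Any as Any using (Any; here; there)
open import Function.Base using (_∘_)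
open import Relation.Binary.PropositionalEquality
open import Relation.Nullary.Decidable using (Dec; yes; no; map′; _→-dec_; _⊎-dec_; _×-dec_)
open import Relation.Nullary.Negation using (¬_; contradiction)

-- Real numbers are Cauchy sequences of rationals, compared up to _≈_.

Cauchy : (ℕ → ℚ) → Set
Cauchy a = ∀ ε → 0ℚ ℚ.< ε →
  ∃[ N ] (∀ m n → N ℕ.≤ m → N ℕ.≤ n → ℚ.∣ a m ℚ.- a n ∣ ℚ.≤ ε)

record ℝ : Set where
  constructor real
  field
    seq    : ℕ → ℚ
    cauchy : Cauchy seq

open ℝ public

infix 4 _≈_ _≤_ _<_

_≈_ : ℝ → ℝ → Set
x ≈ y = ∀ ε → 0ℚ ℚ.< ε →
  ∃[ N ] (∀ m → N ℕ.≤ m → ℚ.∣ seq x m ℚ.- seq y m ∣ ℚ.≤ ε)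

_≤_ : ℝ → ℝ → Set
x ≤ y = ∀ ε → 0ℚ ℚ.< ε →
  ∃[ N ] (∀ m → N ℕ.≤ m → seq x m ℚ.≤ seq y m ℚ.+ ε)

_<_ : ℝ → ℝ → Set
x < y = ∃[ δ ] (0ℚ ℚ.< δ ×
  ∃[ N ] (∀ m → N ℕ.≤ m → seq x m ℚ.+ δ ℚ.≤ seq y m))

fromℚ : ℚ → ℝ
fromℚ q = real (λ _ → q) λ ε 0<ε → 0 , λ _ _ _ _ →
  subst (λ z → ℚ.∣ z ∣ ℚ.≤ ε) (sym (ℚ.+-inverseʳ q)) (ℚ.<⇒≤ 0<ε)

0ℝ 1ℝ 2ℝ : ℝ
0ℝ = fromℚ 0ℚ
1ℝ = fromℚ 1ℚ
2ℝ = fromℚ (1ℚ ℚ.+ 1ℚ)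

pos*pos : ∀ {p q} → 0ℚ ℚ.< p → 0ℚ ℚ.< q → 0ℚ ℚ.< p ℚ.* q
pos*pos {p} {q} 0<p 0<q =
  subst (ℚ._< p ℚ.* q) (ℚ.*-zeroʳ p)
    (ℚ.*-monoʳ-<-pos p {{ℚ.positive 0<p}} 0<q)

0<½ : 0ℚ ℚ.< ½
0<½ = ℚ.positive⁻¹ ½

half+half : ∀ ε → ½ ℚ.* ε ℚ.+ ½ ℚ.* ε ≡ ε
half+half ε = trans (sym (ℚ.*-distribʳ-+ ε ½ ½)) (ℚ.*-identityˡ ε)

*-mono-≤ : ∀ {a b c d} → 0ℚ ℚ.≤ c → 0ℚ ℚ.≤ b →
           a ℚ.≤ b → c ℚ.≤ d → a ℚ.* c ℚ.≤ b ℚ.* d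
*-mono-≤ {a} {b} {c} {d} 0≤c 0≤b a≤b c≤d = ℚ.≤-trans
  (ℚ.*-monoʳ-≤-nonNeg c {{ℚ.nonNegative 0≤c}} a≤b)
  (ℚ.*-monoˡ-≤-nonNeg b {{ℚ.nonNegative 0≤b}} c≤d)

1/-pos : ∀ {p} (0<p : 0ℚ ℚ.< p) →
         0ℚ ℚ.< (ℚ.1/ p) {{ℚ.>-nonZero 0<p}}
1/-pos {p} 0<p = ℚ.positive⁻¹ _ {{ℚ.1/pos⇒pos p {{ℚ.positive 0<p}}}}

EventuallyBounded : (ℕ → ℚ) → Set
EventuallyBounded a =
  Σ[ B ∈ ℚ ] (0ℚ ℚ.< B × ∃[ N ] (∀ m → N ℕ.≤ m → ℚ.∣ a m ∣ ℚ.≤ B))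

bounded : ∀ {a} → Cauchy a → EventuallyBounded a
bounded {a} c with c 1ℚ (ℚ.positive⁻¹ 1ℚ)
... | N , h = 1ℚ ℚ.+ ℚ.∣ a N ∣ , 0<B , N , λ m N≤m →
  subst (λ z → ℚ.∣ z ∣ ℚ.≤ _) (shift (a m) (a N))
    (ℚ.≤-trans (ℚ.∣p+q∣≤∣p∣+∣q∣ (a m ℚ.- a N) (a N))
      (ℚ.+-monoˡ-≤ ℚ.∣ a N ∣ (h m N N≤m ℕ.≤-refl)))
  where
  open +-*-Solver
  shift : ∀ p q → (p ℚ.- q) ℚ.+ q ≡ p
  shift = solve 2 (λ p q → (p :- q) :+ q := p) refl
  0<B : 0ℚ ℚ.< 1ℚ ℚ.+ ℚ.∣ a N ∣
  0<B = ℚ.+-mono-<-≤ (ℚ.positive⁻¹ 1ℚ) (ℚ.0≤∣p∣ (a N))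

+-cauchy : ∀ {a b} → Cauchy a → Cauchy b → Cauchy (λ m → a m ℚ.+ b m)
+-cauchy {a} {b} ca cb ε 0<ε
  with ca (½ ℚ.* ε) (pos*pos 0<½ 0<ε) | cb (½ ℚ.* ε) (pos*pos 0<½ 0<ε)
... | M , h | N , k = M ℕ.⊔ N , λ m n p q →
  subst₂ (λ z w → ℚ.∣ z ∣ ℚ.≤ w)
    (regroup (a m) (b m) (a n) (b n)) (half+half ε)
    (ℚ.≤-trans (ℚ.∣p+q∣≤∣p∣+∣q∣ (a m ℚ.- a n) (b m ℚ.- b n))
      (ℚ.+-mono-≤
        (h m n (ℕ.m⊔n≤o⇒m≤o M N p) (ℕ.m⊔n≤o⇒m≤o M N q))
        (k m n (ℕ.m⊔n≤o⇒n≤o M N p) (ℕ.m⊔n≤o⇒n≤o M N q))))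
  where
  open +-*-Solver
  regroup : ∀ p q r s → (p ℚ.- r) ℚ.+ (q ℚ.- s) ≡ (p ℚ.+ q) ℚ.- (r ℚ.+ s)
  regroup = solve 4
    (λ p q r s → (p :- r) :+ (q :- s) := (p :+ q) :- (r :+ s)) refl

neg-cauchy : ∀ {a} → Cauchy a → Cauchy (λ m → ℚ.- a m)
neg-cauchy {a} ca ε 0<ε with ca ε 0<ε
... | N , h = N , λ m n p q →
  subst (ℚ._≤ ε)
    (trans (sym (ℚ.∣-p∣≡∣p∣ (a m ℚ.- a n)))
           (cong ℚ.∣_∣ (ℚ.neg-distrib-+ (a m) (ℚ.- a n))))
    (h m n p q)

*-difference : ∀ p q r s →
  p ℚ.* q ℚ.- r ℚ.* s ≡ p ℚ.* (q ℚ.- s) ℚ.+ (p ℚ.- r) ℚ.* s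
*-difference = solve 4
  (λ p q r s → p :* q :- r :* s := p :* (q :- s) :+ (p :- r) :* s) refl
  where open +-*-Solver

*-cancel-1/ : ∀ p q .{{_ : ℚ.NonZero p}} → q ℚ.* (ℚ.1/ p) ℚ.* p ≡ q
*-cancel-1/ p q = trans (ℚ.*-assoc q (ℚ.1/ p) p)
  (trans (cong (q ℚ.*_) (ℚ.*-inverseˡ p)) (ℚ.*-identityʳ q))

*-close : ∀ p q r s {A B α β} → 0ℚ ℚ.≤ A → 0ℚ ℚ.≤ β →
  ℚ.∣ p ∣ ℚ.≤ A → ℚ.∣ q ℚ.- s ∣ ℚ.≤ α →
  ℚ.∣ p ℚ.- r ∣ ℚ.≤ β → ℚ.∣ s ∣ ℚ.≤ B →
  ℚ.∣ p ℚ.* q ℚ.- r ℚ.* s ∣ ℚ.≤ A ℚ.* α ℚ.+ β ℚ.* B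
*-close p q r s {A} {B} {α} {β} 0≤A 0≤β p≤ qs≤ pr≤ s≤ = begin
  ℚ.∣ p ℚ.* q ℚ.- r ℚ.* s ∣
    ≡⟨ cong ℚ.∣_∣ (*-difference p q r s) ⟩
  ℚ.∣ p ℚ.* (q ℚ.- s) ℚ.+ (p ℚ.- r) ℚ.* s ∣
    ≤⟨ ℚ.∣p+q∣≤∣p∣+∣q∣ (p ℚ.* (q ℚ.- s)) ((p ℚ.- r) ℚ.* s) ⟩
  ℚ.∣ p ℚ.* (q ℚ.- s) ∣ ℚ.+ ℚ.∣ (p ℚ.- r) ℚ.* s ∣
    ≡⟨ cong₂ ℚ._+_ (ℚ.∣p*q∣≡∣p∣*∣q∣ p (q ℚ.- s)) (ℚ.∣p*q∣≡∣p∣*∣q∣ (p ℚ.- r) s) ⟩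
  ℚ.∣ p ∣ ℚ.* ℚ.∣ q ℚ.- s ∣ ℚ.+ ℚ.∣ p ℚ.- r ∣ ℚ.* ℚ.∣ s ∣
    ≤⟨ ℚ.+-mono-≤ (*-mono-≤ (ℚ.0≤∣p∣ (q ℚ.- s)) 0≤A p≤ qs≤)
                  (*-mono-≤ (ℚ.0≤∣p∣ s) 0≤β pr≤ s≤) ⟩
  A ℚ.* α ℚ.+ β ℚ.* B ∎
  where open ℚ.≤-Reasoning

*-cauchy : ∀ {a b} → Cauchy a → Cauchy b → Cauchy (λ m → a m ℚ.* b m)
*-cauchy {a} {b} ca cb ε 0<ε =
  let
    A , 0<A , M , ∣a∣≤A = bounded {a} ca
    B , 0<B , N , ∣b∣≤B = bounded {b} cb
    ε/2 = ½ ℚ.* ε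
    α   = ε/2 ℚ.* (ℚ.1/ A) {{ℚ.>-nonZero 0<A}}
    β   = ε/2 ℚ.* (ℚ.1/ B) {{ℚ.>-nonZero 0<B}}
    0<α = pos*pos (pos*pos 0<½ 0<ε) (1/-pos 0<A)
    0<β = pos*pos (pos*pos 0<½ 0<ε) (1/-pos 0<B)
    M′ , h = ca β 0<β
    N′ , k = cb α 0<α
    total : A ℚ.* α ℚ.+ β ℚ.* B ≡ ε
    total = trans
      (cong₂ ℚ._+_
        (trans (ℚ.*-comm A α) (*-cancel-1/ A ε/2 {{ℚ.>-nonZero 0<A}}))
        (*-cancel-1/ B ε/2 {{ℚ.>-nonZero 0<B}}))
      (half+half ε)
  in (M ℕ.⊔ N) ℕ.⊔ (M′ ℕ.⊔ N′) , λ m n p q →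
    let
      p₁ = ℕ.m⊔n≤o⇒m≤o (M ℕ.⊔ N) (M′ ℕ.⊔ N′) p
      p₂ = ℕ.m⊔n≤o⇒n≤o (M ℕ.⊔ N) (M′ ℕ.⊔ N′) p
      q₁ = ℕ.m⊔n≤o⇒m≤o (M ℕ.⊔ N) (M′ ℕ.⊔ N′) q
      q₂ = ℕ.m⊔n≤o⇒n≤o (M ℕ.⊔ N) (M′ ℕ.⊔ N′) q
    in subst (ℚ.∣ a m ℚ.* b m ℚ.- a n ℚ.* b n ∣ ℚ.≤_) total
      (*-close (a m) (b m) (a n) (b n) (ℚ.<⇒≤ 0<A) (ℚ.<⇒≤ 0<β)
        (∣a∣≤A m (ℕ.m⊔n≤o⇒m≤o M N p₁))
        (k m n (ℕ.m⊔n≤o⇒n≤o M′ N′ p₂) (ℕ.m⊔n≤o⇒n≤o M′ N′ q₂))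
        (h m n (ℕ.m⊔n≤o⇒m≤o M′ N′ p₂) (ℕ.m⊔n≤o⇒m≤o M′ N′ q₂))
        (∣b∣≤B n (ℕ.m⊔n≤o⇒n≤o M N q₁)))

infixl 7 _*_
infixl 6 _+_ _-_

_+_ : ℝ → ℝ → ℝ
x + y = real (λ m → seq x m ℚ.+ seq y m) (+-cauchy {seq x} {seq y} (cauchy x) (cauchy y))

_-_ : ℝ → ℝ → ℝ
x - y = real (λ m → seq x m ℚ.- seq y m)
             (+-cauchy {seq x} {λ m → ℚ.- seq y m}
               (cauchy x) (neg-cauchy {seq y} (cauchy y)))

_*_ : ℝ → ℝ → ℝ
x * y = real (λ m → seq x m ℚ.* seq y m) (*-cauchy {seq x} {seq y} (cauchy x) (cauchy y))

0<⊔ : ∀ q {δ} → 0ℚ ℚ.< δ → 0ℚ ℚ.< q ℚ.⊔ δ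
0<⊔ q {δ} 0<δ = ℚ.<-≤-trans 0<δ (ℚ.p≤q⊔p q δ)

cut-1/ : (δ : ℚ) → 0ℚ ℚ.< δ → ℚ → ℚ
cut-1/ δ 0<δ q = (ℚ.1/ (q ℚ.⊔ δ)) {{ℚ.>-nonZero (0<⊔ q 0<δ)}}

1/-cauchy : ∀ {a} δ (0<δ : 0ℚ ℚ.< δ) →
  ∃[ N ] (∀ m → N ℕ.≤ m → δ ℚ.≤ a m) →
  Cauchy a → Cauchy (λ m → cut-1/ δ 0<δ (a m))
1/-cauchy {a} δ 0<δ (M , δ≤a) ca ε 0<ε
  with ca (ε ℚ.* (δ ℚ.* δ)) (pos*pos 0<ε (pos*pos 0<δ 0<δ))
... | N , h = M ℕ.⊔ N , λ m n p q →
  bound (a m) (a n)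
    (δ≤a m (ℕ.m⊔n≤o⇒m≤o M N p)) (δ≤a n (ℕ.m⊔n≤o⇒m≤o M N q))
    (h m n (ℕ.m⊔n≤o⇒n≤o M N p) (ℕ.m⊔n≤o⇒n≤o M N q))
  where
  open ℚ.≤-Reasoning

  difference : ∀ r s r′ s′ → r ℚ.* r′ ≡ 1ℚ → s ℚ.* s′ ≡ 1ℚ →
               (r ℚ.- s) ℚ.* (r′ ℚ.* s′) ≡ s′ ℚ.- r′
  difference r s r′ s′ rr′≡1 ss′≡1 = trans (expand r s r′ s′)
    (cong₂ ℚ._-_
      (trans (cong (ℚ._* s′) rr′≡1) (ℚ.*-identityˡ s′))
      (trans (cong (ℚ._* r′) ss′≡1) (ℚ.*-identityˡ r′)))
    where
    open +-*-Solver
    expand : ∀ r s r′ s′ → (r ℚ.- s) ℚ.* (r′ ℚ.* s′)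
                         ≡ (r ℚ.* r′) ℚ.* s′ ℚ.- (s ℚ.* s′) ℚ.* r′
    expand = solve 4 (λ r s r′ s′ → (r :- s) :* (r′ :* s′)
                                 := (r :* r′) :* s′ :- (s :* s′) :* r′) refl

  reciprocal : ∀ r → δ ℚ.≤ r → r ℚ.* cut-1/ δ 0<δ r ≡ 1ℚ
  reciprocal r δ≤r =
    trans (cong (ℚ._* cut-1/ δ 0<δ r) (sym (ℚ.p≥q⇒p⊔q≡p δ≤r)))
          (ℚ.*-inverseʳ (r ℚ.⊔ δ) {{ℚ.>-nonZero (0<⊔ r 0<δ)}})

  bound : ∀ r s → δ ℚ.≤ r → δ ℚ.≤ s →
          ℚ.∣ r ℚ.- s ∣ ℚ.≤ ε ℚ.* (δ ℚ.* δ) →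
          ℚ.∣ cut-1/ δ 0<δ r ℚ.- cut-1/ δ 0<δ s ∣ ℚ.≤ ε
  bound r s δ≤r δ≤s ∣r-s∣≤ =
    ℚ.*-cancelʳ-≤-pos (r ℚ.* s) {{ℚ.positive 0<rs}} (begin
      ℚ.∣ r′ ℚ.- s′ ∣ ℚ.* (r ℚ.* s)
        ≡⟨ cong (ℚ.∣ r′ ℚ.- s′ ∣ ℚ.*_)
             (sym (ℚ.0≤p⇒∣p∣≡p (ℚ.<⇒≤ 0<rs))) ⟩
      ℚ.∣ r′ ℚ.- s′ ∣ ℚ.* ℚ.∣ r ℚ.* s ∣
        ≡⟨ sym (ℚ.∣p*q∣≡∣p∣*∣q∣ (r′ ℚ.- s′) (r ℚ.* s)) ⟩
      ℚ.∣ (r′ ℚ.- s′) ℚ.* (r ℚ.* s) ∣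
        ≡⟨ cong ℚ.∣_∣ (difference r′ s′ r s
             (trans (ℚ.*-comm r′ r) (reciprocal r δ≤r))
             (trans (ℚ.*-comm s′ s) (reciprocal s δ≤s))) ⟩
      ℚ.∣ s ℚ.- r ∣
        ≡⟨ sym (trans (cong ℚ.∣_∣ (flip r s)) (ℚ.∣-p∣≡∣p∣ (s ℚ.- r))) ⟩
      ℚ.∣ r ℚ.- s ∣
        ≤⟨ ∣r-s∣≤ ⟩
      ε ℚ.* (δ ℚ.* δ)
        ≤⟨ ℚ.*-monoˡ-≤-nonNeg ε {{ℚ.nonNegative (ℚ.<⇒≤ 0<ε)}}
             (*-mono-≤ (ℚ.<⇒≤ 0<δ) (ℚ.<⇒≤ 0<r) δ≤r δ≤s) ⟩
      ε ℚ.* (r ℚ.* s) ∎)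
    where
    r′ = cut-1/ δ 0<δ r
    s′ = cut-1/ δ 0<δ s
    0<r  = ℚ.<-≤-trans 0<δ δ≤r
    0<rs = pos*pos 0<r (ℚ.<-≤-trans 0<δ δ≤s)
    flip : ∀ p q → p ℚ.- q ≡ ℚ.- (q ℚ.- p)
    flip = solve 2 (λ p q → p :- q := :- (q :- p)) refl
      where open +-*-Solver

-- The proof of 0 < x supplies a rational δ > 0 with δ ≤ xₘ for all large m;
-- replacing xₘ by max(xₘ , δ) changes only finitely many terms and makes all
-- of them invertible.
recip : (x : ℝ) → 0ℝ < x → ℝ
recip x (δ , 0<δ , N , h) =
  real (λ m → cut-1/ δ 0<δ (seq x m))
       (1/-cauchy {seq x} δ 0<δ
         (N , λ m N≤m → subst (ℚ._≤ seq x m) (ℚ.+-identityˡ δ) (h m N≤m))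
         (cauchy x))

ratio : (x y : ℝ) → 0ℝ < y → ℝ
ratio x y 0<y = x * recip y 0<y

∑ ∏ : ∀ {n} → Vector ℝ n → ℝ
∑ = Vector.foldr _+_ 0ℝ
∏ = Vector.foldr _*_ 1ℝ

UpperBound : (ℝ → Set) → ℝ → Set
UpperBound A u = ∀ r → A r → r ≤ u

IsSupremum : (ℝ → Set) → ℝ → Set
IsSupremum A b = UpperBound A b × (∀ u → UpperBound A u → b ≤ u)

BoolFun : ℕ → Set
BoolFun n = Vec Bool n → Bool

kOfN : ∀ {n} → ℕ → BoolFun n
kOfN k x = k ℕ.≤ᵇ Vec.sum (Vec.map (λ b → if b then 1 else 0) x)

-- nothing plays the role of •.
State : ℕ → Set
State n = Vec (Maybe Bool) n

initial : ∀ {n} → State n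
initial = Vec.replicate _ nothing

Incomplete : ∀ {n} → State n → Set
Incomplete = Any (_≡ nothing)

unknowns : ∀ {n} → State n → ℕ
unknowns = Vec.countᵇ is-nothing

_FollowsFrom_ : ∀ {n} → Vec Bool n → State n → Set
x FollowsFrom s = ∀ i → lookup s i ≡ just (lookup x i) ⊎ lookup s i ≡ nothing

Determined : ∀ {n} → BoolFun n → State n → Set
Determined f s = ∀ x y → x FollowsFrom s → y FollowsFrom s → f x ≡ f y

followsFrom? : ∀ {n} (x : Vec Bool n) s → Dec (x FollowsFrom s)
followsFrom? x s = Fin.all? λ i →
  Maybe.≡-dec Bool._≟_ (lookup s i) (just (lookup x i))
    ⊎-dec Maybe.≡-dec Bool._≟_ (lookup s i) nothing

allVec? : ∀ {n} {P : Vec Bool n → Set} → (∀ x → Dec (P x)) → Dec (∀ x → P x)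
allVec? {zero}  P? = map′ (λ { p [] → p }) (λ p → p []) (P? [])
allVec? {suc n} P? = map′
  (λ { (p , q) (true ∷ x) → p x ; (p , q) (false ∷ x) → q x })
  (λ p → p ∘ (true ∷_) , p ∘ (false ∷_))
  (allVec? (P? ∘ (true ∷_)) ×-dec allVec? (P? ∘ (false ∷_)))

determined? : ∀ {n} (f : BoolFun n) s → Dec (Determined f s)
determined? f s = allVec? λ x → allVec? λ y →
  followsFrom? x s →-dec followsFrom? y s →-dec f x Bool.≟ f y

undetermined⇒incomplete : ∀ {n} (f : BoolFun n) s →
                          ¬ Determined f s → Incomplete s
undetermined⇒incomplete f s ¬det
  with Any.any? (λ v → Maybe.≡-dec Bool._≟_ v nothing) s
... | yes h = h
... | no ¬h = contradiction (λ x y xs ys → cong f (unique x y xs ys)) ¬det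
  where
  known : ∀ x → x FollowsFrom s → ∀ i → lookup s i ≡ just (lookup x i)
  known x xs i with xs i
  ... | inj₁ eq = eq
  ... | inj₂ eq = contradiction (Any.map (λ e → trans (sym e) eq) (∈-lookup i s)) ¬h
  unique : ∀ x y → x FollowsFrom s → y FollowsFrom s → x ≡ y
  unique x y xs ys = begin
    x                          ≡⟨ Vec.tabulate∘lookup x ⟨
    Vec.tabulate (lookup x)    ≡⟨ Vec.tabulate-cong (λ i → Maybe.just-injective
                                    (trans (sym (known x xs i)) (known y ys i))) ⟩
    Vec.tabulate (lookup y)    ≡⟨ Vec.tabulate∘lookup y ⟩
    y                          ∎
    where open ≡-Reasoning

-- Irrelevance of the incompleteness proof makes the choice a function of
-- the state alone.
record Policy (n : ℕ) : Set where
  field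
    choose   : (s : State n) → .(Incomplete s) → Fin n
    untested : ∀ s .(h : Incomplete s) → lookup s (choose s h) ≡ nothing

open Policy public

data Reachable {n} (π : Policy n) : State n → Set where
  start : Reachable π initial
  step  : ∀ {s} → Reachable π s → .(h : Incomplete s) → (b : Bool) →
          Reachable π (s [ choose π s h ]≔ just b)

-- The choice depends only on the number of unknown variables.  This has to
-- be restricted to states that π can reach: with two or more variables, the
-- states having a single unknown force different choices, so no policy
-- satisfies the condition on all states.  On reachable states it says that π
-- tests the variables in a fixed order.
NonAdaptive : ∀ {n} → Policy n → Set
NonAdaptive π = ∀ {s t} → Reachable π s → Reachable π t →
  .(hs : Incomplete s) .(ht : Incomplete t) →
  unknowns s ≡ unknowns t → choose π s hs ≡ choose π t ht

-- The first argument bounds the number of further tests.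
run : ∀ {n} → ℕ → BoolFun n → Policy n → Vec Bool n → State n → State n
run zero    f π x s = s
run (suc m) f π x s with determined? f s
... | yes _   = s
... | no ¬det = run m f π x (s [ i ]≔ just (lookup x i))
  where i = choose π s (undetermined⇒incomplete f s ¬det)

finalState : ∀ {n} → BoolFun n → Policy n → Vec Bool n → State n
finalState {n} f π x = run n f π x initial

-- n tests always suffice, so a run ends only once f is determined.
unknowns-test : ∀ {n} (s : State n) i b → lookup s i ≡ nothing →
                unknowns s ≡ suc (unknowns (s [ i ]≔ just b))
unknowns-test (nothing ∷ s) zero    b eq = refl
unknowns-test (nothing ∷ s) (suc i) b eq = cong suc (unknowns-test s i b eq)
unknowns-test (just _ ∷ s)  (suc i) b eq = unknowns-test s i b eq

incomplete⇒0<unknowns : ∀ {n} {s : State n} → Incomplete s → 0 ℕ.< unknowns s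
incomplete⇒0<unknowns                   (here refl) = ℕ.z<s
incomplete⇒0<unknowns {s = nothing ∷ _} (there h)   = ℕ.z<s
incomplete⇒0<unknowns {s = just _ ∷ _}  (there h)   = incomplete⇒0<unknowns h

run-determined : ∀ {n} m f (π : Policy n) x s → unknowns s ℕ.≤ m →
                 Determined f (run m f π x s)
run-determined zero f π x s u≤0 with determined? f s
... | yes det = det
... | no ¬det = contradiction u≤0
  (ℕ.<⇒≱ (incomplete⇒0<unknowns (undetermined⇒incomplete f s ¬det)))
run-determined (suc m) f π x s u≤m with determined? f s
... | yes det = det
... | no ¬det = run-determined m f π x (s [ i ]≔ just (lookup x i))
  (ℕ.s≤s⁻¹ (subst (ℕ._≤ suc m)
    (unknowns-test s i (lookup x i) (untested π s inc)) u≤m))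
  where
  inc = undetermined⇒incomplete f s ¬det
  i   = choose π s inc

finalState-determined : ∀ {n} f (π : Policy n) x → Determined f (finalState f π x)
finalState-determined {n} f π x =
  run-determined n f π x initial (Vec.count≤n _ initial)

cost : ∀ {n} → BoolFun n → Vector ℝ n → Policy n → Vec Bool n → ℝ
cost f c π x = ∑ λ i → if is-just (lookup (finalState f π x) i) then c i else 0ℝ

cube : ∀ n → List (Vec Bool n)
cube zero    = [] List.∷ List.[]
cube (suc n) = List.map (true ∷_) (cube n) List.++ List.map (false ∷_) (cube n)

probability : ∀ {n} → Vector ℝ n → Vec Bool n → ℝ
probability p x = ∏ λ i → if lookup x i then p i else 1ℝ - p i

expectation : ∀ {n} → Vector ℝ n → (Vec Bool n → ℝ) → ℝ
expectation {n} p g =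
  List.foldr _+_ 0ℝ (List.map (λ x → probability p x * g x) (cube n))

record Instance : Set where
  field
    n k : ℕ
    1≤k : 1 ℕ.≤ k
    k≤n : k ℕ.≤ n
    c   : Vector ℝ n
    0≤c : ∀ i → 0ℝ ≤ c i
    p   : Vector ℝ n
    0<p : ∀ i → 0ℝ < p i
    p<1 : ∀ i → p i < 1ℝ

  expectedCost : Policy n → ℝ
  expectedCost π = expectation p (cost (kOfN k) c π)

  Minimizes : (Policy n → Set) → Policy n → Set
  Minimizes C π = C π × (∀ π′ → C π′ → expectedCost π ≤ expectedCost π′)

  IsOPT IsOPT-NA : Policy n → Set
  IsOPT    = Minimizes (λ _ → ⊤)
  IsOPT-NA = Minimizes NonAdaptive

AdaptivityRatio : ℝ → Set
AdaptivityRatio r =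
  Σ[ I ∈ Instance ] (let open Instance I in
    Σ[ opt   ∈ Policy n ] Σ[ optNA ∈ Policy n ]
      IsOPT opt × IsOPT-NA optNA ×
      Σ[ pos ∈ 0ℝ < expectedCost opt ]
        r ≈ ratio (expectedCost optNA) (expectedCost opt) pos)

{-# OPTIONS --safe #-}

-- Upper bound.  On the inputs with value 1 a policy must find k ones, and by an
-- exchange argument no policy does so more cheaply in expectation than testing
-- by increasing c / p; symmetrically by c / (1 - p) on the inputs with value 0.
-- The optimum is at least the sum V₁ + V₀ of the two costs.  Give every variable
-- the smaller of its cumulative costs in the two orders and test by increasing
-- key: if one order finishes at cost a, only variables of key at most a are
-- tested, and these cost at most 2 a.  Hence this non-adaptive policy costs at
-- most 2 (V₁ + V₀).  Real data are handled by applying this to the rational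
-- approximations at each index; as there are finitely many non-adaptive
-- policies, the optimal one is eventually compared with all of them at once.
--
-- Lower bound.  Take R variables that are almost surely 1 and R that are almost
-- surely 0, all of unit cost, and many fair coins of cost 0, such that the coins
-- leave a nearly uniform target: either j ones or j zeros remain to be found,
-- with 1 ≤ j ≤ R.  Adaptively this costs about j, on average (R + 1) / 2.  A
-- fixed order resolves at most one further target per unit of cost, so that it
-- costs (2 R + 1) / 2 on average, and the ratio tends to 2.
module Submission where

open import Data.Bool.Base using (Bool; true; false; not; if_then_else_)
open import Data.Bool.Properties using (T-≡)
open import Data.Empty.Irrelevant using (⊥-elim)
open import Data.Fin.Base using (Fin; zero; suc; _↑ˡ_; _↑ʳ_)
open import Data.Fin.Properties using () renaming (_≟_ to _≟ᶠ_)
open import Data.Integer.Base as ℤ using (-[1+_])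
import Data.Integer.Properties as ℤ
open import Data.List.Base as List using (List; []; _∷_; length; allFin)
open import Data.List.Membership.Propositional using (_∈_)
open import Data.List.Membership.Propositional.Properties using (∈-allFin)
open import Data.List.Properties using (map-tabulate; length-tabulate)
open import Data.List.Relation.Binary.Permutation.Propositional
  using (_↭_; ↭-refl; ↭-prep; ↭-swap; ↭-sym; ↭-trans; ↭⇒↭ₛ)
import Data.List.Relation.Binary.Permutation.Propositional as Perm
open import Data.List.Relation.Binary.Permutation.Propositional.Properties
  using (drop-∷; map⁺; ∈-resp-↭; ↭-length)
import Data.List.Relation.Binary.Permutation.Setoid.Properties as Permₛ
open import Data.List.Relation.Unary.All as All using (All; []; _∷_)
open import Data.List.Relation.Unary.AllPairs as AllPairs using (AllPairs; []; _∷_)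
open import Data.List.Relation.Unary.Any using (here; there)
open import Data.List.Relation.Unary.Linked.Properties using (Linked⇒AllPairs)
open import Data.List.Relation.Unary.Unique.Propositional using (Unique)
open import Data.List.Relation.Unary.Unique.Propositional.Properties using (allFin⁺)
import Data.List.Sort as Sort
open import Data.Maybe.Base as Maybe using (Maybe; just; nothing; is-just; is-nothing)
import Data.Maybe.Properties as Maybe
open import Data.Nat.Base as ℕ using (ℕ; zero; suc)
import Data.Nat.Coprimality as Coprime
import Data.Nat.ListAction as ℕ
import Data.Nat.ListAction.Properties as ℕ
import Data.Nat.Properties as ℕ
import Data.Nat.Tactic.RingSolver as ℕ-Solver
open import Data.Product.Base using (Σ-syntax; ∃-syntax; _×_; _,_; proj₁; proj₂)
open import Data.Rational.Base
open import Data.Rational.Properties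
open import Data.Sum.Base using (_⊎_; inj₁; inj₂)
open import Data.Unit.Base using (tt)
open import Data.Vec.Base as Vec using (Vec; []; _∷_; lookup; _[_]≔_; _++_; replicate)
import Data.Vec.Functional as Vector
open import Data.Vec.Properties
  using (lookup∘update; lookup∘update′; lookup-map; lookup-replicate; lookup-++ˡ; lookup-++ʳ;
         map-[]≔; []≔-++-↑ˡ; []≔-++-↑ʳ)
open import Data.Vec.Relation.Unary.Any using (here; there)
open import Function.Base using (_∘_; case_of_)
open import Function.Bundles using (Equivalence)
open import Level using (0ℓ)
import Relation.Binary.Construct.On as On
open import Relation.Binary.PropositionalEquality
open import Relation.Nullary.Decidable using (Dec; yes; no; dec⇒maybe)
open import Relation.Nullary.Negation using (¬_; contradiction)
open import Tactic.RingSolver using (solve-∀)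
open import Tactic.RingSolver.Core.AlmostCommutativeRing
  using (AlmostCommutativeRing; fromCommutativeRing)
open import Defs hiding (_≈_; _≤_; _<_; _+_; _*_; _-_; *-mono-≤)
import Defs as ℝ

-- Rational arithmetic and the exchange argument

-- The bound by `V₁ + V₀` is an induction on the state that follows both orders at once. Finding `k`
-- ones and finding `k̄ = n + 1 - k` zeros are complementary goals, so their probabilities add up to
-- 1 and the two orders together charge each test exactly its cost. This is why two fixed lists can
-- be compared with an arbitrary adaptive policy.
--
-- Comparison of Cauchy reals is undecidable, so no order by ratios and no cheapest policy can be
-- selected from real data. The combinatorics therefore takes place over the rationals, and the good
-- policy found there changes with the index of the approximation; finiteness of the set of orders
-- lets an inequality known for each order be used for a varying one. The instances for the lower
-- bound have rational data, so that their optima are computed outright.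
--
-- The gap comes from two pools of costly variables: the free coins tell an adaptive policy which
-- pool to use, while a fixed order has to serve both targets blindly.

ℚ-ring : AlmostCommutativeRing 0ℓ 0ℓ
ℚ-ring = fromCommutativeRing +-*-commutativeRing λ q → dec⇒maybe (0ℚ ≟ q)

≤-by : ∀ {a b} d → 0ℚ ≤ d → a + d ≡ b → a ≤ b
≤-by {a} d 0≤d refl = subst (_≤ a + d) (+-identityʳ a) (+-monoʳ-≤ a 0≤d)

0≤-diff : ∀ {a b} → a ≤ b → 0ℚ ≤ b - a
0≤-diff {a} {b} a≤b = subst (_≤ b - a) (+-inverseʳ a) (+-monoˡ-≤ (- a) a≤b)

0≤+ : ∀ {a b} → 0ℚ ≤ a → 0ℚ ≤ b → 0ℚ ≤ a + b
0≤+ 0≤a 0≤b = +-mono-≤ 0≤a 0≤b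

0≤* : ∀ {a b} → 0ℚ ≤ a → 0ℚ ≤ b → 0ℚ ≤ a * b
0≤* {a} {b} 0≤a 0≤b =
  subst (_≤ a * b) (*-zeroʳ a) (*-monoˡ-≤-nonNeg a {{nonNegative 0≤a}} 0≤b)

*-monoˡ : ∀ {a b c} → 0ℚ ≤ c → a ≤ b → c * a ≤ c * b
*-monoˡ {c = c} 0≤c = *-monoˡ-≤-nonNeg c {{nonNegative 0≤c}}

½≤1 : ½ ≤ 1ℚ
½≤1 = ≤-by ½ (nonNegative⁻¹ ½) refl

module _ {I : Set} where

  data Remove (i : I) : List I → List I → Set where
    here  : ∀ {l} → Remove i (i ∷ l) l
    there : ∀ {j l l′} → Remove i l l′ → Remove i (j ∷ l) (j ∷ l′)

  Remove-All : ∀ {i l l′} {P : I → Set} → Remove i l l′ → All P l → All P l′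
  Remove-All here      (_ ∷ ps) = ps
  Remove-All (there r) (p ∷ ps) = p ∷ Remove-All r ps

  Remove-AllPairs : ∀ {i l l′} {R : I → I → Set} →
                    Remove i l l′ → AllPairs R l → AllPairs R l′
  Remove-AllPairs here      (_ ∷ rs) = rs
  Remove-AllPairs (there r) (p ∷ rs) = Remove-All r p ∷ Remove-AllPairs r rs

  Remove-length : ∀ {i l l′} → Remove i l l′ → length l ≡ suc (length l′)
  Remove-length here      = refl
  Remove-length (there r) = cong suc (Remove-length r)

  Remove-↭ : ∀ {i l l′} → Remove i l l′ → l ↭ i ∷ l′
  Remove-↭ here = ↭-refl
  Remove-↭ (there {j} r) = ↭-trans (↭-prep j (Remove-↭ r)) (↭-swap j _ ↭-refl)

  Remove-at : ∀ {i l l′} {P : I → Set} → Remove i l l′ → All P l → P i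
  Remove-at here      (p ∷ _)  = p
  Remove-at (there r) (_ ∷ ps) = Remove-at r ps

module Tail {I : Set} (ρ : I → ℚ) where

  -- The upper tail of a Poisson binomial distribution: the probability that independent trials with
  -- success probabilities `ρ` over `l` give at least `k` successes, by conditioning on the first
  -- trial.
  tail : List I → ℕ → ℚ
  tail _       zero    = 1ℚ
  tail []      (suc k) = 0ℚ
  tail (i ∷ l) (suc k) = ρ i * tail l k + (1ℚ - ρ i) * tail l (suc k)

  -- The number of successes does not depend on the order of the trials, so one may condition on any
  -- trial instead of the head.
  tail-remove : ∀ {i l l′} → Remove i l l′ → ∀ k →
                tail l (suc k) ≡ ρ i * tail l′ k + (1ℚ - ρ i) * tail l′ (suc k)
  tail-remove here k = refl
  tail-remove {i} {j ∷ l} {_ ∷ l′} (there r) zero =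
    trans (cong (λ t → ρ j * 1ℚ + (1ℚ - ρ j) * t) (tail-remove r zero)) (lemma (ρ i) (ρ j) (tail l′ 1))
    where
    lemma : ∀ p q t → q * 1ℚ + (1ℚ - q) * (p * 1ℚ + (1ℚ - p) * t)
                    ≡ p * 1ℚ + (1ℚ - p) * (q * 1ℚ + (1ℚ - q) * t)
    lemma = solve-∀ ℚ-ring
  tail-remove {i} {j ∷ l} {_ ∷ l′} (there r) (suc k) =
    trans (cong₂ (λ t u → ρ j * t + (1ℚ - ρ j) * u) (tail-remove r k) (tail-remove r (suc k)))
          (lemma (ρ i) (ρ j) (tail l′ k) (tail l′ (suc k)) (tail l′ (suc (suc k))))
    where
    lemma : ∀ p q t u v →
      q * (p * t + (1ℚ - p) * u) + (1ℚ - q) * (p * u + (1ℚ - p) * v) ≡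
      p * (q * t + (1ℚ - q) * u) + (1ℚ - p) * (q * u + (1ℚ - q) * v)
    lemma = solve-∀ ℚ-ring

  tail-long : ∀ l {k} → length l ℕ.< k → tail l k ≡ 0ℚ
  tail-long []      {suc k} _ = refl
  tail-long (i ∷ l) {suc k} (ℕ.s≤s |l|<k) =
    trans (cong₂ (λ t u → ρ i * t + (1ℚ - ρ i) * u) (tail-long l |l|<k) (tail-long l (ℕ.m≤n⇒m≤1+n |l|<k)))
          (lemma (ρ i))
    where
    lemma : ∀ p → p * 0ℚ + (1ℚ - p) * 0ℚ ≡ 0ℚ
    lemma = solve-∀ ℚ-ring

  tail-↭ : ∀ {l l′} → l ↭ l′ → ∀ k → tail l k ≡ tail l′ k
  tail-↭ p zero = refl
  tail-↭ Perm.refl (suc k) = refl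
  tail-↭ (Perm.prep i p) (suc k) = cong₂ (λ t u → ρ i * t + (1ℚ - ρ i) * u) (tail-↭ p k) (tail-↭ p (suc k))
  tail-↭ (Perm.swap {l} {l′} i j p) (suc k) = trans (tail-remove {l′ = i ∷ l} (there here) k)
    (cong₂ (λ t u → ρ j * t + (1ℚ - ρ j) * u) (prepend k) (prepend (suc k)))
    where
    prepend : ∀ k → tail (i ∷ l) k ≡ tail (i ∷ l′) k
    prepend zero    = refl
    prepend (suc k) = cong₂ (λ t u → ρ i * t + (1ℚ - ρ i) * u) (tail-↭ p k) (tail-↭ p (suc k))
  tail-↭ (Perm.trans p q) (suc k) = trans (tail-↭ p (suc k)) (tail-↭ q (suc k))

module Ordered {I : Set} (c ρ : I → ℚ) where

  open Tail ρ public

  -- The expected cost, on the event that l contains at least k successes, of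
  -- testing l in order up to the k-th success.
  successCost : List I → ℕ → ℚ
  successCost _       zero    = 0ℚ
  successCost []      (suc k) = 0ℚ
  successCost (i ∷ l) (suc k) =
    c i * tail (i ∷ l) (suc k) + (ρ i * successCost l k + (1ℚ - ρ i) * successCost l (suc k))

  successCost-long : ∀ l {k} → length l ℕ.< k → successCost l k ≡ 0ℚ
  successCost-long []      {suc k} _ = refl
  successCost-long (i ∷ l) {suc k} |l|<k@(ℕ.s≤s |l|<k′) =
    trans (cong₂ (λ t u → c i * t + u) (tail-long (i ∷ l) |l|<k)
            (cong₂ (λ t u → ρ i * t + (1ℚ - ρ i) * u)
              (successCost-long l |l|<k′) (successCost-long l (ℕ.m≤n⇒m≤1+n |l|<k′))))
          (lemma (c i) (ρ i))
    where
    lemma : ∀ c p → c * 0ℚ + (p * 0ℚ + (1ℚ - p) * 0ℚ) ≡ 0ℚ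
    lemma = solve-∀ ℚ-ring

  module _ (0≤ρ : ∀ i → 0ℚ ≤ ρ i) (ρ≤1 : ∀ i → ρ i ≤ 1ℚ) where

    -- Moving i behind a better j changes the cost only if the next success
    -- is the last one needed, and then by c i * ρ j - c j * ρ i.
    exchange : ∀ {i l l′} → Remove i l l′ →
      AllPairs (λ i j → c i * ρ j ≤ c j * ρ i) l → ∀ k →
      successCost l (suc k) ≤
      c i * tail l (suc k) + (ρ i * successCost l′ k + (1ℚ - ρ i) * successCost l′ (suc k))
    exchange here _ k = ≤-refl
    exchange {i} {j ∷ l} {_ ∷ l′} (there r) (j≤ ∷ sorted) zero =
      ≤-trans (+-monoʳ-≤ (c j * tail (j ∷ l) 1) (+-monoʳ-≤ (ρ j * 0ℚ)
                (*-monoˡ (0≤-diff (ρ≤1 j)) (exchange r sorted zero))))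
        (subst (λ t → c j * (ρ j * 1ℚ + (1ℚ - ρ j) * t)
                      + (ρ j * 0ℚ + (1ℚ - ρ j) * (c i * t + (ρ i * 0ℚ + (1ℚ - ρ i) * successCost l′ 1)))
                    ≤ c i * (ρ j * 1ℚ + (1ℚ - ρ j) * t)
                      + (ρ i * 0ℚ + (1ℚ - ρ i) * successCost (j ∷ l′) 1))
          (sym (tail-remove r zero))
          (≤-by _ (0≤-diff (Remove-at r j≤)) (lemma (c j) (c i) (ρ j) (ρ i) (tail l′ 1) (successCost l′ 1))))
      where
      lemma : ∀ cj ci q p t v →
        (cj * (q * 1ℚ + (1ℚ - q) * (p * 1ℚ + (1ℚ - p) * t))
          + (q * 0ℚ + (1ℚ - q) * (ci * (p * 1ℚ + (1ℚ - p) * t) + (p * 0ℚ + (1ℚ - p) * v))))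
        + (ci * q - cj * p) ≡
        ci * (q * 1ℚ + (1ℚ - q) * (p * 1ℚ + (1ℚ - p) * t))
          + (p * 0ℚ + (1ℚ - p) * (cj * (q * 1ℚ + (1ℚ - q) * t) + (q * 0ℚ + (1ℚ - q) * v)))
      lemma = solve-∀ ℚ-ring
    exchange {i} {j ∷ l} {_ ∷ l′} (there r) (j≤ ∷ sorted) (suc k) =
      ≤-trans (+-monoʳ-≤ (c j * tail (j ∷ l) (suc (suc k))) (+-mono-≤
                (*-monoˡ (0≤ρ j) (exchange r sorted k))
                (*-monoˡ (0≤-diff (ρ≤1 j)) (exchange r sorted (suc k)))))
        (≤-reflexive (trans
          (cong₂ (λ t u → c j * (ρ j * t + (1ℚ - ρ j) * u)
                        + (ρ j * (c i * t + (ρ i * successCost l′ k + (1ℚ - ρ i) * successCost l′ (suc k)))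
                        + (1ℚ - ρ j) * (c i * u + (ρ i * successCost l′ (suc k) + (1ℚ - ρ i) * successCost l′ (suc (suc k))))))
            (tail-remove r k) (tail-remove r (suc k)))
          (trans (lemma (c j) (c i) (ρ j) (ρ i) (tail l′ k) (tail l′ (suc k)) (tail l′ (suc (suc k)))
                   (successCost l′ k) (successCost l′ (suc k)) (successCost l′ (suc (suc k))))
            (cong₂ (λ t u → c i * (ρ j * t + (1ℚ - ρ j) * u)
                        + (ρ i * successCost (j ∷ l′) (suc k) + (1ℚ - ρ i) * successCost (j ∷ l′) (suc (suc k))))
              (sym (tail-remove r k)) (sym (tail-remove r (suc k)))))))
      where
      lemma : ∀ cj ci q p t u w x y z →
        cj * (q * (p * t + (1ℚ - p) * u) + (1ℚ - q) * (p * u + (1ℚ - p) * w))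
        + (q * (ci * (p * t + (1ℚ - p) * u) + (p * x + (1ℚ - p) * y))
          + (1ℚ - q) * (ci * (p * u + (1ℚ - p) * w) + (p * y + (1ℚ - p) * z))) ≡
        ci * (q * (p * t + (1ℚ - p) * u) + (1ℚ - q) * (p * u + (1ℚ - p) * w))
        + (p * (cj * (q * t + (1ℚ - q) * u) + (q * x + (1ℚ - q) * y))
          + (1ℚ - p) * (cj * (q * u + (1ℚ - q) * w) + (q * y + (1ℚ - q) * z)))
      lemma = solve-∀ ℚ-ring

-- If `k + k′` exceeds the number of trials by one, then either at least `k` trials succeed or at
-- least `k′` fail, and never both.
tail-complement : ∀ {I : Set} (ρ : I → ℚ) l {k k′} → k ℕ.+ k′ ≡ suc (length l) →
  Tail.tail ρ l k + Tail.tail (λ i → 1ℚ - ρ i) l k′ ≡ 1ℚ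
tail-complement ρ l {zero} refl =
  cong (1ℚ +_) (Tail.tail-long (λ i → 1ℚ - ρ i) l ℕ.≤-refl)
tail-complement ρ l {suc k} {zero} eq =
  cong (_+ 1ℚ) (Tail.tail-long ρ l
    (ℕ.≤-reflexive (trans (sym eq) (ℕ.+-identityʳ (suc k)))))
tail-complement ρ [] {suc k} {suc k′} eq with trans (sym (ℕ.+-suc k k′)) (ℕ.suc-injective eq)
... | ()
tail-complement ρ (i ∷ l) {suc k} {suc k′} eq =
  trans (lemma (ρ i) (Tail.tail ρ l k) _ _ _)
    (trans (cong₂ (λ t u → ρ i * t + (1ℚ - ρ i) * u)
             (tail-complement ρ l {k} {suc k′} (ℕ.suc-injective eq))
             (tail-complement ρ l {suc k} {k′} (trans (sym (ℕ.+-suc k k′)) (ℕ.suc-injective eq))))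
           (one (ρ i)))
  where
  lemma : ∀ p t u v w → (p * t + (1ℚ - p) * u) + ((1ℚ - p) * v + (1ℚ - (1ℚ - p)) * w)
                       ≡ p * (t + w) + (1ℚ - p) * (u + v)
  lemma = solve-∀ ℚ-ring
  one : ∀ p → p * 1ℚ + (1ℚ - p) * 1ℚ ≡ 1ℚ
  one = solve-∀ ℚ-ring

-- Expected cost and the lower bound for arbitrary policies

m+n≤m⇒n≡0 : ∀ m {n} → m ℕ.+ n ℕ.≤ m → n ≡ 0
m+n≤m⇒n≡0 m {n} m+n≤m = ℕ.n≤0⇒n≡0
  (ℕ.+-cancelˡ-≤ m n 0 (subst (m ℕ.+ n ℕ.≤_) (sym (ℕ.+-identityʳ m)) m+n≤m))

follows-tail : ∀ {n b v} {x : Vec Bool n} {s} → (b ∷ x) FollowsFrom (v ∷ s) → x FollowsFrom s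
follows-tail x∼s = x∼s ∘ suc

follows-nothing : ∀ {n b} {x : Vec Bool n} {s} → x FollowsFrom s → (b ∷ x) FollowsFrom (nothing ∷ s)
follows-nothing x∼s zero    = inj₂ refl
follows-nothing x∼s (suc i) = x∼s i

follows-just : ∀ {n b} {x : Vec Bool n} {s} → x FollowsFrom s → (b ∷ x) FollowsFrom (just b ∷ s)
follows-just x∼s zero    = inj₁ refl
follows-just x∼s (suc i) = x∼s i

follows-lookup : ∀ {n} (x : Vec Bool n) s i {b} →
                 lookup s i ≡ just b → x FollowsFrom s → lookup x i ≡ b
follows-lookup x s i eq x∼s with x∼s i
... | inj₁ e = case trans (sym e) eq of λ { refl → refl }
... | inj₂ e with trans (sym e) eq
...   | ()

-- The conditional expectation given the state `s`: known entries are fixed, only unknown ones are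
-- averaged. Each test of a policy thereby becomes a single application of `𝔼-split`.
𝔼 : ∀ {n} → (Fin n → ℚ) → State n → (Vec Bool n → ℚ) → ℚ
𝔼 p []            g = g []
𝔼 p (just b ∷ s)  g = 𝔼 (p ∘ suc) s (g ∘ (b ∷_))
𝔼 p (nothing ∷ s) g =
  p zero * 𝔼 (p ∘ suc) s (g ∘ (true ∷_)) + (1ℚ - p zero) * 𝔼 (p ∘ suc) s (g ∘ (false ∷_))

mix : ℚ → ℚ → ℚ → ℚ
mix p q r = p * q + (1ℚ - p) * r

mix-mono : ∀ {p q q′ r r′} → 0ℚ ≤ p → p ≤ 1ℚ → q ≤ q′ → r ≤ r′ → mix p q r ≤ mix p q′ r′
mix-mono 0≤p p≤1 q≤ r≤ = +-mono-≤ (*-monoˡ 0≤p q≤) (*-monoˡ (0≤-diff p≤1) r≤)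

mix-const : ∀ p q → mix p q q ≡ q
mix-const p q = lemma p q
  where
  lemma : ∀ p q → p * q + (1ℚ - p) * q ≡ q
  lemma = solve-∀ ℚ-ring

mix-+ : ∀ p a b c d → mix p (a + b) (c + d) ≡ mix p a c + mix p b d
mix-+ p a b c d = lemma p a b c d
  where
  lemma : ∀ p a b c d → p * (a + b) + (1ℚ - p) * (c + d)
                      ≡ (p * a + (1ℚ - p) * c) + (p * b + (1ℚ - p) * d)
  lemma = solve-∀ ℚ-ring

mix-* : ∀ p q a b → mix p (q * a) (q * b) ≡ q * mix p a b
mix-* p q a b = lemma p q a b
  where
  lemma : ∀ p q a b → p * (q * a) + (1ℚ - p) * (q * b) ≡ q * (p * a + (1ℚ - p) * b)
  lemma = solve-∀ ℚ-ring

𝔼-cong : ∀ {n} (p : Fin n → ℚ) s {g h} →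
         (∀ x → x FollowsFrom s → g x ≡ h x) → 𝔼 p s g ≡ 𝔼 p s h
𝔼-cong p []            g≗h = g≗h [] λ ()
𝔼-cong p (just b ∷ s)  g≗h = 𝔼-cong (p ∘ suc) s λ x x∼s → g≗h (b ∷ x) (follows-just x∼s)
𝔼-cong p (nothing ∷ s) g≗h = cong₂ (mix (p zero))
  (𝔼-cong (p ∘ suc) s λ x x∼s → g≗h (true ∷ x) (follows-nothing x∼s))
  (𝔼-cong (p ∘ suc) s λ x x∼s → g≗h (false ∷ x) (follows-nothing x∼s))

𝔼-const : ∀ {n} (p : Fin n → ℚ) s q → 𝔼 p s (λ _ → q) ≡ q
𝔼-const p []            q = refl
𝔼-const p (just b ∷ s)  q = 𝔼-const (p ∘ suc) s q
𝔼-const p (nothing ∷ s) q = trans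
  (cong (λ t → mix (p zero) t t) (𝔼-const (p ∘ suc) s q)) (mix-const (p zero) q)

𝔼-+ : ∀ {n} (p : Fin n → ℚ) s g h → 𝔼 p s (λ x → g x + h x) ≡ 𝔼 p s g + 𝔼 p s h
𝔼-+ p []            g h = refl
𝔼-+ p (just b ∷ s)  g h = 𝔼-+ (p ∘ suc) s (g ∘ (b ∷_)) (h ∘ (b ∷_))
𝔼-+ p (nothing ∷ s) g h = trans
  (cong₂ (mix (p zero)) (𝔼-+ (p ∘ suc) s _ _) (𝔼-+ (p ∘ suc) s _ _))
  (mix-+ (p zero) (𝔼 (p ∘ suc) s (g ∘ (true ∷_))) (𝔼 (p ∘ suc) s (h ∘ (true ∷_)))
         (𝔼 (p ∘ suc) s (g ∘ (false ∷_))) (𝔼 (p ∘ suc) s (h ∘ (false ∷_))))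

𝔼-* : ∀ {n} (p : Fin n → ℚ) s q g → 𝔼 p s (λ x → q * g x) ≡ q * 𝔼 p s g
𝔼-* p []            q g = refl
𝔼-* p (just b ∷ s)  q g = 𝔼-* (p ∘ suc) s q (g ∘ (b ∷_))
𝔼-* p (nothing ∷ s) q g = trans
  (cong₂ (mix (p zero)) (𝔼-* (p ∘ suc) s q _) (𝔼-* (p ∘ suc) s q _))
  (mix-* (p zero) q (𝔼 (p ∘ suc) s (g ∘ (true ∷_))) (𝔼 (p ∘ suc) s (g ∘ (false ∷_))))

𝔼-split : ∀ {n} (p : Fin n → ℚ) s i g → lookup s i ≡ nothing →
          𝔼 p s g ≡ mix (p i) (𝔼 p (s [ i ]≔ just true) g) (𝔼 p (s [ i ]≔ just false) g)
𝔼-split p (nothing ∷ s) zero    g eq = refl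
𝔼-split p (just b ∷ s)  (suc i) g eq = 𝔼-split (p ∘ suc) s i (g ∘ (b ∷_)) eq
𝔼-split p (nothing ∷ s) (suc i) g eq = trans
  (cong₂ (mix (p zero)) (𝔼-split (p ∘ suc) s i (g ∘ (true ∷_)) eq)
                        (𝔼-split (p ∘ suc) s i (g ∘ (false ∷_)) eq))
  (lemma (p zero) (p (suc i))
    (𝔼 (p ∘ suc) (s [ i ]≔ just true) (g ∘ (true ∷_))) (𝔼 (p ∘ suc) (s [ i ]≔ just false) (g ∘ (true ∷_)))
    (𝔼 (p ∘ suc) (s [ i ]≔ just true) (g ∘ (false ∷_))) (𝔼 (p ∘ suc) (s [ i ]≔ just false) (g ∘ (false ∷_))))
  where
  lemma : ∀ p q a b c d →
    p * (q * a + (1ℚ - q) * b) + (1ℚ - p) * (q * c + (1ℚ - q) * d) ≡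
    q * (p * a + (1ℚ - p) * c) + (1ℚ - q) * (p * b + (1ℚ - p) * d)
  lemma = solve-∀ ℚ-ring

𝔼-mono : ∀ {n} (p : Fin n → ℚ) → (∀ i → 0ℚ ≤ p i) → (∀ i → p i ≤ 1ℚ) → ∀ s {g h} →
         (∀ x → x FollowsFrom s → g x ≤ h x) → 𝔼 p s g ≤ 𝔼 p s h
𝔼-mono p 0≤p p≤1 []            g≤h = g≤h [] λ ()
𝔼-mono p 0≤p p≤1 (just b ∷ s)  g≤h =
  𝔼-mono (p ∘ suc) (0≤p ∘ suc) (p≤1 ∘ suc) s λ x x∼s → g≤h (b ∷ x) (follows-just x∼s)
𝔼-mono p 0≤p p≤1 (nothing ∷ s) g≤h = mix-mono (0≤p zero) (p≤1 zero)
  (𝔼-mono (p ∘ suc) (0≤p ∘ suc) (p≤1 ∘ suc) s λ x x∼s → g≤h (true ∷ x) (follows-nothing x∼s))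
  (𝔼-mono (p ∘ suc) (0≤p ∘ suc) (p≤1 ∘ suc) s λ x x∼s → g≤h (false ∷ x) (follows-nothing x∼s))

∑ℚ : ∀ {n} → (Fin n → ℚ) → ℚ
∑ℚ = Vector.foldr _+_ 0ℚ

spent : ∀ {n} → (Fin n → ℚ) → State n → ℚ
spent c s = ∑ℚ λ i → if is-just (lookup s i) then c i else 0ℚ

spent-test : ∀ {n} (c : Fin n → ℚ) s i b → lookup s i ≡ nothing →
             spent c (s [ i ]≔ just b) ≡ spent c s + c i
spent-test c (nothing ∷ s) zero b eq = lemma (c zero) (spent (c ∘ suc) s)
  where
  lemma : ∀ x y → x + y ≡ 0ℚ + y + x
  lemma = solve-∀ ℚ-ring
spent-test c (v ∷ s) (suc i) b eq = trans
  (cong (w +_) (spent-test (c ∘ suc) s i b eq)) (sym (+-assoc w (spent (c ∘ suc) s) (c (suc i))))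
  where w = if is-just v then c zero else 0ℚ

hits : Bool → Maybe Bool → ℕ
hits true  (just true)  = 1
hits false (just false) = 1
hits _     _            = 0

known : ∀ {n} → Bool → State n → ℕ
known b s = Vec.sum (Vec.map (hits b) s)

count : ∀ {n} → Bool → Vec Bool n → ℕ
count b x = Vec.sum (Vec.map (hits b ∘ just) x)

known-total : ∀ {n} (s : State n) → known true s ℕ.+ known false s ℕ.+ unknowns s ≡ n
known-total []               = refl
known-total (just true ∷ s)  = cong suc (known-total s)
known-total (just false ∷ s) = trans (cong (ℕ._+ unknowns s) (ℕ.+-suc (known true s) _)) (cong suc (known-total s))
known-total (nothing ∷ s)    = trans (ℕ.+-suc _ (unknowns s)) (cong suc (known-total s))

known-initial : ∀ n b → known b (initial {n}) ≡ 0
known-initial zero    b     = refl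
known-initial (suc n) true  = known-initial n true
known-initial (suc n) false = known-initial n false

unknowns-initial : ∀ n → unknowns (initial {n}) ≡ n
unknowns-initial zero    = refl
unknowns-initial (suc n) = cong suc (unknowns-initial n)

lookup-initial : ∀ {n} (i : Fin n) → lookup initial i ≡ nothing
lookup-initial zero    = refl
lookup-initial (suc i) = lookup-initial i

count-total : ∀ {n} (x : Vec Bool n) → count true x ℕ.+ count false x ≡ n
count-total []          = refl
count-total (true ∷ x)  = cong suc (count-total x)
count-total (false ∷ x) = trans (ℕ.+-suc _ (count false x)) (cong suc (count-total x))

known-test : ∀ {n} (s : State n) i b b′ → lookup s i ≡ nothing →
             known b (s [ i ]≔ just b′) ≡ hits b (just b′) ℕ.+ known b s
known-test (nothing ∷ s) zero    true  b′ eq = refl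
known-test (nothing ∷ s) zero    false b′ eq = refl
known-test (v ∷ s)       (suc i) b     b′ eq = trans
  (cong (hits b v ℕ.+_) (known-test s i b b′ eq)) (lemma (hits b v) (hits b (just b′)) (known b s))
  where
  lemma : ∀ x y z → x ℕ.+ (y ℕ.+ z) ≡ y ℕ.+ (x ℕ.+ z)
  lemma = ℕ-Solver.solve-∀

known≤count : ∀ {n} b (x : Vec Bool n) s → x FollowsFrom s → known b s ℕ.≤ count b x
known≤count b [] [] x∼s = ℕ.z≤n
known≤count b (b′ ∷ x) (v ∷ s) x∼s with x∼s zero
... | inj₁ refl = ℕ.+-monoʳ-≤ (hits b (just b′)) (known≤count b x s (follows-tail {v = just b′} x∼s))
known≤count true  (b′ ∷ x) (nothing ∷ s) x∼s | inj₂ refl = ℕ.m≤n⇒m≤o+n _ (known≤count true x s (follows-tail {b = b′} {v = nothing} x∼s))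
known≤count false (b′ ∷ x) (nothing ∷ s) x∼s | inj₂ refl = ℕ.m≤n⇒m≤o+n _ (known≤count false x s (follows-tail {b = b′} {v = nothing} x∼s))

fill : ∀ {n} → Bool → State n → Vec Bool n
fill b = Vec.map λ { (just b′) → b′ ; nothing → b }

fill-follows : ∀ {n} b (s : State n) → fill b s FollowsFrom s
fill-follows b (just b′ ∷ s) = follows-just (fill-follows b s)
fill-follows b (nothing ∷ s) = follows-nothing (fill-follows b s)

count-fill : ∀ {n} b (s : State n) → count b (fill (not b) s) ≡ known b s
count-fill b     []            = refl
count-fill b     (just b′ ∷ s) = cong (hits b (just b′) ℕ.+_) (count-fill b s)
count-fill true  (nothing ∷ s) = count-fill true s
count-fill false (nothing ∷ s) = count-fill false s

run-determined≡ : ∀ {n} m f (π : Policy n) x s → Determined f s → run m f π x s ≡ s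
run-determined≡ zero    f π x s det = refl
run-determined≡ (suc m) f π x s det with determined? f s
... | yes _   = refl
... | no ¬det = contradiction det ¬det

run-step : ∀ {n} m f (π : Policy n) x s → ¬ Determined f s → .(h : Incomplete s) →
  run (suc m) f π x s ≡ run m f π x (s [ choose π s h ]≔ just (lookup x (choose π s h)))
run-step m f π x s ¬det h with determined? f s
... | yes det = contradiction det ¬det
... | no _    = refl

value : ∀ {n} (p c : Fin n → ℚ) → BoolFun n → Policy n → ℕ → State n → ℚ
value p c f π m s = 𝔼 p s λ x → spent c (run m f π x s)

module _ {n : ℕ} (p c : Fin n → ℚ) (f : BoolFun n) (π : Policy n) where

  value-determined : ∀ m s → Determined f s → value p c f π m s ≡ spent c s
  value-determined m s det = trans
    (𝔼-cong p s λ x _ → cong (spent c) (run-determined≡ m f π x s det)) (𝔼-const p s (spent c s))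

  value-step : ∀ m s → ¬ Determined f s → .(h : Incomplete s) → let i = choose π s h in
    value p c f π (suc m) s ≡
    mix (p i) (value p c f π m (s [ i ]≔ just true)) (value p c f π m (s [ i ]≔ just false))
  value-step m s ¬det h = trans
    (𝔼-cong p s λ x _ → cong (spent c) (run-step m f π x s ¬det h))
    (trans (𝔼-split p s i _ (untested π s h))
      (cong₂ (mix (p i)) (branch true) (branch false)))
    where
    i = choose π s h
    branch : ∀ b → 𝔼 p (s [ i ]≔ just b) (λ x → spent c (run m f π x (s [ i ]≔ just (lookup x i))))
                 ≡ value p c f π m (s [ i ]≔ just b)
    branch b = 𝔼-cong p (s [ i ]≔ just b) λ x x∼s →
      cong (λ b′ → spent c (run m f π x (s [ i ]≔ just b′)))
           (follows-lookup x (s [ i ]≔ just b) i (lookup∘update i s (just b)) x∼s)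

select : Bool → ℕ → ℕ → ℕ
select true  k k̄ = k
select false k k̄ = k̄

-- k ones force the value true, and k̄ = n + 1 - k zeros force the value false.
module KOfN {n k k̄ : ℕ} (k+k̄ : k ℕ.+ k̄ ≡ suc n) where

  sum≡count : ∀ {n} (x : Vec Bool n) →
              Vec.sum (Vec.map (λ b → if b then 1 else 0) x) ≡ count true x
  sum≡count []          = refl
  sum≡count (true ∷ x)  = cong suc (sum≡count x)
  sum≡count (false ∷ x) = sum≡count x

  evaluate : ∀ b (x : Vec Bool n) → select b k k̄ ℕ.≤ count b x → kOfN k x ≡ b
  evaluate true x k≤ =
    Equivalence.to T-≡ (ℕ.≤⇒≤ᵇ (subst (k ℕ.≤_) (sym (sum≡count x)) k≤))
  evaluate false x k̄≤ with kOfN k x in eq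
  ... | false = refl
  ... | true  = contradiction (subst₂ ℕ._≤_ k+k̄ (count-total x) (ℕ.+-mono-≤ k≤ k̄≤)) (ℕ.<-irrefl refl)
    where
    k≤ : k ℕ.≤ count true x
    k≤ = subst (k ℕ.≤_) (sum≡count x) (ℕ.≤ᵇ⇒≤ k _ (Equivalence.from T-≡ eq))

  evaluate⁻¹ : ∀ b (x : Vec Bool n) → kOfN k x ≡ b → select b k k̄ ℕ.≤ count b x
  evaluate⁻¹ true  x eq = subst (k ℕ.≤_) (sum≡count x) (ℕ.≤ᵇ⇒≤ k _ (Equivalence.from T-≡ eq))
  evaluate⁻¹ false x eq with k ℕ.≤? count true x
  ... | yes k≤ = case trans (sym eq) (evaluate true x k≤) of λ ()
  ... | no  k≰ = ℕ.+-cancelˡ-≤ k _ _ (begin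
    k ℕ.+ k̄ ≡⟨ k+k̄ ⟩
    suc n ≡⟨ cong suc (count-total x) ⟨
    suc (count true x) ℕ.+ count false x ≤⟨ ℕ.+-monoˡ-≤ _ (ℕ.≰⇒> k≰) ⟩
    k ℕ.+ count false x ∎)
    where open ℕ.≤-Reasoning

  determined : ∀ b s → select b k k̄ ℕ.≤ known b s → Determined (kOfN k) s
  determined b s k≤ x y x∼s y∼s = trans
    (evaluate b x (ℕ.≤-trans k≤ (known≤count b x s x∼s)))
    (sym (evaluate b y (ℕ.≤-trans k≤ (known≤count b y s y∼s))))

  -- The two extreme completions decide. If filling with zeros gives value 1, the known ones alone
  -- reach `k`; otherwise filling with ones must give 0 as well, so the known zeros alone reach
  -- `k̄`.
  determined⁻¹ : ∀ s → Determined (kOfN k) s → ∃[ b ] select b k k̄ ℕ.≤ known b s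
  determined⁻¹ s det with kOfN k (fill false s) in eq
  ... | true  = true , subst (k ℕ.≤_) (count-fill true s) (evaluate⁻¹ true (fill false s) eq)
  ... | false = false , subst (k̄ ℕ.≤_) (count-fill false s) (evaluate⁻¹ false (fill true s)
                  (trans (det (fill true s) (fill false s) (fill-follows true s) (fill-follows false s)) eq))

-- A list of the right length that contains every unknown variable is an enumeration of the unknowns
-- without repetition.
record Lists {n : ℕ} (s : State n) (l : List (Fin n)) : Set where
  field
    covers : ∀ i → lookup s i ≡ nothing → i ∈ l
    exact  : length l ≡ unknowns s

open Lists

∈⇒Remove : ∀ {I : Set} {i : I} {l} → i ∈ l → ∃[ l′ ] Remove i l l′
∈⇒Remove (here refl) = _ , here
∈⇒Remove (there i∈l) = let _ , r = ∈⇒Remove i∈l in _ , there r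

Remove-∈ : ∀ {I : Set} {i j : I} {l l′} → Remove i l l′ → j ∈ l → j ≢ i → j ∈ l′
Remove-∈ here      (here j≡i)  j≢i = contradiction j≡i j≢i
Remove-∈ here      (there j∈l) j≢i = j∈l
Remove-∈ (there r) (here refl) j≢i = here refl
Remove-∈ (there r) (there j∈l) j≢i = there (Remove-∈ r j∈l j≢i)

Lists-test : ∀ {n} {s : State n} {i l l′} → lookup s i ≡ nothing → Remove i l l′ →
             Lists s l → ∀ b → Lists (s [ i ]≔ just b) l′
Lists-test {s = s} {i} un r L b .covers j eq with j ≟ᶠ i
... | yes refl = case trans (sym eq) (lookup∘update i s (just b)) of λ ()
... | no j≢i   = Remove-∈ r (covers L j (trans (sym (lookup∘update′ j≢i s (just b))) eq)) j≢i
Lists-test {s = s} {i} un r L b .exact = ℕ.suc-injective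
  (trans (sym (Remove-length r)) (trans (exact L) (unknowns-test s i b un)))

module PolicyBound {n k k̄ : ℕ} (k+k̄ : k ℕ.+ k̄ ≡ suc n) (p c : Fin n → ℚ)
                   (0≤p : ∀ i → 0ℚ ≤ p i) (p≤1 : ∀ i → p i ≤ 1ℚ) (π : Policy n) where

  open KOfN {n} {k} {k̄} k+k̄

  q : Fin n → ℚ
  q i = 1ℚ - p i

  q≤1 : ∀ i → q i ≤ 1ℚ
  q≤1 i = ≤-by (p i) (0≤p i) (lemma (p i))
    where
    lemma : ∀ p → 1ℚ - p + p ≡ 1ℚ
    lemma = solve-∀ ℚ-ring

  private
    module One  = Ordered c p
    module Zero = Ordered c q

  bound : List (Fin n) → List (Fin n) → ℕ → ℕ → ℚ
  bound α β k₁ k₀ = One.successCost α k₁ + Zero.successCost β k₀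

  bound-zero : ∀ {α β k₁ k₀} → k₁ ≡ 0 × length β ℕ.< k₀ ⊎ k₀ ≡ 0 × length α ℕ.< k₁ →
               bound α β k₁ k₀ ≡ 0ℚ
  bound-zero (inj₁ (refl , <k₀)) = cong (0ℚ +_) (Zero.successCost-long _ <k₀)
  bound-zero (inj₂ (refl , <k₁)) = cong (_+ 0ℚ) (One.successCost-long _ <k₁)

  -- Known ones, known zeros and unknowns add up to `n`; this keeps the two remaining targets in the
  -- proportion that `tail-complement` demands, at every state.
  remaining : ∀ s {k₁ k₀} → known true s ℕ.+ k₁ ≡ k → known false s ℕ.+ k₀ ≡ k̄ →
              k₁ ℕ.+ k₀ ≡ suc (unknowns s)
  remaining s {k₁} {k₀} eq₁ eq₀ = ℕ.+-cancelˡ-≡ (known true s ℕ.+ known false s) _ _ (begin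
    known true s ℕ.+ known false s ℕ.+ (k₁ ℕ.+ k₀) ≡⟨ lemma (known true s) (known false s) k₁ k₀ ⟩
    (known true s ℕ.+ k₁) ℕ.+ (known false s ℕ.+ k₀) ≡⟨ cong₂ ℕ._+_ eq₁ eq₀ ⟩
    k ℕ.+ k̄ ≡⟨ k+k̄ ⟩
    suc n ≡⟨ cong suc (known-total s) ⟨
    suc (known true s ℕ.+ known false s ℕ.+ unknowns s) ≡⟨ ℕ.+-suc _ (unknowns s) ⟨
    known true s ℕ.+ known false s ℕ.+ suc (unknowns s) ∎)
    where
    open ≡-Reasoning
    lemma : ∀ a b c d → a ℕ.+ b ℕ.+ (c ℕ.+ d) ≡ (a ℕ.+ c) ℕ.+ (b ℕ.+ d)
    lemma = ℕ-Solver.solve-∀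

  Sorted : (Fin n → ℚ) → List (Fin n) → Set
  Sorted ρ = AllPairs (λ i j → c i * ρ j ≤ c j * ρ i)

  -- Whichever variable `i` the policy tests, `exchange` moves it to the front of both lists without
  -- lowering either cost. The head is then charged `c i` times the tail of ones and `c i` times the
  -- tail of zeros; as `α` and `β` enumerate the same variables, these tails add up to 1, and the
  -- charge is exactly what the test costs.
  value-bound : ∀ m s α β k₁ k₀ → known true s ℕ.+ k₁ ≡ k → known false s ℕ.+ k₀ ≡ k̄ →
    Lists s α → Lists s β → α ↭ β → Sorted p α → Sorted q β → unknowns s ℕ.≤ m →
    spent c s + bound α β k₁ k₀ ≤ value p c (kOfN k) π m s
  value-bound m s α β k₁ k₀ eq₁ eq₀ Lα Lβ α↭β sα sβ u≤m with determined? (kOfN k) s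
  ... | yes det = ≤-reflexive (trans (trans (cong (spent c s +_) (bound-zero zeros)) (+-identityʳ _))
                                     (sym (value-determined p c (kOfN k) π m s det)))
    where
    zeros : k₁ ≡ 0 × length β ℕ.< k₀ ⊎ k₀ ≡ 0 × length α ℕ.< k₁
    zeros with determined⁻¹ s det
    ... | true  , k≤ = inj₁ (k₁≡0 , ℕ.≤-reflexive
      (trans (cong suc (exact Lβ)) (trans (sym (remaining s eq₁ eq₀)) (cong (ℕ._+ k₀) k₁≡0))))
      where k₁≡0 = m+n≤m⇒n≡0 (known true s) (subst (ℕ._≤ known true s) (sym eq₁) k≤)
    ... | false , k̄≤ = inj₂ (k₀≡0 , ℕ.≤-reflexive
      (trans (cong suc (exact Lα)) (trans (sym (remaining s eq₁ eq₀))
        (trans (cong (k₁ ℕ.+_) k₀≡0) (ℕ.+-identityʳ k₁)))))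
      where k₀≡0 = m+n≤m⇒n≡0 (known false s) (subst (ℕ._≤ known false s) (sym eq₀) k̄≤)
  value-bound zero s α β k₁ k₀ eq₁ eq₀ Lα Lβ α↭β sα sβ u≤m | no ¬det =
    contradiction u≤m (ℕ.<⇒≱ (incomplete⇒0<unknowns (undetermined⇒incomplete _ s ¬det)))
  value-bound (suc m) s α β zero k₀ eq₁ eq₀ Lα Lβ α↭β sα sβ u≤m | no ¬det =
    contradiction (determined true s (ℕ.≤-reflexive (trans (sym eq₁) (ℕ.+-identityʳ _)))) ¬det
  value-bound (suc m) s α β (suc k₁) zero eq₁ eq₀ Lα Lβ α↭β sα sβ u≤m | no ¬det =
    contradiction (determined false s (ℕ.≤-reflexive (trans (sym eq₀) (ℕ.+-identityʳ _)))) ¬det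
  value-bound (suc m) s α β (suc k₁) (suc k₀) eq₁ eq₀ Lα Lβ α↭β sα sβ u≤m | no ¬det =
    subst (_ ≤_) (sym (value-step p c (kOfN k) π m s ¬det inc)) (begin
      spent c s + bound α β (suc k₁) (suc k₀)
        ≤⟨ +-monoʳ-≤ (spent c s) (+-mono-≤ (One.exchange 0≤p p≤1 rα sα k₁)
             (Zero.exchange (λ j → 0≤-diff (p≤1 j)) q≤1 rβ sβ k₀)) ⟩
      spent c s + ((c i * One.tail α (suc k₁) + (p i * One.successCost α′ k₁ + (1ℚ - p i) * One.successCost α′ (suc k₁)))
        + (c i * Zero.tail β (suc k₀) + ((1ℚ - p i) * Zero.successCost β′ k₀ + (1ℚ - (1ℚ - p i)) * Zero.successCost β′ (suc k₀))))
        ≡⟨ lemma (spent c s) (c i) (One.tail α (suc k₁)) (Zero.tail β (suc k₀)) (p i)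
             (One.successCost α′ k₁) (One.successCost α′ (suc k₁)) (Zero.successCost β′ k₀) (Zero.successCost β′ (suc k₀)) ⟩
      mix (p i) (spent c s + c i * (One.tail α (suc k₁) + Zero.tail β (suc k₀)) + bound α′ β′ k₁ (suc k₀))
                (spent c s + c i * (One.tail α (suc k₁) + Zero.tail β (suc k₀)) + bound α′ β′ (suc k₁) k₀)
        ≡⟨ cong₂ (mix (p i)) (cong (_+ bound α′ β′ k₁ (suc k₀)) (pay true))
                             (cong (_+ bound α′ β′ (suc k₁) k₀) (pay false)) ⟩
      mix (p i) (spent c (s [ i ]≔ just true) + bound α′ β′ k₁ (suc k₀))
                (spent c (s [ i ]≔ just false) + bound α′ β′ (suc k₁) k₀)
        ≤⟨ mix-mono (0≤p i) (p≤1 i)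
             (value-bound m (s [ i ]≔ just true) α′ β′ k₁ (suc k₀)
               (trans (cong (ℕ._+ k₁) (known-test s i true true un)) (trans (sym (ℕ.+-suc _ k₁)) eq₁))
               (trans (cong (ℕ._+ suc k₀) (known-test s i false true un)) eq₀)
               (Lists-test un rα Lα true) (Lists-test un rβ Lβ true) α′↭β′ sα′ sβ′ (fuel true))
             (value-bound m (s [ i ]≔ just false) α′ β′ (suc k₁) k₀
               (trans (cong (ℕ._+ suc k₁) (known-test s i true false un)) eq₁)
               (trans (cong (ℕ._+ k₀) (known-test s i false false un)) (trans (sym (ℕ.+-suc _ k₀)) eq₀))
               (Lists-test un rα Lα false) (Lists-test un rβ Lβ false) α′↭β′ sα′ sβ′ (fuel false)) ⟩
      mix (p i) (value p c (kOfN k) π m (s [ i ]≔ just true)) (value p c (kOfN k) π m (s [ i ]≔ just false))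
        ∎)
    where
    open ≤-Reasoning
    inc = undetermined⇒incomplete (kOfN k) s ¬det
    i   = choose π s inc
    un : lookup s i ≡ nothing
    un  = untested π s inc
    α′  = proj₁ (∈⇒Remove (covers Lα i un))
    β′  = proj₁ (∈⇒Remove (covers Lβ i un))
    rα : Remove i α α′
    rα  = proj₂ (∈⇒Remove (covers Lα i un))
    rβ : Remove i β β′
    rβ  = proj₂ (∈⇒Remove (covers Lβ i un))
    sα′ = Remove-AllPairs rα sα
    sβ′ = Remove-AllPairs rβ sβ
    fuel : ∀ b → unknowns (s [ i ]≔ just b) ℕ.≤ m
    fuel b = ℕ.s≤s⁻¹ (subst (ℕ._≤ suc m) (unknowns-test s i b un) u≤m)
    tails : One.tail α (suc k₁) + Zero.tail β (suc k₀) ≡ 1ℚ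
    tails = trans (cong (One.tail α (suc k₁) +_) (Zero.tail-↭ (↭-sym α↭β) (suc k₀)))
      (tail-complement p α {suc k₁} {suc k₀} (trans (remaining s eq₁ eq₀) (cong suc (sym (exact Lα)))))
    α′↭β′ = drop-∷ (↭-trans (↭-sym (Remove-↭ rα)) (↭-trans α↭β (Remove-↭ rβ)))
    pay : ∀ b → spent c s + c i * (One.tail α (suc k₁) + Zero.tail β (suc k₀)) ≡ spent c (s [ i ]≔ just b)
    pay b = trans (cong (λ t → spent c s + c i * t) tails)
      (trans (cong (spent c s +_) (*-identityʳ (c i))) (sym (spent-test c s i b un)))
    lemma : ∀ S c t u p a b d e →
      S + ((c * t + (p * a + (1ℚ - p) * b)) + (c * u + ((1ℚ - p) * d + (1ℚ - (1ℚ - p)) * e))) ≡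
      p * (S + c * (t + u) + (a + e)) + (1ℚ - p) * (S + c * (t + u) + (b + d))
    lemma = solve-∀ ℚ-ring

-- Greedy, ordered and optimal policies

Least : ∀ {n} → Vec Bool n → (Fin n → ℚ) → Maybe (Fin n) → Set
Least v key (just i) = lookup v i ≡ true × (∀ j → lookup v j ≡ true → key i ≤ key j)
Least v key nothing  = ∀ j → lookup v j ≢ true

argmin : ∀ {n} → Vec Bool n → (Fin n → ℚ) → Maybe (Fin n)
argmin []          key = nothing
argmin (false ∷ v) key = Maybe.map suc (argmin v (key ∘ suc))
argmin (true ∷ v)  key with argmin v (key ∘ suc)
... | nothing = just zero
... | just i with key zero ≤? key (suc i)
...   | yes _ = just zero
...   | no _  = just (suc i)

argmin-least : ∀ {n} (v : Vec Bool n) key → Least v key (argmin v key)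
argmin-least [] key = λ ()
argmin-least (false ∷ v) key with argmin v (key ∘ suc) | argmin-least v (key ∘ suc)
... | nothing | none        = λ { (suc j) → none j }
... | just i  | vi , least  = vi , λ { (suc j) → least j }
argmin-least (true ∷ v) key with argmin v (key ∘ suc) | argmin-least v (key ∘ suc)
... | nothing | none = refl , λ { zero _ → ≤-refl ; (suc j) vj → contradiction vj (none j) }
... | just i  | vi , least with key zero ≤? key (suc i)
...   | yes 0≤i = refl , λ { zero _ → ≤-refl ; (suc j) vj → ≤-trans 0≤i (least j vj) }
...   | no  0≰i = vi , λ { zero _ → <⇒≤ (≰⇒> 0≰i) ; (suc j) vj → least j vj }

-- The proof is irrelevant because `choose` receives incompleteness only irrelevantly: the value has
-- to come from inspecting `m`.
pick : ∀ {A : Set} (m : Maybe A) → .(m ≢ nothing) → A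
pick (just a) _   = a
pick nothing  ≢no = ⊥-elim (≢no refl)

pick-just : ∀ {A : Set} (m : Maybe A) .(h : m ≢ nothing) → m ≡ just (pick m h)
pick-just (just a) _   = refl
pick-just nothing  ≢no = ⊥-elim (≢no refl)

pick-cong : ∀ {A : Set} {m m′ : Maybe A} .(h : m ≢ nothing) .(h′ : m′ ≢ nothing) →
            m ≡ m′ → pick m h ≡ pick m′ h′
pick-cong {m = just _} h h′ refl = refl
pick-cong {m = nothing} h h′ refl = ⊥-elim (h refl)

support : ∀ {n} → State n → Vec Bool n
support = Vec.map is-nothing

unknown⇒support : ∀ {n} (s : State n) i → lookup s i ≡ nothing → lookup (support s) i ≡ true
unknown⇒support s i eq = trans (lookup-map i is-nothing s) (cong is-nothing eq)

support⇒unknown : ∀ {n} (s : State n) i → lookup (support s) i ≡ true → lookup s i ≡ nothing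
support⇒unknown (nothing ∷ s) zero    eq = refl
support⇒unknown (_ ∷ s)       (suc i) eq = support⇒unknown s i eq

incomplete⇒argmin : ∀ {n} (s : State n) key → Incomplete s → argmin (support s) key ≢ nothing
incomplete⇒argmin s key h eq with argmin (support s) key | argmin-least (support s) key
incomplete⇒argmin s key h refl | nothing | none = let i , un = unknown s h in none i (unknown⇒support s i un)
  where
  unknown : ∀ {n} (s : State n) → Incomplete s → ∃[ i ] lookup s i ≡ nothing
  unknown (v ∷ s) (here eq) = zero , eq
  unknown (v ∷ s) (there h) = let i , eq = unknown s h in suc i , eq

greedy : ∀ {n} → (State n → Fin n → ℚ) → Policy n
greedy key .choose s h = pick (argmin (support s) (key s)) (incomplete⇒argmin s (key s) h)
greedy key .untested s h = support⇒unknown s _ (proj₁ (subst (Least (support s) (key s))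
  (pick-just _ (incomplete⇒argmin s (key s) h)) (argmin-least (support s) (key s))))

greedy-least : ∀ {n} (key : State n → Fin n → ℚ) s .(h : Incomplete s) j →
               lookup s j ≡ nothing → key s (choose (greedy key) s h) ≤ key s j
greedy-least key s h j un = proj₂ (subst (Least (support s) (key s))
  (pick-just _ (incomplete⇒argmin s (key s) h)) (argmin-least (support s) (key s))) j (unknown⇒support s j un)

support-unknowns : ∀ {n} (s t : State n) → support s ≡ support t → unknowns s ≡ unknowns t
support-unknowns []            []            eq = refl
support-unknowns (nothing ∷ s) (nothing ∷ t) eq = cong suc (support-unknowns s t (cong Vec.tail eq))
support-unknowns (just _ ∷ s)  (just _ ∷ t)  eq = support-unknowns s t (cong Vec.tail eq)
support-unknowns (nothing ∷ s) (just _ ∷ t)  ()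
support-unknowns (just _ ∷ s)  (nothing ∷ t) ()

unknowns-step : ∀ {n} (π : Policy n) s .(h : Incomplete s) b →
                unknowns s ≡ suc (unknowns (s [ choose π s h ]≔ just b))
unknowns-step π s h b = unknowns-test s (choose π s h) b (untested π s h)

unknowns≤n : ∀ {n} (s : State n) → unknowns s ℕ.≤ n
unknowns≤n s = subst (unknowns s ℕ.≤_) (known-total s) (ℕ.m≤n+m _ _)

-- Both derivations are followed in lockstep: equal supports lead to equal choices and hence to
-- equal supports after the test. A derivation that has made a test cannot meet `start`, since only
-- `n` unknowns are possible there.
reachable-support : ∀ {n} {π : Policy n} → (∀ {s t} .(hs : Incomplete s) .(ht : Incomplete t) →
  Reachable π s → Reachable π t → support s ≡ support t → choose π s hs ≡ choose π t ht) →
  ∀ {s t} → Reachable π s → Reachable π t → unknowns s ≡ unknowns t → support s ≡ support t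
reachable-support ch start start eq = refl
reachable-support {n} {π} ch start (step {t} rt h b) eq = contradiction
  (subst (ℕ._≤ n) (trans (unknowns-step π t h b) (cong suc (trans (sym eq) (unknowns-initial n)))) (unknowns≤n t))
  (ℕ.<-irrefl refl)
reachable-support {n} {π} ch (step {s} rs h b) start eq = contradiction
  (subst (ℕ._≤ n) (trans (unknowns-step π s h b) (cong suc (trans eq (unknowns-initial n)))) (unknowns≤n s))
  (ℕ.<-irrefl refl)
reachable-support {n} {π} ch (step {s} rs hs b) (step {t} rt ht b′) eq = begin
  support (s [ choose π s hs ]≔ just b) ≡⟨ map-[]≔ is-nothing s _ ⟩
  support s [ choose π s hs ]≔ false ≡⟨ cong₂ (λ v i → v [ i ]≔ false) s≡t (ch hs ht rs rt s≡t) ⟩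
  support t [ choose π t ht ]≔ false ≡⟨ map-[]≔ is-nothing t _ ⟨
  support (t [ choose π t ht ]≔ just b′) ∎
  where
  open ≡-Reasoning
  s≡t = reachable-support ch rs rt
    (trans (unknowns-step π s hs b) (trans (cong suc eq) (sym (unknowns-step π t ht b′))))

greedy-nonAdaptive : ∀ {n} (key : State n → Fin n → ℚ) →
  (∀ s t → support s ≡ support t → key s ≡ key t) → NonAdaptive (greedy key)
greedy-nonAdaptive key key-support {s} {t} rs rt hs ht eq =
  same hs ht rs rt (reachable-support same rs rt eq)
  where
  same : ∀ {s t} .(hs : Incomplete s) .(ht : Incomplete t) →
    Reachable (greedy key) s → Reachable (greedy key) t → support s ≡ support t →
    choose (greedy key) s hs ≡ choose (greedy key) t ht
  same {s} {t} hs ht _ _ eq = pick-cong (incomplete⇒argmin s (key s) hs) (incomplete⇒argmin t (key t) ht)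
    (cong₂ argmin eq (key-support s t eq))

-- Entries are counted from the end, starting at 1.
entry : ∀ {A : Set} {m} → Vec A m → ℕ → Maybe A
entry []                u = nothing
entry {m = suc m} (a ∷ v) u with u ℕ.≟ suc m
... | yes _ = just a
... | no _  = entry v u

rank : ∀ {n m} → Vec (Fin n) m → ℕ → Fin n → ℚ
rank v u i with Maybe.≡-dec _≟ᶠ_ (entry v u) (just i)
... | yes _ = 0ℚ
... | no _  = 1ℚ

-- The entry for the number of unknowns left is tested; if it has been tested
-- before, the first unknown is tested instead, so that every vector is an order.
ordered : ∀ {n} → Vec (Fin n) n → Policy n
ordered v = greedy (rank v ∘ unknowns)

ordered-nonAdaptive : ∀ {n} (v : Vec (Fin n) n) → NonAdaptive (ordered v)
ordered-nonAdaptive v = greedy-nonAdaptive (rank v ∘ unknowns) λ s t eq →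
  cong (rank v) (support-unknowns s t eq)

ordered-entry : ∀ {n} (v : Vec (Fin n) n) s .(h : Incomplete s) i →
  lookup s i ≡ nothing → entry v (unknowns s) ≡ just i → choose (ordered v) s h ≡ i
ordered-entry v s h i un eq = go (choose (ordered v) s h) (greedy-least (rank v ∘ unknowns) s h i un)
  where
  go : ∀ j → rank v (unknowns s) j ≤ rank v (unknowns s) i → j ≡ i
  go j j≤i with Maybe.≡-dec _≟ᶠ_ (entry v (unknowns s)) (just i) | Maybe.≡-dec _≟ᶠ_ (entry v (unknowns s)) (just j)
  ... | no ≢  | _      = contradiction eq ≢
  ... | yes _ | yes e  = Maybe.just-injective (trans (sym e) eq)
  ... | yes _ | no _   = contradiction (<-≤-trans (positive⁻¹ 1ℚ) j≤i) (<-irrefl refl)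

0<unknowns⇒incomplete : ∀ {n} (s : State n) → 0 ℕ.< unknowns s → Incomplete s
0<unknowns⇒incomplete (nothing ∷ s) _  = here refl
0<unknowns⇒incomplete (just _ ∷ s)  0< = there (0<unknowns⇒incomplete s 0<)

module _ {n : ℕ} (π : Policy n) (na : NonAdaptive π) where

  -- Supplies for every number of unknowns a reachable state at which the order of `π` can be read
  -- off; the answer `false` is an arbitrary choice.
  reachable-unknowns : ∀ d {u} → u ℕ.+ d ≡ n → Σ[ s ∈ State n ] Reachable π s × unknowns s ≡ u
  reachable-unknowns zero {u} eq =
    initial , start , trans (unknowns-initial n) (trans (sym eq) (ℕ.+-identityʳ u))
  reachable-unknowns (suc d) {u} eq with reachable-unknowns d {suc u} (trans (sym (ℕ.+-suc u d)) eq)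
  ... | s , rs , su = _ , step rs h false ,
    ℕ.suc-injective (trans (sym (unknowns-step π s h false)) su)
    where h = 0<unknowns⇒incomplete s (subst (0 ℕ.<_) (sym su) ℕ.z<s)

  order-prefix : ∀ m → m ℕ.≤ n → Σ[ v ∈ Vec (Fin n) m ] (∀ {s} → Reachable π s → .(h : Incomplete s) →
                 unknowns s ℕ.≤ m → entry v (unknowns s) ≡ just (choose π s h))
  order-prefix zero m≤n = [] , λ rs h u≤0 → ⊥-elim (ℕ.<⇒≱ (incomplete⇒0<unknowns h) u≤0)
  order-prefix (suc m) m<n with order-prefix m (ℕ.<⇒≤ m<n)
                              | reachable-unknowns (n ℕ.∸ suc m) (ℕ.m+[n∸m]≡n m<n)
  ... | v , v-ok | t , rt , tu = choose π t ht ∷ v , ok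
    where
    ht = 0<unknowns⇒incomplete t (subst (0 ℕ.<_) (sym tu) ℕ.z<s)
    ok : ∀ {s} → Reachable π s → .(h : Incomplete s) →
         unknowns s ℕ.≤ suc m → entry (choose π t ht ∷ v) (unknowns s) ≡ just (choose π s h)
    ok {s} rs h u≤ with unknowns s ℕ.≟ suc m
    ... | yes eq = cong just (na rt rs ht h (trans tu (sym eq)))
    ... | no ≢   = v-ok rs h (ℕ.s≤s⁻¹ (ℕ.≤∧≢⇒< u≤ ≢))

  order : Vec (Fin n) n
  order = proj₁ (order-prefix n ℕ.≤-refl)

  order-run : ∀ m f x {s} → Reachable π s → run m f (ordered order) x s ≡ run m f π x s
  order-run zero    f x rs = refl
  order-run (suc m) f x {s} rs = go (determined? f s)
    where
    go : Dec (Determined f s) → run (suc m) f (ordered order) x s ≡ run (suc m) f π x s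
    go (yes det) = trans (run-determined≡ (suc m) f (ordered order) x s det)
                         (sym (run-determined≡ (suc m) f π x s det))
    go (no ¬det) = begin
      run (suc m) f (ordered order) x s ≡⟨ run-step m f (ordered order) x s ¬det h ⟩
      run m f (ordered order) x (after (choose (ordered order) s h))
        ≡⟨ cong (λ i → run m f (ordered order) x (after i))
             (ordered-entry order s h (choose π s h) (untested π s h)
               (proj₂ (order-prefix n ℕ.≤-refl) rs h (unknowns≤n s))) ⟩
      run m f (ordered order) x (after (choose π s h)) ≡⟨ order-run m f x (step rs h (lookup x (choose π s h))) ⟩
      run m f π x (after (choose π s h)) ≡⟨ run-step m f π x s ¬det h ⟨
      run (suc m) f π x s ∎
      where
      open ≡-Reasoning
      h = undetermined⇒incomplete f s ¬det
      after : Fin n → State n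
      after i = s [ i ]≔ just (lookup x i)

expected : ∀ {n} (p c : Fin n → ℚ) → BoolFun n → Policy n → ℚ
expected {n} p c f π = value p c f π n initial

-- Policies are functions on all states and cannot be enumerated, but the cost of a non-adaptive one
-- depends only on its order. Finite minimization and finite conjunction over vectors thus reach all
-- non-adaptive policies.
order-expected : ∀ {n} (p c : Fin n → ℚ) f (π : Policy n) (na : NonAdaptive π) →
                 expected p c f (ordered (order π na)) ≡ expected p c f π
order-expected {n} p c f π na = 𝔼-cong p initial λ x _ →
  cong (spent c) (order-run π na n f x start)

minimum-Fin : ∀ {n} (φ : Fin (suc n) → ℚ) → ∃[ i ] (∀ j → φ i ≤ φ j)
minimum-Fin {zero}  φ = zero , λ { zero → ≤-refl }
minimum-Fin {suc n} φ with minimum-Fin (φ ∘ suc)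
... | i , least with φ zero ≤? φ (suc i)
...   | yes 0≤i = zero , λ { zero → ≤-refl ; (suc j) → ≤-trans 0≤i (least j) }
...   | no  0≰i = suc i , λ { zero → <⇒≤ (≰⇒> 0≰i) ; (suc j) → least j }

minimum-Vec : ∀ {n} m (φ : Vec (Fin (suc n)) m → ℚ) → ∃[ v ] (∀ w → φ v ≤ φ w)
minimum-Vec zero    φ = [] , λ { [] → ≤-refl }
minimum-Vec (suc m) φ =
  let best = λ i → minimum-Vec m (φ ∘ (i ∷_))
      i , least = minimum-Fin λ i → φ (i ∷ proj₁ (best i))
  in i ∷ proj₁ (best i) , λ { (j ∷ w) → ≤-trans (least j) (proj₂ (best j) w) }

nonAdaptive-optimum : ∀ {n} → 0 ℕ.< n → (p c : Fin n → ℚ) → ∀ f →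
  ∃[ π ] (NonAdaptive π × (∀ π′ → NonAdaptive π′ → expected p c f π ≤ expected p c f π′))
nonAdaptive-optimum {suc n} _ p c f =
  let v , least = minimum-Vec (suc n) (λ v → expected p c f (ordered v))
  in ordered v , ordered-nonAdaptive v , λ π′ na →
     subst (expected p c f (ordered v) ≤_) (order-expected p c f π′ na) (least (order π′ na))

module Optimum {n : ℕ} (p c : Fin n → ℚ) (f : BoolFun n)
               (0≤p : ∀ i → 0ℚ ≤ p i) (p≤1 : ∀ i → p i ≤ 1ℚ) (0≤c : ∀ i → 0ℚ ≤ c i) where

  after : (State n → ℚ) → State n → Fin n → ℚ
  after v s i = mix (p i) (v (s [ i ]≔ just true)) (v (s [ i ]≔ just false))

  best : (State n → ℚ) → ∀ s → Dec (Determined f s) → ℚ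
  best v s (yes _)   = spent c s
  best v s (no ¬det) = after v s (choose (greedy (after v)) s (undetermined⇒incomplete f s ¬det))

  -- Bellman recursion in the number of tests still allowed. With none left it returns the cost
  -- spent, in agreement with `run`.
  optimal : ℕ → State n → ℚ
  optimal zero    s = spent c s
  optimal (suc m) s = best (optimal m) s (determined? f s)

  optimal-determined : ∀ m s → Determined f s → optimal m s ≡ spent c s
  optimal-determined zero    s det = refl
  optimal-determined (suc m) s det with determined? f s
  ... | yes _   = refl
  ... | no ¬det = contradiction det ¬det

  optimal-undetermined : ∀ m s → ¬ Determined f s → .(h : Incomplete s) →
    optimal (suc m) s ≡ after (optimal m) s (choose (greedy (after (optimal m))) s h)
  optimal-undetermined m s ¬det h with determined? f s
  ... | yes det = contradiction det ¬det
  ... | no _    = refl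

  spent-mono : ∀ s i b → lookup s i ≡ nothing → spent c s ≤ spent c (s [ i ]≔ just b)
  spent-mono s i b un = ≤-by (c i) (0≤c i) (sym (spent-test c s i b un))

  ≤-after : ∀ v q s i → q ≤ v (s [ i ]≔ just true) → q ≤ v (s [ i ]≔ just false) → q ≤ after v s i
  ≤-after v q s i q≤ q≤′ = subst (_≤ after v s i) (mix-const (p i) q) (mix-mono (0≤p i) (p≤1 i) q≤ q≤′)

  spent≤optimal : ∀ m s → spent c s ≤ optimal m s
  spent≤optimal zero    s = ≤-refl
  spent≤optimal (suc m) s with determined? f s
  ... | yes _   = ≤-refl
  ... | no ¬det = ≤-after (optimal m) (spent c s) s i (bound true) (bound false)
    where
    h = undetermined⇒incomplete f s ¬det
    i = choose (greedy (after (optimal m))) s h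
    bound : ∀ b → spent c s ≤ optimal m (s [ i ]≔ just b)
    bound b = ≤-trans (spent-mono s i b (untested (greedy (after (optimal m))) s h)) (spent≤optimal m _)

  -- If `f` is already determined, a further test can only add cost. Covering this case allows upper
  -- bounds from testing schemes that never ask whether `f` is determined.
  optimal-test : ∀ m s i → lookup s i ≡ nothing → optimal (suc m) s ≤ after (optimal m) s i
  optimal-test m s i un with determined? f s
  ... | yes _   = ≤-after (optimal m) (spent c s) s i (bound true) (bound false)
    where
    bound : ∀ b → spent c s ≤ optimal m (s [ i ]≔ just b)
    bound b = ≤-trans (spent-mono s i b un) (spent≤optimal m _)
  ... | no ¬det = greedy-least (after (optimal m)) s (undetermined⇒incomplete f s ¬det) i un

  optimal≤value : ∀ π m s → optimal m s ≤ value p c f π m s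
  optimal≤value π zero    s = ≤-reflexive (sym (𝔼-const p s (spent c s)))
  optimal≤value π (suc m) s = go (determined? f s)
    where
    go : Dec (Determined f s) → optimal (suc m) s ≤ value p c f π (suc m) s
    go (yes det) = ≤-reflexive (trans (optimal-determined (suc m) s det)
                                      (sym (value-determined p c f π (suc m) s det)))
    go (no ¬det) = begin
      optimal (suc m) s ≤⟨ optimal-test m s i (untested π s h) ⟩
      after (optimal m) s i ≤⟨ mix-mono (0≤p i) (p≤1 i) (optimal≤value π m _) (optimal≤value π m _) ⟩
      after (value p c f π m) s i ≡⟨ value-step p c f π m s ¬det h ⟨
      value p c f π (suc m) s ∎
      where
      open ≤-Reasoning
      h = undetermined⇒incomplete f s ¬det
      i = choose π s h

  -- A policy sees only the state, so the number of tests left is recovered from it: after the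
  -- present test one unknown fewer remains.
  optimalPolicy : Policy n
  optimalPolicy = greedy λ s → after (optimal (ℕ.pred (unknowns s))) s

  optimalPolicy-value : ∀ m s → unknowns s ≡ m → value p c f optimalPolicy m s ≡ optimal m s
  optimalPolicy-value zero    s eq = 𝔼-const p s (spent c s)
  optimalPolicy-value (suc m) s eq = go (determined? f s)
    where
    open ≡-Reasoning
    go : Dec (Determined f s) → value p c f optimalPolicy (suc m) s ≡ optimal (suc m) s
    go (yes det) = trans (value-determined p c f optimalPolicy (suc m) s det) (sym (optimal-determined (suc m) s det))
    go (no ¬det) = begin
      value p c f optimalPolicy (suc m) s ≡⟨ value-step p c f optimalPolicy m s ¬det h ⟩
      after (value p c f optimalPolicy m) s i ≡⟨ cong₂ (mix (p i)) (IH true) (IH false) ⟩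
      after (optimal m) s i
        ≡⟨ cong (λ u → after (optimal m) s (choose (greedy (after (optimal u))) s h)) (cong ℕ.pred eq) ⟩
      after (optimal m) s (choose (greedy (after (optimal m))) s h)
        ≡⟨ optimal-undetermined m s ¬det h ⟨
      optimal (suc m) s ∎
      where
      h = undetermined⇒incomplete f s ¬det
      i = choose optimalPolicy s h
      IH : ∀ b → value p c f optimalPolicy m (s [ i ]≔ just b) ≡ optimal m (s [ i ]≔ just b)
      IH b = optimalPolicy-value m _ (ℕ.suc-injective (trans (sym (unknowns-step optimalPolicy s h b)) eq))

-- Orders by ratio and the interleaved policy

tally : ∀ {n} → Bool → State n → List (Fin n) → ℕ
tally b s l = ℕ.sum (List.map (hits b ∘ lookup s) l)

sum-lookup : ∀ {n} {A : Set} (h : A → ℕ) (v : Vec A n) →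
             ℕ.sum (List.map (h ∘ lookup v) (allFin n)) ≡ Vec.sum (Vec.map h v)
sum-lookup h []      = refl
sum-lookup {suc n} h (a ∷ v) = cong (h a ℕ.+_) (trans
  (cong ℕ.sum (trans (map-tabulate suc (h ∘ lookup (a ∷ v))) (sym (map-tabulate (λ i → i) (h ∘ lookup v)))))
  (sum-lookup h v))

tally-all : ∀ {n} b (s : State n) {l} → l ↭ allFin n → tally b s l ≡ known b s
tally-all b s l↭ = trans (ℕ.sum-↭ (map⁺ (hits b ∘ lookup s) l↭)) (sum-lookup (hits b) s)

∑ᴸ : ∀ {I : Set} → (I → ℚ) → List I → ℚ
∑ᴸ f []      = 0ℚ
∑ᴸ f (i ∷ l) = f i + ∑ᴸ f l

∑ᴸ-↭ : ∀ {I : Set} (f : I → ℚ) {l l′} → l ↭ l′ → ∑ᴸ f l ≡ ∑ᴸ f l′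
∑ᴸ-↭ f Perm.refl         = refl
∑ᴸ-↭ f (Perm.prep i p)   = cong (f i +_) (∑ᴸ-↭ f p)
∑ᴸ-↭ f (Perm.swap {l} {l′} i j p) =
  trans (cong (λ t → f i + (f j + t)) (∑ᴸ-↭ f p)) (lemma (f i) (f j) (∑ᴸ f l′))
  where
  lemma : ∀ a b c → a + (b + c) ≡ b + (a + c)
  lemma = solve-∀ ℚ-ring
∑ᴸ-↭ f (Perm.trans p q)  = trans (∑ᴸ-↭ f p) (∑ᴸ-↭ f q)

∑ᴸ-map : ∀ {I J : Set} (f : J → ℚ) (g : I → J) l → ∑ᴸ f (List.map g l) ≡ ∑ᴸ (f ∘ g) l
∑ᴸ-map f g []      = refl
∑ᴸ-map f g (i ∷ l) = cong (f (g i) +_) (∑ᴸ-map f g l)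

∑ᴸ-allFin : ∀ {n} (f : Fin n → ℚ) → ∑ᴸ f (allFin n) ≡ ∑ℚ f
∑ᴸ-allFin {zero}  f = refl
∑ᴸ-allFin {suc n} f = cong (f zero +_) (trans
  (cong (∑ᴸ f) (sym (map-tabulate (λ i → i) suc)))
  (trans (∑ᴸ-map f suc (allFin n)) (∑ᴸ-allFin (f ∘ suc))))

∑ℚ-mono : ∀ {n} {f g : Fin n → ℚ} → (∀ i → f i ≤ g i) → ∑ℚ f ≤ ∑ℚ g
∑ℚ-mono {zero}  f≤g = ≤-refl
∑ℚ-mono {suc n} f≤g = +-mono-≤ (f≤g zero) (∑ℚ-mono (f≤g ∘ suc))

∑ℚ-+ : ∀ {n} (f g : Fin n → ℚ) → ∑ℚ (λ i → f i + g i) ≡ ∑ℚ f + ∑ℚ g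
∑ℚ-+ {zero}  f g = refl
∑ℚ-+ {suc n} f g = trans (cong (f zero + g zero +_) (∑ℚ-+ (f ∘ suc) (g ∘ suc)))
  (lemma (f zero) (g zero) (∑ℚ (f ∘ suc)) (∑ℚ (g ∘ suc)))
  where
  lemma : ∀ a b c d → a + b + (c + d) ≡ a + c + (b + d)
  lemma = solve-∀ ℚ-ring

bias : ∀ {n} → (Fin n → ℚ) → Bool → Fin n → ℚ
bias p true  i = p i
bias p false i = 1ℚ - p i

module Sorting {n : ℕ} (c ρ : Fin n → ℚ) (0<ρ : ∀ i → 0ℚ < ρ i) where

  private
    key : Fin n → ℚ
    key i = c i * (1/ ρ i) {{>-nonZero (0<ρ i)}}
    O = On.decTotalOrder ≤-decTotalOrder key

    cross : ∀ {i j} → key i ≤ key j → c i * ρ j ≤ c j * ρ i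
    cross {i} {j} ki≤kj = subst₂ _≤_ (side (ρ j) i) (side′ j i)
      (*-monoʳ-≤-nonNeg (ρ j * ρ i) {{nonNegative (0≤* (<⇒≤ (0<ρ j)) (<⇒≤ (0<ρ i)))}} ki≤kj)
      where
      side : ∀ t i → key i * (t * ρ i) ≡ c i * t
      side t i = trans (lemma (c i) ((1/ ρ i) {{>-nonZero (0<ρ i)}}) t (ρ i))
        (trans (cong (c i * t *_) (*-inverseˡ (ρ i) {{>-nonZero (0<ρ i)}})) (*-identityʳ (c i * t)))
        where
        lemma : ∀ c r t p → c * r * (t * p) ≡ c * t * (r * p)
        lemma = solve-∀ ℚ-ring
      side′ : ∀ j i → key j * (ρ j * ρ i) ≡ c j * ρ i
      side′ j i = trans (cong (key j *_) (*-comm (ρ j) (ρ i))) (side (ρ i) j)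

  order-by-ratio : List (Fin n)
  order-by-ratio = Sort.sort O (allFin n)

  order-↭ : order-by-ratio ↭ allFin n
  order-↭ = Sort.sort-↭ O (allFin n)

  order-sorted : AllPairs (λ i j → c i * ρ j ≤ c j * ρ i) order-by-ratio
  order-sorted = AllPairs.map cross (Linked⇒AllPairs ≤-trans (Sort.sort-↗ O (allFin n)))

Unique-↭ : ∀ {n} {l : List (Fin n)} → l ↭ allFin n → Unique l
Unique-↭ {n} l↭ = Permₛ.Unique-resp-↭ (setoid (Fin n)) (↭⇒↭ₛ (↭-sym l↭)) (allFin⁺ n)

hits-same : ∀ b → hits b (just b) ≡ 1
hits-same true  = refl
hits-same false = refl

hits-not : ∀ b → hits b (just (not b)) ≡ 0
hits-not true  = refl
hits-not false = refl

bias-split : ∀ {n} (p : Fin n → ℚ) b s i g → lookup s i ≡ nothing →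
  𝔼 p s g ≡ bias p b i * 𝔼 p (s [ i ]≔ just b) g + (1ℚ - bias p b i) * 𝔼 p (s [ i ]≔ just (not b)) g
bias-split p true  s i g un = 𝔼-split p s i g un
bias-split p false s i g un = trans (𝔼-split p s i g un)
  (lemma (p i) (𝔼 p (s [ i ]≔ just true) g) (𝔼 p (s [ i ]≔ just false) g))
  where
  lemma : ∀ p a b → p * a + (1ℚ - p) * b ≡ (1ℚ - p) * b + (1ℚ - (1ℚ - p)) * a
  lemma = solve-∀ ℚ-ring

-- Costs along an order on a fixed input

module Path {n : ℕ} (c : Fin n → ℚ) (b : Bool) (x : Vec Bool n) where

  -- The pointwise counterpart of `successCost`, before restriction to the event that `l` holds `k`
  -- values `b`. The factor `enough` in `gated` imposes that event.
  pathCost : List (Fin n) → ℕ → ℚ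
  pathCost l       zero    = 0ℚ
  pathCost []      (suc k) = 0ℚ
  pathCost (i ∷ l) (suc k) = c i + pathCost l (suc k ℕ.∸ hits b (just (lookup x i)))

  tallyˣ : List (Fin n) → ℕ
  tallyˣ = tally b (Vec.map just x)

  enough : List (Fin n) → ℕ → ℚ
  enough l k = if k ℕ.≤ᵇ tallyˣ l then 1ℚ else 0ℚ

  gated : List (Fin n) → ℕ → ℚ
  gated l k = enough l k * pathCost l k

  tallyˣ-cons : ∀ i l → tallyˣ (i ∷ l) ≡ hits b (just (lookup x i)) ℕ.+ tallyˣ l
  tallyˣ-cons i l = cong (λ v → hits b v ℕ.+ tallyˣ l) (lookup-map i just x)

  module _ (i : Fin n) (l : List (Fin n)) (k : ℕ) where

    enough-same : lookup x i ≡ b → enough (i ∷ l) (suc k) ≡ enough l k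
    enough-same eq = trans (cong (λ t → if suc k ℕ.≤ᵇ t then 1ℚ else 0ℚ)
      (trans (tallyˣ-cons i l) (cong (ℕ._+ tallyˣ l) (trans (cong (hits b ∘ just) eq) (hits-same b))))) (shift k (tallyˣ l))
      where
      shift : ∀ k t → (if suc k ℕ.≤ᵇ suc t then 1ℚ else 0ℚ) ≡ (if k ℕ.≤ᵇ t then 1ℚ else 0ℚ)
      shift zero    t = refl
      shift (suc k) t = refl

    enough-not : lookup x i ≡ not b → enough (i ∷ l) (suc k) ≡ enough l (suc k)
    enough-not eq = cong (λ t → if suc k ℕ.≤ᵇ t then 1ℚ else 0ℚ)
      (trans (tallyˣ-cons i l) (cong (ℕ._+ tallyˣ l) (trans (cong (hits b ∘ just) eq) (hits-not b))))

    pathCost-same : lookup x i ≡ b → pathCost (i ∷ l) (suc k) ≡ c i + pathCost l k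
    pathCost-same eq = cong (λ t → c i + pathCost l (suc k ℕ.∸ t)) (trans (cong (hits b ∘ just) eq) (hits-same b))

    pathCost-not : lookup x i ≡ not b → pathCost (i ∷ l) (suc k) ≡ c i + pathCost l (suc k)
    pathCost-not eq = cong (λ t → c i + pathCost l (suc k ℕ.∸ t)) (trans (cong (hits b ∘ just) eq) (hits-not b))

    gated-same : lookup x i ≡ b → gated (i ∷ l) (suc k) ≡ c i * enough l k + gated l k
    gated-same eq = trans (cong₂ _*_ (enough-same eq) (pathCost-same eq)) (lemma (enough l k) (c i) (pathCost l k))
      where
      lemma : ∀ e c q → e * (c + q) ≡ c * e + e * q
      lemma = solve-∀ ℚ-ring

    gated-not : lookup x i ≡ not b → gated (i ∷ l) (suc k) ≡ c i * enough l (suc k) + gated l (suc k)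
    gated-not eq = trans (cong₂ _*_ (enough-not eq) (pathCost-not eq)) (lemma (enough l (suc k)) (c i) (pathCost l (suc k)))
      where
      lemma : ∀ e c q → e * (c + q) ≡ c * e + e * q
      lemma = solve-∀ ℚ-ring

  module _ (0≤c : ∀ i → 0ℚ ≤ c i) where

    0≤pathCost : ∀ l k → 0ℚ ≤ pathCost l k
    0≤pathCost l       zero    = ≤-refl
    0≤pathCost []      (suc k) = ≤-refl
    0≤pathCost (i ∷ l) (suc k) = 0≤+ (0≤c i) (0≤pathCost l (suc k ℕ.∸ hits b (just (lookup x i))))

    0≤enough : ∀ l k → 0ℚ ≤ enough l k
    0≤enough l k with k ℕ.≤ᵇ tallyˣ l
    ... | true  = nonNegative⁻¹ 1ℚ
    ... | false = ≤-refl

    0≤gated : ∀ l k → 0ℚ ≤ gated l k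
    0≤gated l k = 0≤* (0≤enough l k) (0≤pathCost l k)

  gated-enough : ∀ l k → k ℕ.≤ tallyˣ l → gated l k ≡ pathCost l k
  gated-enough l k k≤ = trans (cong (λ t → (if t then 1ℚ else 0ℚ) * pathCost l k)
    (Equivalence.to T-≡ (ℕ.≤⇒≤ᵇ k≤))) (*-identityˡ (pathCost l k))

module PathExpectation {n : ℕ} (p c : Fin n → ℚ) (b : Bool) where

  open Path c b
  open Ordered c (bias p b)

  unknown-tail : ∀ {s : State n} {i l} b′ → All (i ≢_) l → All (λ j → lookup s j ≡ nothing) l →
                 All (λ j → lookup (s [ i ]≔ just b′) j ≡ nothing) l
  unknown-tail b′ []          []         = []
  unknown-tail {s} b′ (i≢j ∷ i≢) (un ∷ uns) =
    trans (lookup∘update′ (i≢j ∘ sym) s (just b′)) un ∷ unknown-tail {s} b′ i≢ uns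

  𝔼-enough : ∀ s l k → Unique l → All (λ j → lookup s j ≡ nothing) l →
             𝔼 p s (λ x → enough x l k) ≡ tail l k
  𝔼-enough s l       zero    u uns = 𝔼-const p s 1ℚ
  𝔼-enough s []      (suc k) u uns = 𝔼-const p s 0ℚ
  𝔼-enough s (i ∷ l) (suc k) (i≢ ∷ u) (un ∷ uns) = trans (bias-split p b s i _ un)
    (cong₂ (λ t u → bias p b i * t + (1ℚ - bias p b i) * u)
      (branch b k λ x eq → enough-same x i l k eq)
      (branch (not b) (suc k) λ x eq → enough-not x i l k eq))
    where
    branch : ∀ b′ k′ → (∀ x → lookup x i ≡ b′ → enough x (i ∷ l) (suc k) ≡ enough x l k′) →
             𝔼 p (s [ i ]≔ just b′) (λ x → enough x (i ∷ l) (suc k)) ≡ tail l k′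
    branch b′ k′ eq = trans
      (𝔼-cong p (s [ i ]≔ just b′) λ x x∼ →
        eq x (follows-lookup x (s [ i ]≔ just b′) i (lookup∘update i s (just b′)) x∼))
      (𝔼-enough (s [ i ]≔ just b′) l k′ u (unknown-tail {s} b′ i≢ uns))

  -- Conditioning on the head leaves its cost times the event for the tail, whose mean is
  -- `𝔼-enough`. Distinctness of `l` keeps the tail unknown after the head is revealed.
  𝔼-gated : ∀ s l k → Unique l → All (λ j → lookup s j ≡ nothing) l →
            𝔼 p s (λ x → gated x l k) ≡ successCost l k
  𝔼-gated s l       zero    u uns = 𝔼-const p s 0ℚ
  𝔼-gated s []      (suc k) u uns = 𝔼-const p s 0ℚ
  𝔼-gated s (i ∷ l) (suc k) (i≢ ∷ u) (un ∷ uns) = trans (bias-split p b s i _ un)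
    (trans (cong₂ (λ t u → bias p b i * t + (1ℚ - bias p b i) * u)
      (branch b k λ x eq → gated-same x i l k eq)
      (branch (not b) (suc k) λ x eq → gated-not x i l k eq))
    (lemma (bias p b i) (c i) (tail l k) (successCost l k) (tail l (suc k)) (successCost l (suc k))))
    where
    branch : ∀ b′ k′ → (∀ x → lookup x i ≡ b′ → gated x (i ∷ l) (suc k) ≡ c i * enough x l k′ + gated x l k′) →
             𝔼 p (s [ i ]≔ just b′) (λ x → gated x (i ∷ l) (suc k)) ≡ c i * tail l k′ + successCost l k′
    branch b′ k′ eq = begin
      𝔼 p s′ (λ x → gated x (i ∷ l) (suc k))
        ≡⟨ 𝔼-cong p s′ (λ x x∼ → eq x (follows-lookup x s′ i (lookup∘update i s (just b′)) x∼)) ⟩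
      𝔼 p s′ (λ x → c i * enough x l k′ + gated x l k′)
        ≡⟨ 𝔼-+ p s′ (λ x → c i * enough x l k′) (λ x → gated x l k′) ⟩
      𝔼 p s′ (λ x → c i * enough x l k′) + 𝔼 p s′ (λ x → gated x l k′)
        ≡⟨ cong₂ _+_ (𝔼-* p s′ (c i) (λ x → enough x l k′)) (𝔼-gated s′ l k′ u (unknown-tail {s} b′ i≢ uns)) ⟩
      c i * 𝔼 p s′ (λ x → enough x l k′) + successCost l k′
        ≡⟨ cong (λ t → c i * t + successCost l k′) (𝔼-enough s′ l k′ u (unknown-tail {s} b′ i≢ uns)) ⟩
      c i * tail l k′ + successCost l k′ ∎
      where
      open ≡-Reasoning
      s′ = s [ i ]≔ just b′
    lemma : ∀ r c t s t′ s′ → r * (c * t + s) + (1ℚ - r) * (c * t′ + s′)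
                            ≡ c * (r * t + (1ℚ - r) * t′) + (r * s + (1ℚ - r) * s′)
    lemma = solve-∀ ℚ-ring

-- The cost of `l` up to and including `i`, or of all of `l` if `i` is absent.
cumulative : ∀ {n} → (Fin n → ℚ) → List (Fin n) → Fin n → ℚ
cumulative c []      i = 0ℚ
cumulative c (j ∷ l) i with j ≟ᶠ i
... | yes _ = c j
... | no _  = c j + cumulative c l i

module Cumulative {n : ℕ} (c : Fin n → ℚ) (0≤c : ∀ i → 0ℚ ≤ c i) where

  cumulative-cons : ∀ j l i → cumulative c (j ∷ l) i ≤ c j + cumulative c l i
  cumulative-cons j l i with j ≟ᶠ i
  ... | yes _ = ≤-by (cumulative c l i) (0≤cumulative l) refl
    where
    0≤cumulative : ∀ l → 0ℚ ≤ cumulative c l i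
    0≤cumulative []      = ≤-refl
    0≤cumulative (j ∷ l) with j ≟ᶠ i
    ... | yes _ = 0≤c j
    ... | no _  = 0≤+ (0≤c j) (0≤cumulative l)
  ... | no _  = ≤-refl

  cumulative-head : ∀ j l → cumulative c (j ∷ l) j ≡ c j
  cumulative-head j l with j ≟ᶠ j
  ... | yes _ = refl
  ... | no ≢  = contradiction refl ≢

  cumulative-tail : ∀ j l {i} → j ≢ i → cumulative c (j ∷ l) i ≡ c j + cumulative c l i
  cumulative-tail j l {i} j≢i with j ≟ᶠ i
  ... | yes eq = contradiction eq j≢i
  ... | no _   = refl

  -- The cumulative cost of the last selected element already contains the cost of every selected
  -- one. The induction subtracts each selected head from `a`, just as the cumulative costs behind
  -- it drop by `c i`.
  budget : ∀ l a (φ : Fin n → Bool) → Unique l → 0ℚ ≤ a →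
           (∀ {i} → i ∈ l → φ i ≡ true → cumulative c l i ≤ a) →
           ∑ᴸ (λ i → if φ i then c i else 0ℚ) l ≤ a
  budget []      a φ u        0≤a ok = 0≤a
  budget (i ∷ l) a φ (i≢ ∷ u) 0≤a ok with φ i in eq
  ... | true  = subst (_ ≤_) (lemma (c i) a) (+-monoʳ-≤ (c i) (budget l (a - c i) φ u (0≤-diff ci≤a) ok′))
    where
    ci≤a : c i ≤ a
    ci≤a = subst (_≤ a) (cumulative-head i l) (ok (here refl) eq)
    ok′ : ∀ {j} → j ∈ l → φ j ≡ true → cumulative c l j ≤ a - c i
    ok′ {j} j∈l φj = ≤-by (a - (c i + cumulative c l j))
      (0≤-diff (subst (_≤ a) (cumulative-tail i l (All.lookup i≢ j∈l)) (ok (there j∈l) φj)))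
      (lemma′ (cumulative c l j) a (c i))
      where
      lemma′ : ∀ q a c → q + (a - (c + q)) ≡ a - c
      lemma′ = solve-∀ ℚ-ring
    lemma : ∀ c a → c + (a - c) ≡ a
    lemma = solve-∀ ℚ-ring
  ... | false = subst (_≤ a) (sym (+-identityˡ _)) (budget l a φ u 0≤a λ {j} j∈l φj →
    ≤-trans (≤-by (c i) (0≤c i) (trans (+-comm (cumulative c l j) (c i))
      (sym (cumulative-tail i l (All.lookup i≢ j∈l))))) (ok (there j∈l) φj))

  module _ (b : Bool) (x : Vec Bool n) (s : State n) (x∼s : x FollowsFrom s) where

    open Path c b x

    known-value : ∀ {i} → lookup s i ≢ nothing → lookup s i ≡ just (lookup x i)
    known-value {i} ≢no with x∼s i
    ... | inj₁ eq = eq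
    ... | inj₂ eq = contradiction eq ≢no

    -- The prefix of `l` that ends with the `k`-th value `b` costs `pathCost l k` in total, so each
    -- of its elements has cumulative cost within the bound and has been tested.
    prefix-tally : ∀ l k → k ℕ.≤ tallyˣ l →
      (∀ {i} → i ∈ l → cumulative c l i ≤ pathCost l k → lookup s i ≢ nothing) → k ℕ.≤ tally b s l
    prefix-tally l       zero    k≤ tested = ℕ.z≤n
    prefix-tally (i ∷ l) (suc k) k≤ tested = begin
      suc k ≤⟨ ℕ.m≤n+m∸n (suc k) h ⟩
      h ℕ.+ (suc k ℕ.∸ h) ≤⟨ ℕ.+-monoʳ-≤ h (prefix-tally l (suc k ℕ.∸ h) enough-left tested′) ⟩
      h ℕ.+ tally b s l ≡⟨ cong (λ v → hits b v ℕ.+ tally b s l) (known-value i-tested) ⟨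
      hits b (lookup s i) ℕ.+ tally b s l ∎
      where
      open ℕ.≤-Reasoning
      h = hits b (just (lookup x i))
      i-tested : lookup s i ≢ nothing
      i-tested = tested (here refl) (subst (_≤ c i + pathCost l (suc k ℕ.∸ h)) (sym (cumulative-head i l))
        (≤-by _ (0≤pathCost 0≤c l (suc k ℕ.∸ h)) refl))
      tested′ : ∀ {j} → j ∈ l → cumulative c l j ≤ pathCost l (suc k ℕ.∸ h) → lookup s j ≢ nothing
      tested′ {j} j∈l le = tested (there j∈l) (≤-trans (cumulative-cons i l j) (+-monoʳ-≤ (c i) le))
      enough-left : suc k ℕ.∸ h ℕ.≤ tallyˣ l
      enough-left = ℕ.m≤n+o⇒m∸n≤o (suc k) h (subst (suc k ℕ.≤_) (tallyˣ-cons i l) k≤)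

follows-test : ∀ {n} (x : Vec Bool n) s i → x FollowsFrom s → x FollowsFrom (s [ i ]≔ just (lookup x i))
follows-test x s i x∼s j with j ≟ᶠ i
... | yes refl = inj₁ (lookup∘update i s (just (lookup x i)))
... | no j≢i   = subst (λ v → v ≡ just (lookup x j) ⊎ v ≡ nothing) (sym (lookup∘update′ j≢i s _)) (x∼s j)

follows-initial : ∀ {n} (x : Vec Bool n) → x FollowsFrom initial
follows-initial x i = inj₂ (lookup-initial i)

-- While `f` is undetermined, `suffices` leaves some variable of key at most `a` untested, and the
-- greedy choice has a key no larger than that one.
greedy-threshold : ∀ {n} (f : BoolFun n) (key : Fin n → ℚ) x a →
  (∀ s → x FollowsFrom s → (∀ i → key i ≤ a → lookup s i ≢ nothing) → Determined f s) →
  ∀ m s → x FollowsFrom s → (∀ i → lookup s i ≢ nothing → key i ≤ a) →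
  ∀ i → lookup (run m f (greedy λ _ → key) x s) i ≢ nothing → key i ≤ a
greedy-threshold f key x a suffices zero    s x∼s below = below
greedy-threshold f key x a suffices (suc m) s x∼s below with determined? f s
... | yes _   = below
... | no ¬det = greedy-threshold f key x a suffices m (s [ i ]≔ just (lookup x i))
                  (follows-test x s i x∼s) below′
  where
  h = undetermined⇒incomplete f s ¬det
  i = choose (greedy λ _ → key) s h
  i≤a : key i ≤ a
  i≤a with key i ≤? a
  ... | yes le = le
  ... | no ≰   = contradiction (suffices s x∼s λ j j≤a un →
    ≰ (≤-trans (greedy-least (λ _ → key) s h j un) j≤a)) ¬det
  below′ : ∀ j → lookup (s [ i ]≔ just (lookup x i)) j ≢ nothing → key j ≤ a
  below′ j ≢no with j ≟ᶠ i
  ... | yes refl = i≤a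
  ... | no j≢i   = below j (≢no ∘ trans (lookup∘update′ j≢i s _))

∑ℚ-if : ∀ {n} (c : Fin n → ℚ) {l} → l ↭ allFin n → (φ : Fin n → Bool) →
        ∑ᴸ (λ i → if φ i then c i else 0ℚ) l ≡ ∑ℚ (λ i → if φ i then c i else 0ℚ)
∑ℚ-if c l↭ φ = trans (∑ᴸ-↭ _ l↭) (∑ᴸ-allFin (λ i → if φ i then c i else 0ℚ))

atMost : ℚ → ℚ → Bool
atMost a q with q ≤? a
... | yes _ = true
... | no _  = false

atMost-sound : ∀ a q → atMost a q ≡ true → q ≤ a
atMost-sound a q eq with q ≤? a
... | yes le = le

atMost-complete : ∀ a q → q ≤ a → atMost a q ≡ true
atMost-complete a q le with q ≤? a
... | yes _ = refl
... | no ≰  = contradiction le ≰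

module Interleaving {n k k̄ : ℕ} (k+k̄ : k ℕ.+ k̄ ≡ suc n) (p c : Fin n → ℚ)
  (0<p : ∀ i → 0ℚ < p i) (p<1 : ∀ i → p i < 1ℚ) (0≤c : ∀ i → 0ℚ ≤ c i) where

  open KOfN {n} {k} {k̄} k+k̄
  open Cumulative c 0≤c

  private
    f : BoolFun n
    f = kOfN k

    0<bias : ∀ b i → 0ℚ < bias p b i
    0<bias true  i = 0<p i
    0<bias false i = subst (_< 1ℚ - p i) (+-inverseʳ (p i)) (+-monoˡ-< (- p i) (p<1 i))

    by-ratio : Bool → List (Fin n)
    by-ratio b = Sorting.order-by-ratio c (bias p b) (0<bias b)

    by-ratio-↭ : ∀ b → by-ratio b ↭ allFin n
    by-ratio-↭ b = Sorting.order-↭ c (bias p b) (0<bias b)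

    Kᵇ : Bool → ℕ
    Kᵇ b = select b k k̄

    budgetᵇ : Bool → Vec Bool n → ℚ
    budgetᵇ b x = Path.pathCost c b x (by-ratio b) (Kᵇ b)

    cum : Bool → Fin n → ℚ
    cum b = cumulative c (by-ratio b)

    key : Fin n → ℚ
    key i = cum true i ⊓ cum false i

    key≤cum : ∀ b i → key i ≤ cum b i
    key≤cum true  i = p⊓q≤p (cum true i) (cum false i)
    key≤cum false i = p⊓q≤q (cum true i) (cum false i)

  interleaving : Policy n
  interleaving = greedy λ _ → key

  interleaving-nonAdaptive : NonAdaptive interleaving
  interleaving-nonAdaptive = greedy-nonAdaptive (λ _ → key) λ _ _ _ → refl

  private
    within : ℚ → Bool → Fin n → Bool
    within a b i = atMost a (cum b i)

    within-budget : ∀ a b → 0ℚ ≤ a → ∑ℚ (λ i → if within a b i then c i else 0ℚ) ≤ a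
    within-budget a b 0≤a = subst (_≤ a) (∑ℚ-if c (by-ratio-↭ b) (within a b))
      (budget (by-ratio b) a (within a b) (Unique-↭ (by-ratio-↭ b)) 0≤a λ {i} _ → atMost-sound a (cum b i))

    enough : ∀ b x → f x ≡ b → Kᵇ b ℕ.≤ tally b (Vec.map just x) (by-ratio b)
    enough b x fx = subst (Kᵇ b ℕ.≤_)
      (sym (trans (tally-all b (Vec.map just x) (by-ratio-↭ b)) (known-map x))) (evaluate⁻¹ b x fx)
      where
      known-map : ∀ {n} (x : Vec Bool n) → known b (Vec.map just x) ≡ count b x
      known-map []       = refl
      known-map (b′ ∷ x) = cong (hits b (just b′) ℕ.+_) (known-map x)

    final-cost : ∀ b x → f x ≡ b → spent c (finalState f interleaving x) ≤ budgetᵇ b x + budgetᵇ b x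
    final-cost b x fx = ≤-trans (∑ℚ-mono split)
      (subst (_≤ a + a) (sym (∑ℚ-+ (part true) (part false)))
        (+-mono-≤ (within-budget a true 0≤a) (within-budget a false 0≤a)))
      where
      a = budgetᵇ b x
      0≤a = Path.0≤pathCost c b x 0≤c (by-ratio b) (Kᵇ b)
      s = finalState f interleaving x
      suffices : ∀ s → x FollowsFrom s → (∀ i → key i ≤ a → lookup s i ≢ nothing) → Determined f s
      suffices s x∼s tested = determined b s (subst (Kᵇ b ℕ.≤_) (tally-all b s (by-ratio-↭ b))
        (prefix-tally b x s x∼s (by-ratio b) (Kᵇ b) (enough b x fx) λ {i} _ cum≤a →
          tested i (≤-trans (key≤cum b i) cum≤a)))
      below : ∀ i → lookup s i ≢ nothing → key i ≤ a
      below = greedy-threshold f key x a suffices n initial (follows-initial x)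
        λ i ≢no → contradiction (lookup-initial i) ≢no
      part : Bool → Fin n → ℚ
      part b′ i = if within a b′ i then c i else 0ℚ
      0≤part : ∀ b′ i → 0ℚ ≤ part b′ i
      0≤part b′ i with within a b′ i
      ... | true  = 0≤c i
      ... | false = ≤-refl
      part≡ : ∀ b′ i → cum b′ i ≤ a → part b′ i ≡ c i
      part≡ b′ i le = cong (λ t → if t then c i else 0ℚ) (atMost-complete a (cum b′ i) le)
      cover : ∀ i → key i ≤ a → c i ≤ part true i + part false i
      cover i key≤a with ⊓-sel (cum true i) (cum false i)
      ... | inj₁ eq = ≤-by (part false i) (0≤part false i)
        (cong (_+ part false i) (sym (part≡ true i (subst (_≤ a) eq key≤a))))
      ... | inj₂ eq = ≤-by (part true i) (0≤part true i)
        (trans (+-comm (c i) (part true i)) (cong (part true i +_) (sym (part≡ false i (subst (_≤ a) eq key≤a)))))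
      split : ∀ i → (if is-just (lookup s i) then c i else 0ℚ) ≤ part true i + part false i
      split i with lookup s i in eq
      ... | nothing = 0≤+ (0≤part true i) (0≤part false i)
      ... | just _  = cover i (below i λ eq′ → case trans (sym eq) eq′ of λ ())

    gatedᵇ : Bool → Vec Bool n → ℚ
    gatedᵇ b x = Path.gated c b x (by-ratio b) (Kᵇ b)

    -- The gate for the value of `f x` is open and the other term is nonnegative. Bounding by the
    -- sum of both avoids splitting the expectation by the value of `f`.
    final-gated : ∀ x → spent c (finalState f interleaving x) ≤
                        (1ℚ + 1ℚ) * (gatedᵇ true x + gatedᵇ false x)
    final-gated x = go (f x) refl
      where
      0≤gatedᵇ : ∀ b → 0ℚ ≤ gatedᵇ b x
      0≤gatedᵇ b = Path.0≤gated c b x 0≤c (by-ratio b) (Kᵇ b)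
      gated≡budget : ∀ b → f x ≡ b → gatedᵇ b x ≡ budgetᵇ b x
      gated≡budget b fx = Path.gated-enough c b x (by-ratio b) (Kᵇ b)
        (enough b x fx)
      twice : ∀ {S} a o → 0ℚ ≤ o → S ≤ a + a → S ≤ (1ℚ + 1ℚ) * (a + o)
      twice a o 0≤o S≤ = ≤-trans S≤ (≤-by (o + o) (0≤+ 0≤o 0≤o) (lemma a o))
        where
        lemma : ∀ a o → a + a + (o + o) ≡ (1ℚ + 1ℚ) * (a + o)
        lemma = solve-∀ ℚ-ring
      S = spent c (finalState f interleaving x)
      go : ∀ b → f x ≡ b → S ≤ (1ℚ + 1ℚ) * (gatedᵇ true x + gatedᵇ false x)
      go true fx = twice (gatedᵇ true x) (gatedᵇ false x) (0≤gatedᵇ false)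
        (subst (λ t → S ≤ t + t) (sym (gated≡budget true fx)) (final-cost true x fx))
      go false fx = subst (λ t → S ≤ (1ℚ + 1ℚ) * t) (+-comm (gatedᵇ false x) (gatedᵇ true x))
        (twice (gatedᵇ false x) (gatedᵇ true x) (0≤gatedᵇ true)
          (subst (λ t → S ≤ t + t) (sym (gated≡budget false fx)) (final-cost false x fx)))

    all-unknown : ∀ (l : List (Fin n)) → All.All (λ j → lookup initial j ≡ nothing) l
    all-unknown l = All.universal lookup-initial l

    𝔼-gatedᵇ : ∀ b → 𝔼 p initial (gatedᵇ b) ≡ Ordered.successCost c (bias p b) (by-ratio b) (Kᵇ b)
    𝔼-gatedᵇ b = PathExpectation.𝔼-gated p c b initial (by-ratio b) (Kᵇ b)
      (Unique-↭ (by-ratio-↭ b)) (all-unknown (by-ratio b))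

    lists : ∀ b → Lists initial (by-ratio b)
    lists b .Lists.covers i _ = ∈-resp-↭ (↭-sym (by-ratio-↭ b)) (∈-allFin i)
    lists b .Lists.exact = trans (↭-length (by-ratio-↭ b))
      (trans (length-tabulate {n = n} (λ i → i)) (sym (unknowns-initial n)))

  two-approximation : ∀ π → expected p c f interleaving ≤ (1ℚ + 1ℚ) * expected p c f π
  two-approximation π = begin
    expected p c f interleaving
      ≤⟨ 𝔼-mono p (<⇒≤ ∘ 0<p) (<⇒≤ ∘ p<1) initial (λ x _ → final-gated x) ⟩
    𝔼 p initial (λ x → (1ℚ + 1ℚ) * (gatedᵇ true x + gatedᵇ false x))
      ≡⟨ trans (𝔼-* p initial (1ℚ + 1ℚ) _) (cong ((1ℚ + 1ℚ) *_) (𝔼-+ p initial (gatedᵇ true) (gatedᵇ false))) ⟩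
    (1ℚ + 1ℚ) * (𝔼 p initial (gatedᵇ true) + 𝔼 p initial (gatedᵇ false))
      ≡⟨ cong ((1ℚ + 1ℚ) *_) (cong₂ _+_ (𝔼-gatedᵇ true) (𝔼-gatedᵇ false)) ⟩
    (1ℚ + 1ℚ) * (bound (by-ratio true) (by-ratio false) k k̄)
      ≤⟨ *-monoˡ (nonNegative⁻¹ (1ℚ + 1ℚ)) lower ⟩
    (1ℚ + 1ℚ) * expected p c f π ∎
    where
    open ≤-Reasoning
    open PolicyBound {n} {k} {k̄} k+k̄ p c (<⇒≤ ∘ 0<p) (<⇒≤ ∘ p<1) π
    spent-initial : ∀ {n} (c : Fin n → ℚ) → spent c initial ≡ 0ℚ
    spent-initial {zero}  c = refl
    spent-initial {suc n} c = trans (+-identityˡ _) (spent-initial (c ∘ suc))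
    lower : bound (by-ratio true) (by-ratio false) k k̄ ≤ expected p c f π
    lower = subst (_≤ expected p c f π)
      (trans (cong (_+ bound (by-ratio true) (by-ratio false) k k̄) (spent-initial c)) (+-identityˡ _))
      (value-bound n initial (by-ratio true) (by-ratio false) k k̄
        (cong (ℕ._+ k) (known-initial n true)) (cong (ℕ._+ k̄) (known-initial n false))
        (lists true) (lists false) (↭-trans (by-ratio-↭ true) (↭-sym (by-ratio-↭ false)))
        (Sorting.order-sorted c (bias p true) (0<bias true)) (Sorting.order-sorted c (bias p false) (0<bias false))
        (ℕ.≤-reflexive (unknowns-initial n)))

-- From rational approximations to real instances

∑ᴸ-++ : ∀ {I : Set} (f : I → ℚ) l l′ → ∑ᴸ f (l List.++ l′) ≡ ∑ᴸ f l + ∑ᴸ f l′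
∑ᴸ-++ f []      l′ = sym (+-identityˡ _)
∑ᴸ-++ f (i ∷ l) l′ = trans (cong (f i +_) (∑ᴸ-++ f l l′)) (sym (+-assoc (f i) (∑ᴸ f l) (∑ᴸ f l′)))

∑ᴸ-* : ∀ {I : Set} q (f : I → ℚ) l → ∑ᴸ (λ i → q * f i) l ≡ q * ∑ᴸ f l
∑ᴸ-* q f []      = sym (*-zeroʳ q)
∑ᴸ-* q f (i ∷ l) = trans (cong (q * f i +_) (∑ᴸ-* q f l)) (sym (*-distribˡ-+ q (f i) (∑ᴸ f l)))

∑ᴸ-cong : ∀ {I : Set} {f g : I → ℚ} → (∀ i → f i ≡ g i) → ∀ l → ∑ᴸ f l ≡ ∑ᴸ g l
∑ᴸ-cong f≗g []      = refl
∑ᴸ-cong f≗g (i ∷ l) = cong₂ _+_ (f≗g i) (∑ᴸ-cong f≗g l)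

weight : ∀ {n} → (Fin n → ℚ) → Vec Bool n → ℚ
weight p x = Vector.foldr _*_ 1ℚ λ i → if lookup x i then p i else 1ℚ - p i

𝔼-initial : ∀ {n} (p : Fin n → ℚ) g → ∑ᴸ (λ x → weight p x * g x) (cube n) ≡ 𝔼 p initial g
𝔼-initial {zero}  p g = trans (+-identityʳ (1ℚ * g [])) (*-identityˡ (g []))
𝔼-initial {suc n} p g = trans
  (∑ᴸ-++ (λ x → weight p x * g x) (List.map (true ∷_) (cube n)) (List.map (false ∷_) (cube n)))
  (cong₂ _+_ (branch true) (branch false))
  where
  first : Bool → ℚ
  first b = if b then p zero else 1ℚ - p zero
  branch : ∀ b → ∑ᴸ (λ x → weight p x * g x) (List.map (b ∷_) (cube n)) ≡
                 first b * 𝔼 (p ∘ suc) initial (g ∘ (b ∷_))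
  branch b = trans (∑ᴸ-map (λ x → weight p x * g x) (b ∷_) (cube n))
    (trans (∑ᴸ-cong (λ x → *-assoc (first b) (weight (p ∘ suc) x) (g (b ∷ x))) (cube n))
    (trans (∑ᴸ-* (first b) (λ x → weight (p ∘ suc) x * g (b ∷ x)) (cube n))
           (cong (first b *_) (𝔼-initial (p ∘ suc) (g ∘ (b ∷_))))))

at : ∀ {n} → ℕ → (Fin n → ℝ) → Fin n → ℚ
at m v i = seq (v i) m

seq-∑ : ∀ {n} m (v : Fin n → ℝ) → seq (∑ v) m ≡ ∑ℚ (at m v)
seq-∑ {zero}  m v = refl
seq-∑ {suc n} m v = cong (seq (v zero) m +_) (seq-∑ m (v ∘ suc))

seq-∏ : ∀ {n} m (v : Fin n → ℝ) → seq (∏ v) m ≡ Vector.foldr _*_ 1ℚ (at m v)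
seq-∏ {zero}  m v = refl
seq-∏ {suc n} m v = cong (seq (v zero) m *_) (seq-∏ m (v ∘ suc))

∑ℚ-cong : ∀ {n} {f g : Fin n → ℚ} → (∀ i → f i ≡ g i) → ∑ℚ f ≡ ∑ℚ g
∑ℚ-cong {zero}  f≗g = refl
∑ℚ-cong {suc n} f≗g = cong₂ _+_ (f≗g zero) (∑ℚ-cong (f≗g ∘ suc))

∏ℚ-cong : ∀ {n} {f g : Fin n → ℚ} → (∀ i → f i ≡ g i) → Vector.foldr _*_ 1ℚ f ≡ Vector.foldr _*_ 1ℚ g
∏ℚ-cong {zero}  f≗g = refl
∏ℚ-cong {suc n} f≗g = cong₂ _*_ (f≗g zero) (∏ℚ-cong (f≗g ∘ suc))

seq-if : ∀ b x y m → seq (if b then x else y) m ≡ (if b then seq x m else seq y m)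
seq-if true  x y m = refl
seq-if false x y m = refl

seq-cost : ∀ {n} m (f : BoolFun n) c π x →
           seq (cost f c π x) m ≡ spent (at m c) (finalState f π x)
seq-cost m f c π x = trans (seq-∑ m λ i → if is-just (lookup (finalState f π x) i) then c i else 0ℝ)
  (∑ℚ-cong λ i → seq-if (is-just (lookup (finalState f π x) i)) (c i) 0ℝ m)

seq-probability : ∀ {n} m (p : Fin n → ℝ) x → seq (probability p x) m ≡ weight (at m p) x
seq-probability m p x = trans (seq-∏ m λ i → if lookup x i then p i else 1ℝ ℝ.- p i) (∏ℚ-cong λ i → seq-if (lookup x i) (p i) (1ℝ ℝ.- p i) m)

seq-expectation : ∀ {n} m (p : Fin n → ℝ) g →
                  seq (expectation p g) m ≡ 𝔼 (at m p) initial (λ x → seq (g x) m)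
seq-expectation {n} m p g = trans (sums (cube n)) (trans
  (∑ᴸ-cong (λ x → cong (_* seq (g x) m) (seq-probability m p x)) (cube n))
  (𝔼-initial (at m p) λ x → seq (g x) m))
  where
  sums : ∀ l → seq (List.foldr ℝ._+_ 0ℝ (List.map (λ x → probability p x ℝ.* g x) l)) m ≡
               ∑ᴸ (λ x → seq (probability p x) m * seq (g x) m) l
  sums []      = refl
  sums (x ∷ l) = cong (seq (probability p x) m * seq (g x) m +_) (sums l)

-- Addition, subtraction and multiplication of reals act on each index separately, so each index of
-- a real expected cost is the expected cost of rational data. These data satisfy the constraints of
-- an instance only eventually, and the costs only up to a tolerance.
seq-expectedCost : ∀ (I : Instance) (let open Instance I) π m →
                   seq (expectedCost π) m ≡ expected (at m p) (at m c) (kOfN k) π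
seq-expectedCost I π m = trans (seq-expectation m p (cost (kOfN k) c π))
  (𝔼-cong (at m p) initial λ x _ → seq-cost m (kOfN k) c π x)
  where open Instance I

Eventually : (ℕ → Set) → Set
Eventually P = ∃[ N ] (∀ m → N ℕ.≤ m → P m)

both : ∀ {P Q : ℕ → Set} → Eventually P → Eventually Q → Eventually (λ m → P m × Q m)
both (M , h) (N , h′) = M ℕ.⊔ N , λ m le →
  h m (ℕ.m⊔n≤o⇒m≤o M N le) , h′ m (ℕ.m⊔n≤o⇒n≤o M N le)

eventually-map : ∀ {P Q : ℕ → Set} → (∀ m → P m → Q m) → Eventually P → Eventually Q
eventually-map f (N , h) = N , λ m le → f m (h m le)

eventually-Fin : ∀ {n} {P : Fin n → ℕ → Set} → (∀ i → Eventually (P i)) → Eventually (λ m → ∀ i → P i m)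
eventually-Fin {zero}  h = 0 , λ _ _ ()
eventually-Fin {suc n} h = eventually-map (λ { m (a , b) zero → a ; m (a , b) (suc i) → b i })
  (both (h zero) (eventually-Fin (h ∘ suc)))

eventually-Vec : ∀ {n} l {P : Vec (Fin n) l → ℕ → Set} →
                 (∀ v → Eventually (P v)) → Eventually (λ m → ∀ v → P v m)
eventually-Vec zero    h = eventually-map (λ { m a [] → a }) (h [])
eventually-Vec (suc l) h = eventually-map (λ { m a (i ∷ v) → a i v })
  (eventually-Fin λ i → eventually-Vec l (h ∘ (i ∷_)))

p≤∣p∣ : ∀ q → q ≤ ∣ q ∣
p≤∣p∣ q with ≤-total 0ℚ q
... | inj₁ 0≤q = ≤-reflexive (sym (0≤p⇒∣p∣≡p 0≤q))
... | inj₂ q≤0 = ≤-trans q≤0 (0≤∣p∣ q)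

close⇒≤ : ∀ a b {ε} → ∣ a - b ∣ ≤ ε → a ≤ b + ε
close⇒≤ a b {ε} h = subst (_≤ b + ε) (lemma a b) (+-monoʳ-≤ b (≤-trans (p≤∣p∣ (a - b)) h))
  where
  lemma : ∀ a b → b + (a - b) ≡ a
  lemma = solve-∀ ℚ-ring

small-factor : ∀ A ε → 0ℚ ≤ A → 0ℚ < ε → ∃[ η ] (0ℚ < η × A * η ≤ ε)
small-factor A ε 0≤A 0<ε = η , pos*pos 0<ε (1/-pos 0<1+A) ,
  ≤-trans (≤-by η (<⇒≤ (pos*pos 0<ε (1/-pos 0<1+A))) refl) (≤-reflexive
    (trans (lemma A ε ((1/ (1ℚ + A)) {{>-nonZero 0<1+A}}))
      (trans (cong (ε *_) (*-inverseˡ (1ℚ + A) {{>-nonZero 0<1+A}})) (*-identityʳ ε))))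
  where
  0<1+A : 0ℚ < 1ℚ + A
  0<1+A = +-mono-<-≤ (positive⁻¹ 1ℚ) 0≤A
  -- Division by `1 + A` instead of `A` also covers `A = 0`.
  η = ε * (1/ (1ℚ + A)) {{>-nonZero 0<1+A}}
  lemma : ∀ A ε r → A * (ε * r) + ε * r ≡ ε * (r * (1ℚ + A))
  lemma = solve-∀ ℚ-ring

-- Adding η to every cost makes slightly negative approximations of the costs nonnegative.
module Shifted {n : ℕ} (p c : Fin n → ℚ) (0≤p : ∀ i → 0ℚ ≤ p i) (p≤1 : ∀ i → p i ≤ 1ℚ)
               (η : ℚ) (0≤η : 0ℚ ≤ η) (f : BoolFun n) (π : Policy n) where

  shifted : Fin n → ℚ
  shifted i = c i + η

  total : ℚ
  total = ∑ℚ {n} λ _ → 1ℚ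

  total-η : ∀ n → ∑ℚ {n} (λ _ → η) ≡ ∑ℚ {n} (λ _ → 1ℚ) * η
  total-η zero    = sym (*-zeroˡ η)
  total-η (suc n) = trans (cong (η +_) (total-η n)) (lemma η (∑ℚ {n} λ _ → 1ℚ))
    where
    lemma : ∀ η t → η + t * η ≡ (1ℚ + t) * η
    lemma = solve-∀ ℚ-ring

  spent-≤ : ∀ s → spent c s ≤ spent shifted s
  spent-≤ s = ∑ℚ-mono λ i → go (is-just (lookup s i)) i
    where
    go : ∀ b i → (if b then c i else 0ℚ) ≤ (if b then shifted i else 0ℚ)
    go true  i = ≤-by η 0≤η refl
    go false i = ≤-refl

  spent-≥ : ∀ s → spent shifted s ≤ spent c s + total * η
  spent-≥ s = ≤-trans (∑ℚ-mono λ i → go (is-just (lookup s i)) i) (≤-reflexive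
    (trans (∑ℚ-+ (λ i → if is-just (lookup s i) then c i else 0ℚ) (λ _ → η)) (cong (spent c s +_) (total-η n))))
    where
    go : ∀ b i → (if b then shifted i else 0ℚ) ≤ (if b then c i else 0ℚ) + η
    go true  i = ≤-refl
    go false i = ≤-by η 0≤η refl

  expected-≤ : expected p c f π ≤ expected p shifted f π
  expected-≤ = 𝔼-mono p 0≤p p≤1 initial λ x _ → spent-≤ (finalState f π x)

  expected-≥ : expected p shifted f π ≤ expected p c f π + total * η
  expected-≥ = ≤-trans (𝔼-mono p 0≤p p≤1 initial λ x _ → spent-≥ (finalState f π x)) (≤-reflexive
    (trans (𝔼-+ p initial _ (λ _ → total * η)) (cong (expected p c f π +_) (𝔼-const p initial (total * η)))))

0≤∑ℚ-ones : ∀ n → 0ℚ ≤ ∑ℚ {n} (λ _ → 1ℚ)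
0≤∑ℚ-ones zero    = ≤-refl
0≤∑ℚ-ones (suc n) = 0≤+ (nonNegative⁻¹ 1ℚ) (0≤∑ℚ-ones n)

shifted-two-approximation : ∀ {n k k̄} → k ℕ.+ k̄ ≡ suc n → (p c : Fin n → ℚ) →
  (∀ i → 0ℚ < p i) → (∀ i → p i < 1ℚ) → ∀ η → 0ℚ ≤ η → (∀ i → 0ℚ ≤ c i + η) →
  ∃[ σ ] (NonAdaptive σ × (∀ π → expected p c (kOfN k) σ ≤
    (1ℚ + 1ℚ) * (expected p c (kOfN k) π + ∑ℚ {n} (λ _ → 1ℚ) * η)))
shifted-two-approximation {n} {k} {k̄} k+k̄ p c 0<p p<1 η 0≤η 0≤c+η =
  interleaving , interleaving-nonAdaptive , λ π →
    ≤-trans (Shifted.expected-≤ p c 0≤p p≤1 η 0≤η (kOfN k) interleaving)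
      (≤-trans (two-approximation π)
        (*-monoˡ (nonNegative⁻¹ (1ℚ + 1ℚ)) (Shifted.expected-≥ p c 0≤p p≤1 η 0≤η (kOfN k) π)))
  where
  0≤p : ∀ i → 0ℚ ≤ p i
  0≤p i = <⇒≤ (0<p i)
  p≤1 : ∀ i → p i ≤ 1ℚ
  p≤1 i = <⇒≤ (p<1 i)
  open Interleaving {n} {k} {k̄} k+k̄ p (λ i → c i + η) 0<p p<1 0≤c+η

absorb : ∀ a b s e e′ t η ε → a ≤ b + ½ * ε → b ≡ s → s ≤ (1ℚ + 1ℚ) * (e + t * η) →
         (1ℚ + 1ℚ) * t * η ≤ ½ * ε → e ≡ e′ → a ≤ (1ℚ + 1ℚ) * e′ + ε
absorb a b s e e t η ε a≤ refl s≤ small refl = begin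
  a ≤⟨ a≤ ⟩
  s + ½ * ε ≤⟨ +-monoˡ-≤ (½ * ε) s≤ ⟩
  (1ℚ + 1ℚ) * (e + t * η) + ½ * ε ≡⟨ regroup e t η (½ * ε) ⟩
  (1ℚ + 1ℚ) * e + ((1ℚ + 1ℚ) * t * η + ½ * ε) ≤⟨ +-monoʳ-≤ ((1ℚ + 1ℚ) * e) (+-monoˡ-≤ (½ * ε) small) ⟩
  (1ℚ + 1ℚ) * e + (½ * ε + ½ * ε) ≡⟨ cong ((1ℚ + 1ℚ) * e +_) (half+half ε) ⟩
  (1ℚ + 1ℚ) * e + ε ∎
  where
  open ≤-Reasoning
  regroup : ∀ e t η h → (1ℚ + 1ℚ) * (e + t * η) + h ≡ (1ℚ + 1ℚ) * e + ((1ℚ + 1ℚ) * t * η + h)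
  regroup = solve-∀ ℚ-ring

module UpperBoundOf (I : Instance) where

  open Instance I

  private
    f = kOfN {n} k
    A = (1ℚ + 1ℚ) * ∑ℚ {n} (λ _ → 1ℚ)

    k+k̄ : k ℕ.+ (suc n ℕ.∸ k) ≡ suc n
    k+k̄ = ℕ.m+[n∸m]≡n (ℕ.m≤n⇒m≤1+n k≤n)

    Good : ℚ → ℕ → Set
    Good η m = (∀ i → 0ℚ < at m p i) × (∀ i → at m p i < 1ℚ) × (∀ i → 0ℚ ≤ at m c i + η)

    within-limits : ∀ η → 0ℚ < η → Eventually (Good η)
    within-limits η 0<η = both (eventually-Fin λ i → above (p i) (0<p i))
      (both (eventually-Fin λ i → below (p i) (p<1 i)) (eventually-Fin λ i → 0≤c i η 0<η))
      where
      above : ∀ y → 0ℝ ℝ.< y → Eventually (λ m → 0ℚ < seq y m)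
      above y (δ , 0<δ , N , h) = N , λ m le → <-≤-trans 0<δ (subst (_≤ seq y m) (+-identityˡ δ) (h m le))
      below : ∀ y → y ℝ.< 1ℝ → Eventually (λ m → seq y m < 1ℚ)
      below y (δ , 0<δ , N , h) = N , λ m le →
        <-≤-trans (subst (_< seq y m + δ) (+-identityʳ (seq y m)) (+-monoʳ-< (seq y m) 0<δ)) (h m le)

  nonAdaptive≤twice : ∀ {π₀} → IsOPT-NA π₀ → ∀ π → expectedCost π₀ ℝ.≤ 2ℝ ℝ.* expectedCost π
  nonAdaptive≤twice {π₀} (_ , best) π ε 0<ε =
    -- One half of `ε` pays for shifting the costs, which amounts to `A * η` after doubling; the
    -- other half is the tolerance in comparing `π₀` with the orders.
    let η , 0<η , Aη≤ = small-factor A (½ * ε) (0≤* (nonNegative⁻¹ (1ℚ + 1ℚ)) (0≤∑ℚ-ones n)) (pos*pos 0<½ 0<ε)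
    in eventually-map {λ m → Good η m × Best m} {λ m → seq (expectedCost π₀) m ≤ (1ℚ + 1ℚ) * seq (expectedCost π) m + ε}
         (bound η 0<η Aη≤) (both {Good η} {Best} (within-limits η 0<η) eventually-best)
    where
    Best : ℕ → Set
    Best m = ∀ v → seq (expectedCost π₀) m ≤ seq (expectedCost (ordered v)) m + ½ * ε
    eventually-best : Eventually Best
    eventually-best = eventually-Vec n {λ v m → seq (expectedCost π₀) m ≤ seq (expectedCost (ordered v)) m + ½ * ε}
      λ v → best (ordered v) (ordered-nonAdaptive v) (½ * ε) (pos*pos 0<½ 0<ε)
    bound : ∀ η → 0ℚ < η → A * η ≤ ½ * ε → ∀ m → Good η m × Best m →
      seq (expectedCost π₀) m ≤ (1ℚ + 1ℚ) * seq (expectedCost π) m + ε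
    bound η 0<η Aη≤ m ((0<pₘ , pₘ<1 , 0≤c′) , π₀≤) =
      conclude (shifted-two-approximation {n} {k} {suc n ℕ.∸ k} k+k̄ (at m p) (at m c) 0<pₘ pₘ<1 η (<⇒≤ 0<η) 0≤c′)
      where
      conclude : ∃[ σ ] (NonAdaptive σ × (∀ π → expected (at m p) (at m c) f σ ≤
                   (1ℚ + 1ℚ) * (expected (at m p) (at m c) f π + ∑ℚ {n} (λ _ → 1ℚ) * η))) →
                 seq (expectedCost π₀) m ≤ (1ℚ + 1ℚ) * seq (expectedCost π) m + ε
      -- The policy `σ` depends on the index `m`, whereas optimality of `π₀` gives each fixed
      -- competitor its own threshold. Replacing `σ` by its order puts it among the finitely many
      -- competitors whose thresholds have been unified in `Best`.
      conclude (σ , σ-na , σ≤) = absorb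
        (seq (expectedCost π₀) m) (seq (expectedCost (ordered (order σ σ-na))) m)
        (expected (at m p) (at m c) f σ) (expected (at m p) (at m c) f π) (seq (expectedCost π) m)
        (∑ℚ {n} (λ _ → 1ℚ)) η ε
        (π₀≤ (order σ σ-na))
        (trans (seq-expectedCost I (ordered (order σ σ-na)) m) (order-expected (at m p) (at m c) f σ σ-na))
        (σ≤ π) Aη≤ (sym (seq-expectedCost I π m))

cut-inverse : ∀ δ (0<δ : 0ℚ < δ) q → δ ≤ q → q * cut-1/ δ 0<δ q ≡ 1ℚ
cut-inverse δ 0<δ q δ≤q = trans (cong (_* cut-1/ δ 0<δ q) (sym (p≥q⇒p⊔q≡p δ≤q)))
  (*-inverseʳ (q ⊔ δ) {{>-nonZero (0<⊔ q 0<δ)}})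

ratio-≤ : ∀ x y (pos : 0ℝ ℝ.< y) z → x ℝ.≤ z ℝ.* y → ratio x y pos ℝ.≤ z
ratio-≤ x y (δ , 0<δ , N , h) z x≤zy ε 0<ε =
  -- The tolerance is `ε * δ` because dividing by a denominator of at least `δ` enlarges it by a
  -- factor of at most `1 / δ`.
  eventually-map bound (both (N , h) (x≤zy (ε * δ) (pos*pos 0<ε 0<δ)))
  where
  bound : ∀ m → 0ℚ + δ ≤ seq y m × seq x m ≤ seq z m * seq y m + ε * δ →
          seq x m * cut-1/ δ 0<δ (seq y m) ≤ seq z m + ε
  bound m (δ≤ , x≤) = begin
    a * r ≤⟨ *-monoʳ-≤-nonNeg r {{nonNegative 0≤r}} x≤ ⟩
    (w * b + ε * δ) * r ≡⟨ lemma w b ε δ r ⟩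
    w * (b * r) + ε * (δ * r) ≤⟨ +-monoʳ-≤ (w * (b * r)) (*-monoˡ (<⇒≤ 0<ε) (*-monoʳ-≤-nonNeg r {{nonNegative 0≤r}} δ≤b)) ⟩
    w * (b * r) + ε * (b * r) ≡⟨ cong (λ t → w * t + ε * t) (cut-inverse δ 0<δ b δ≤b) ⟩
    w * 1ℚ + ε * 1ℚ ≡⟨ cong₂ _+_ (*-identityʳ w) (*-identityʳ ε) ⟩
    w + ε ∎
    where
    open ≤-Reasoning
    a = seq x m
    b = seq y m
    w = seq z m
    r = cut-1/ δ 0<δ b
    δ≤b : δ ≤ b
    δ≤b = subst (_≤ b) (+-identityˡ δ) δ≤
    0≤r : 0ℚ ≤ r
    0≤r = <⇒≤ (1/-pos (0<⊔ b 0<δ))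
    lemma : ∀ w b ε δ r → (w * b + ε * δ) * r ≡ w * (b * r) + ε * (δ * r)
    lemma = solve-∀ ℚ-ring

≈-≤-trans : ∀ x y z → x ℝ.≈ y → y ℝ.≤ z → x ℝ.≤ z
≈-≤-trans x y z x≈y y≤z ε 0<ε = eventually-map bound
  (both (x≈y (½ * ε) (pos*pos 0<½ 0<ε)) (y≤z (½ * ε) (pos*pos 0<½ 0<ε)))
  where
  bound : ∀ m → ∣ seq x m - seq y m ∣ ≤ ½ * ε × seq y m ≤ seq z m + ½ * ε → seq x m ≤ seq z m + ε
  bound m (x∼y , y≤) = ≤-trans (close⇒≤ (seq x m) (seq y m) x∼y) (≤-trans (+-monoˡ-≤ (½ * ε) y≤)
    (≤-reflexive (trans (+-assoc (seq z m) (½ * ε) (½ * ε)) (cong (seq z m +_) (half+half ε)))))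

adaptivity-upper : UpperBound AdaptivityRatio 2ℝ
adaptivity-upper r (I , opt , optNA , _ , isNA , pos , r≈) =
  ≈-≤-trans r (ratio (expectedCost optNA) (expectedCost opt) pos) 2ℝ r≈
    (ratio-≤ (expectedCost optNA) (expectedCost opt) pos 2ℝ
      (UpperBoundOf.nonAdaptive≤twice I {optNA} isNA opt))
  where open Instance I

-- A lower bound for non-adaptive policies

-- true marks the variables not yet tested.
mask : ∀ {n} → Vec Bool n → Vec Bool n → State n
mask = Vec.zipWith λ u b → if u then nothing else just b

marks : ∀ {n} → Vec Bool n → ℕ
marks = Vec.countᵇ λ u → u

left : ∀ {n} → (Fin n → ℚ) → Vec Bool n → ℚ
left c []      = 0ℚ
left c (u ∷ v) = (if u then c zero else 0ℚ) + left (c ∘ suc) v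

mask-unknowns : ∀ {n} (v x : Vec Bool n) → unknowns (mask v x) ≡ marks v
mask-unknowns []          []      = refl
mask-unknowns (true ∷ v)  (b ∷ x) = cong suc (mask-unknowns v x)
mask-unknowns (false ∷ v) (b ∷ x) = mask-unknowns v x

mask-lookup : ∀ {n} (v x : Vec Bool n) i → lookup (mask v x) i ≡ nothing → lookup v i ≡ true
mask-lookup (true ∷ v)  (b ∷ x) zero    eq = refl
mask-lookup (u ∷ v)     (b ∷ x) (suc i) eq = mask-lookup v x i eq

mask-lookup⁻¹ : ∀ {n} (v x : Vec Bool n) i → lookup v i ≡ true → lookup (mask v x) i ≡ nothing
mask-lookup⁻¹ (true ∷ v)  (b ∷ x) zero    eq = refl
mask-lookup⁻¹ (u ∷ v)     (b ∷ x) (suc i) eq = mask-lookup⁻¹ v x i eq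

mask-test : ∀ {n} (v x : Vec Bool n) i → mask (v [ i ]≔ false) x ≡ mask v x [ i ]≔ just (lookup x i)
mask-test (u ∷ v) (b ∷ x) zero    = refl
mask-test (u ∷ v) (b ∷ x) (suc i) = cong (_ ∷_) (mask-test v x i)

mask-all : ∀ {n} (x : Vec Bool n) → mask (replicate n true) x ≡ initial
mask-all []      = refl
mask-all (b ∷ x) = cong (nothing ∷_) (mask-all x)

marks-test : ∀ {n} (v : Vec Bool n) i → lookup v i ≡ true → marks v ≡ suc (marks (v [ i ]≔ false))
marks-test (true ∷ v)  zero    eq = refl
marks-test (true ∷ v)  (suc i) eq = cong suc (marks-test v i eq)
marks-test (false ∷ v) (suc i) eq = marks-test v i eq

left-test : ∀ {n} (c : Fin n → ℚ) v i → lookup v i ≡ true → left c v ≡ left c (v [ i ]≔ false) + c i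
left-test c (true ∷ v) zero eq = lemma (c zero) (left (c ∘ suc) v)
  where
  lemma : ∀ x y → x + y ≡ 0ℚ + y + x
  lemma = solve-∀ ℚ-ring
left-test c (u ∷ v) (suc i) eq = trans (cong (w +_) (left-test (c ∘ suc) v i eq))
  (sym (+-assoc w (left (c ∘ suc) (v [ i ]≔ false)) (c (suc i))))
  where w = if u then c zero else 0ℚ

left-none : ∀ {n} (c : Fin n → ℚ) v → marks v ≡ 0 → left c v ≡ 0ℚ
left-none c []          eq = refl
left-none c (false ∷ v) eq = trans (+-identityˡ _) (left-none (c ∘ suc) v eq)

left-all : ∀ {n} (c : Fin n → ℚ) → left c (replicate n true) ≡ ∑ℚ c
left-all {zero}  c = refl
left-all {suc n} c = cong (c zero +_) (left-all (c ∘ suc))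

spent-left : ∀ {n} (c : Fin n → ℚ) v x → spent c (mask v x) ≡ ∑ℚ c - left c v
spent-left c []          []      = refl
spent-left c (true ∷ v)  (b ∷ x) = trans (cong (0ℚ +_) (spent-left (c ∘ suc) v x))
  (lemma (c zero) (∑ℚ (c ∘ suc)) (left (c ∘ suc) v))
  where
  lemma : ∀ a b d → 0ℚ + (b - d) ≡ a + b - (a + d)
  lemma = solve-∀ ℚ-ring
spent-left c (false ∷ v) (b ∷ x) = trans (cong (c zero +_) (spent-left (c ∘ suc) v x))
  (lemma (c zero) (∑ℚ (c ∘ suc)) (left (c ∘ suc) v))
  where
  lemma : ∀ a b d → a + (b - d) ≡ a + b - (0ℚ + d)
  lemma = solve-∀ ℚ-ring

follows-untest : ∀ {n} (x : Vec Bool n) s i {b} → lookup s i ≡ nothing →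
                 x FollowsFrom (s [ i ]≔ just b) → x FollowsFrom s
follows-untest x s i un x∼ j with j ≟ᶠ i
... | yes refl = inj₂ un
... | no j≢i   = subst (λ v → v ≡ just (lookup x j) ⊎ v ≡ nothing) (lookup∘update′ j≢i s _) (x∼ j)

determined-test : ∀ {n} (f : BoolFun n) s i b → lookup s i ≡ nothing →
                  Determined f s → Determined f (s [ i ]≔ just b)
determined-test f s i b un det x y x∼ y∼ = det x y (follows-untest x s i un x∼) (follows-untest y s i un y∼)

-- Each unit of cost is charged while at least w times the cost left is still
-- undetermined, which sums to w times a triangular number.
module NonAdaptiveBound {n : ℕ} (p c : Fin n → ℚ) (f : BoolFun n)
  (0≤p : ∀ i → 0ℚ ≤ p i) (p≤1 : ∀ i → p i ≤ 1ℚ)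
  (0≤c : ∀ i → 0ℚ ≤ c i) (idem : ∀ i → c i * c i ≡ c i)
  (w : ℚ) (open-at : Vec Bool n → Vec Bool n → ℚ)
  (open≤1 : ∀ v x → open-at v x ≤ 1ℚ)
  (closed : ∀ v x → Determined f (mask v x) → open-at v x ≤ 0ℚ)
  (open-weight : ∀ v → w * left c v ≤ 𝔼 p initial (open-at v))
  (π : Policy n) (na : NonAdaptive π) where

  private
    C = ∑ℚ c

  masked-value : ℕ → Vec Bool n → ℚ
  masked-value m v = 𝔼 p initial λ x → spent c (run m f π x (mask v x))

  -- The cost of the tests already made, plus `w` times a triangular number. With costs 0 and 1 the
  -- latter collects `w * l` for each `l` from `left c v` down to 1.
  bound : Vec Bool n → ℚ
  bound v = C - left c v + w * (½ * (left c v * (left c v + 1ℚ)))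

  -- A fixed order tests the same variable next on every input. The induction can therefore remove
  -- that variable from `v` for all inputs at once and apply `open-weight` to the average.
  masked-bound : ∀ m v → marks v ≡ m → (∀ x → Reachable π (mask v x)) → bound v ≤ masked-value m v
  masked-bound zero v none reach = ≤-reflexive (begin
    bound v ≡⟨ cong (λ l → C - l + w * (½ * (l * (l + 1ℚ)))) (left-none c v none) ⟩
    C - 0ℚ + w * (½ * (0ℚ * (0ℚ + 1ℚ))) ≡⟨ lemma C w ½ ⟩
    C - 0ℚ ≡⟨ 𝔼-const p initial (C - 0ℚ) ⟨
    𝔼 p initial (λ _ → C - 0ℚ) ≡⟨ 𝔼-cong p initial (λ x _ → sym (trans (spent-left c v x) (cong (λ t → C - t) (left-none c v none)))) ⟩
    masked-value zero v ∎)
    where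
    open ≡-Reasoning
    lemma : ∀ C w h → C - 0ℚ + w * (h * (0ℚ * (0ℚ + 1ℚ))) ≡ C - 0ℚ
    lemma = solve-∀ ℚ-ring
  masked-bound (suc m) v some reach = begin
    bound v ≡⟨ arith (left c v) (left c v′) (left-test c v i vi) ⟩
    bound v′ + c i * (w * left c v - 1ℚ) ≤⟨ +-mono-≤ (masked-bound m v′ some′ reach′) (*-monoˡ (0≤c i) (+-monoˡ-≤ (- 1ℚ) (open-weight v))) ⟩
    masked-value m v′ + c i * (𝔼 p initial (open-at v) - 1ℚ) ≡⟨ cong (λ t → masked-value m v′ + c i * (𝔼 p initial (open-at v) + t)) (sym (𝔼-const p initial (- 1ℚ))) ⟩
    masked-value m v′ + c i * (𝔼 p initial (open-at v) + 𝔼 p initial (λ _ → - 1ℚ))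
      ≡⟨ cong (λ t → masked-value m v′ + c i * t) (sym (𝔼-+ p initial (open-at v) (λ _ → - 1ℚ))) ⟩
    masked-value m v′ + c i * 𝔼 p initial (λ x → open-at v x - 1ℚ) ≡⟨ cong (masked-value m v′ +_) (sym (𝔼-* p initial (c i) λ x → open-at v x - 1ℚ)) ⟩
    masked-value m v′ + 𝔼 p initial (λ x → c i * (open-at v x - 1ℚ)) ≡⟨ sym (𝔼-+ p initial _ _) ⟩
    𝔼 p initial (λ x → spent c (run m f π x (mask v′ x)) + c i * (open-at v x - 1ℚ))
      ≤⟨ 𝔼-mono p 0≤p p≤1 initial (λ x _ → pathwise x) ⟩
    masked-value (suc m) v ∎
    where
    open ≤-Reasoning
    x₀ = replicate n true
    h : ∀ x → Incomplete (mask v x)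
    h x = 0<unknowns⇒incomplete (mask v x) (subst (0 ℕ.<_) (sym (trans (mask-unknowns v x) some)) ℕ.z<s)
    i = choose π (mask v x₀) (h x₀)
    same : ∀ x → choose π (mask v x) (h x) ≡ i
    same x = na (reach x) (reach x₀) (h x) (h x₀) (trans (mask-unknowns v x) (sym (mask-unknowns v x₀)))
    vi : lookup v i ≡ true
    vi = mask-lookup v x₀ i (untested π (mask v x₀) (h x₀))
    un : ∀ x → lookup (mask v x) i ≡ nothing
    un x = mask-lookup⁻¹ v x i vi
    v′ = v [ i ]≔ false
    some′ : marks v′ ≡ m
    some′ = ℕ.suc-injective (trans (sym (marks-test v i vi)) some)
    reach′ : ∀ x → Reachable π (mask v′ x)
    reach′ x = subst (Reachable π) (sym (mask-test v x i))
      (subst (λ j → Reachable π (mask v x [ j ]≔ just (lookup x i))) (same x) (step (reach x) (h x) (lookup x i)))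
    -- The triangular number grows by `c i * l`; `idem` treats the costs 0 and 1 together.
    arith : ∀ l l′ → l ≡ l′ + c i →
      C - l + w * (½ * (l * (l + 1ℚ))) ≡ C - l′ + w * (½ * (l′ * (l′ + 1ℚ))) + c i * (w * l - 1ℚ)
    arith l l′ refl = trans (expand C l′ (c i) w ½)
      (trans (cong (λ e → C - l′ + w * (½ * (l′ * (l′ + 1ℚ))) - c i + w * ((½ + ½) * (l′ * c i) + ½ * (c i * c i) + ½ * e)) (sym (idem i)))
      (trans (collect C l′ (c i) w ½)
             (cong (λ e → C - l′ + w * (½ * (l′ * (l′ + 1ℚ))) + c i * (w * e - 1ℚ)) (*-identityˡ (l′ + c i)))))
      where
      expand : ∀ C l c w h → C - (l + c) + w * (h * ((l + c) * (l + c + 1ℚ))) ≡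
        C - l + w * (h * (l * (l + 1ℚ))) - c + w * ((h + h) * (l * c) + h * (c * c) + h * c)
      expand = solve-∀ ℚ-ring
      collect : ∀ C l c w h →
        C - l + w * (h * (l * (l + 1ℚ))) - c + w * ((h + h) * (l * c) + h * (c * c) + h * (c * c)) ≡
        C - l + w * (h * (l * (l + 1ℚ))) + c * (w * ((h + h) * (l + c)) - 1ℚ)
      collect = solve-∀ ℚ-ring
    -- If `f` is determined at `v`, the run from `v′` has paid `c i` in excess, and `closed` refunds
    -- it. Otherwise the two runs coincide and `open≤1` suffices.
    pathwise : ∀ x → spent c (run m f π x (mask v′ x)) + c i * (open-at v x - 1ℚ) ≤ spent c (run (suc m) f π x (mask v x))
    pathwise x = go (determined? f (mask v x))
      where
      go : Dec (Determined f (mask v x)) →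
           spent c (run m f π x (mask v′ x)) + c i * (open-at v x - 1ℚ) ≤ spent c (run (suc m) f π x (mask v x))
      go (yes det) = begin
        spent c (run m f π x (mask v′ x)) + c i * (open-at v x - 1ℚ)
          ≡⟨ cong (λ s → spent c s + c i * (open-at v x - 1ℚ)) (trans (cong (run m f π x) (mask-test v x i))
               (run-determined≡ m f π x _ (determined-test f (mask v x) i (lookup x i) (un x) det))) ⟩
        spent c (mask v x [ i ]≔ just (lookup x i)) + c i * (open-at v x - 1ℚ)
          ≡⟨ cong (_+ c i * (open-at v x - 1ℚ)) (spent-test c (mask v x) i (lookup x i) (un x)) ⟩
        spent c (mask v x) + c i + c i * (open-at v x - 1ℚ)
          ≤⟨ +-monoʳ-≤ (spent c (mask v x) + c i) (*-monoˡ (0≤c i) (+-monoˡ-≤ (- 1ℚ) (closed v x det))) ⟩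
        spent c (mask v x) + c i + c i * (0ℚ - 1ℚ)
          ≡⟨ cancel (spent c (mask v x)) (c i) ⟩
        spent c (mask v x)
          ≡⟨ cong (spent c) (run-determined≡ (suc m) f π x (mask v x) det) ⟨
        spent c (run (suc m) f π x (mask v x)) ∎
        where
        cancel : ∀ s c → s + c + c * (0ℚ - 1ℚ) ≡ s
        cancel = solve-∀ ℚ-ring
      go (no ¬det) = begin
        spent c (run m f π x (mask v′ x)) + c i * (open-at v x - 1ℚ)
          ≤⟨ +-monoʳ-≤ (spent c (run m f π x (mask v′ x))) (*-monoˡ (0≤c i) (+-monoˡ-≤ (- 1ℚ) (open≤1 v x))) ⟩
        spent c (run m f π x (mask v′ x)) + c i * (1ℚ - 1ℚ)
          ≡⟨ cancel (spent c (run m f π x (mask v′ x))) (c i) ⟩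
        spent c (run m f π x (mask v′ x))
          ≡⟨ cong (λ s → spent c (run m f π x s)) (mask-test v x i) ⟩
        spent c (run m f π x (mask v x [ i ]≔ just (lookup x i)))
          ≡⟨ cong (λ j → spent c (run m f π x (mask v x [ j ]≔ just (lookup x j)))) (same x) ⟨
        spent c (run m f π x (mask v x [ choose π (mask v x) (h x) ]≔ just (lookup x (choose π (mask v x) (h x)))))
          ≡⟨ cong (spent c) (run-step m f π x (mask v x) ¬det (h x)) ⟨
        spent c (run (suc m) f π x (mask v x)) ∎
        where
        cancel : ∀ s c → s + c * (1ℚ - 1ℚ) ≡ s
        cancel = solve-∀ ℚ-ring

  nonAdaptive-bound : w * (½ * (C * (C + 1ℚ))) ≤ expected p c f π
  nonAdaptive-bound = begin
    w * (½ * (C * (C + 1ℚ))) ≡⟨ lemma C (w * (½ * (C * (C + 1ℚ)))) ⟩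
    C - C + w * (½ * (C * (C + 1ℚ))) ≡⟨ cong (λ l → C - l + w * (½ * (l * (l + 1ℚ)))) (left-all c) ⟨
    bound (replicate n true) ≤⟨ masked-bound n (replicate n true)
                                                 (trans (sym (mask-unknowns (replicate n true) (replicate n true)))
                                                   (trans (cong unknowns (mask-all (replicate n true))) (unknowns-initial n)))
                                                 (λ x → subst (Reachable π) (sym (mask-all x)) Reachable.start) ⟩
    masked-value n (replicate n true) ≡⟨ 𝔼-cong p initial (λ x _ → cong (spent c ∘ run n f π x) (mask-all x)) ⟩
    expected p c f π ∎
    where
    open ≤-Reasoning
    lemma : ∀ C t → t ≡ C - C + t
    lemma = solve-∀ ℚ-ring

-- Binomial weights near the centre

-- Defined by recursion so that `fromNat (suc n)` unfolds to a ring expression and inductions reduce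
-- to ring identities.
fromNat : ℕ → ℚ
fromNat zero    = 0ℚ
fromNat (suc n) = 1ℚ + fromNat n

fromNat-+ : ∀ m n → fromNat (m ℕ.+ n) ≡ fromNat m + fromNat n
fromNat-+ zero    n = sym (+-identityˡ (fromNat n))
fromNat-+ (suc m) n = trans (cong (1ℚ +_) (fromNat-+ m n)) (sym (+-assoc 1ℚ (fromNat m) (fromNat n)))

fromNat-* : ∀ m n → fromNat (m ℕ.* n) ≡ fromNat m * fromNat n
fromNat-* zero    n = sym (*-zeroˡ (fromNat n))
fromNat-* (suc m) n = trans (fromNat-+ n (m ℕ.* n)) (trans (cong (fromNat n +_) (fromNat-* m n)) (lemma (fromNat m) (fromNat n)))
  where
  lemma : ∀ m n → n + m * n ≡ (1ℚ + m) * n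
  lemma = solve-∀ ℚ-ring

0≤fromNat : ∀ n → 0ℚ ≤ fromNat n
0≤fromNat zero    = ≤-refl
0≤fromNat (suc n) = 0≤+ (nonNegative⁻¹ 1ℚ) (0≤fromNat n)

fromNat-mono : ∀ {m n} → m ℕ.≤ n → fromNat m ≤ fromNat n
fromNat-mono {n = n} ℕ.z≤n = 0≤fromNat n
fromNat-mono (ℕ.s≤s m≤n)   = +-monoʳ-≤ 1ℚ (fromNat-mono m≤n)

fromNat≡ : ∀ n → fromNat n ≡ mkℚ (ℤ.+ n) 0 (Coprime.sym (Coprime.1-coprimeTo n))
fromNat≡ zero    = refl
fromNat≡ (suc n) = trans (cong (1ℚ +_) (fromNat≡ n))
  (trans (cong (λ z → z / 1) (cong (λ t → ℤ.1ℤ ℤ.+ t) (ℤ.*-identityʳ (ℤ.+ n))))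
         (normalize-coprime (Coprime.sym (Coprime.1-coprimeTo (suc n)))))

archimedean : ∀ q → ∃[ n ] q ≤ fromNat n
archimedean q@(mkℚ (ℤ.+ a) d _) = a , subst (q ≤_) (sym (fromNat≡ a)) (*≤* (subst₂ ℤ._≤_
  (ℤ.pos-* a 1) (ℤ.pos-* a (suc d)) (ℤ.+≤+ (ℕ.*-monoʳ-≤ a (ℕ.s≤s ℕ.z≤n)))))
archimedean q@(mkℚ -[1+ a ] d _) = 0 , *≤* ℤ.-≤+

binomialMean : ℕ → (ℕ → ℚ) → ℚ
binomialMean zero    h = h 0
binomialMean (suc F) h = mix ½ (binomialMean F (h ∘ suc)) (binomialMean F h)

½-vector : ∀ F → Vec ℚ F
½-vector F = replicate F ½

𝔼-count : ∀ F h → 𝔼 (lookup (½-vector F)) initial (h ∘ count true) ≡ binomialMean F h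
𝔼-count zero    h = refl
𝔼-count (suc F) h = cong₂ (mix ½) (𝔼-count F (h ∘ suc)) (𝔼-count F h)

binomialMean-cong : ∀ F {h g} → (∀ t → h t ≡ g t) → binomialMean F h ≡ binomialMean F g
binomialMean-cong zero    h≗g = h≗g 0
binomialMean-cong (suc F) h≗g = cong₂ (mix ½) (binomialMean-cong F (h≗g ∘ suc)) (binomialMean-cong F h≗g)

binomialMean-const : ∀ F q → binomialMean F (λ _ → q) ≡ q
binomialMean-const zero    q = refl
binomialMean-const (suc F) q = trans (cong (λ t → mix ½ t t) (binomialMean-const F q)) (mix-const ½ q)

binomialMean-+ : ∀ F h g → binomialMean F (λ t → h t + g t) ≡ binomialMean F h + binomialMean F g
binomialMean-+ zero    h g = refl
binomialMean-+ (suc F) h g = trans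
  (cong₂ (mix ½) (binomialMean-+ F (h ∘ suc) (g ∘ suc)) (binomialMean-+ F h g))
  (mix-+ ½ (binomialMean F (h ∘ suc)) (binomialMean F (g ∘ suc)) (binomialMean F h) (binomialMean F g))

binomialMean-* : ∀ F q h → binomialMean F (λ t → q * h t) ≡ q * binomialMean F h
binomialMean-* zero    q h = refl
binomialMean-* (suc F) q h = trans
  (cong₂ (mix ½) (binomialMean-* F q (h ∘ suc)) (binomialMean-* F q h))
  (mix-* ½ q (binomialMean F (h ∘ suc)) (binomialMean F h))

δ : ℕ → ℕ → ℚ
δ zero    zero    = 1ℚ
δ zero    (suc _) = 0ℚ
δ (suc _) zero    = 0ℚ
δ (suc j) (suc t) = δ j t

δ-same : ∀ j → δ j j ≡ 1ℚ
δ-same zero    = refl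
δ-same (suc j) = δ-same j

δ-≢ : ∀ j t → j ≢ t → δ j t ≡ 0ℚ
δ-≢ zero    zero    ≢ = contradiction refl ≢
δ-≢ zero    (suc t) ≢ = refl
δ-≢ (suc j) zero    ≢ = refl
δ-≢ (suc j) (suc t) ≢ = δ-≢ j t (≢ ∘ cong suc)

0≤δ : ∀ j t → 0ℚ ≤ δ j t
0≤δ zero    zero    = nonNegative⁻¹ 1ℚ
0≤δ zero    (suc _) = ≤-refl
0≤δ (suc _) zero    = ≤-refl
0≤δ (suc j) (suc t) = 0≤δ j t

-- The probability of `j` heads in `F` fair tosses, that is, the binomial coefficient divided by `2`
-- to the power `F`.
binomial : ℕ → ℕ → ℚ
binomial F j = binomialMean F (δ j)

binomial-zero : ∀ F → binomial (suc F) 0 ≡ ½ * binomial F 0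
binomial-zero F = trans (cong (λ t → mix ½ t (binomial F 0)) (binomialMean-const F 0ℚ)) (lemma (binomial F 0))
  where
  lemma′ : ∀ h b → h * 0ℚ + (1ℚ - h) * b ≡ (1ℚ - h) * b
  lemma′ = solve-∀ ℚ-ring
  lemma : ∀ b → ½ * 0ℚ + (1ℚ - ½) * b ≡ ½ * b
  lemma b = lemma′ ½ b

binomial-suc : ∀ F j → binomial (suc F) (suc j) ≡ ½ * (binomial F j + binomial F (suc j))
binomial-suc F j = sym (*-distribˡ-+ ½ (binomial F j) (binomial F (suc j)))

0≤binomial : ∀ F j → 0ℚ ≤ binomial F j
0≤binomial F j = go F (δ j) (0≤δ j)
  where
  go : ∀ F h → (∀ t → 0ℚ ≤ h t) → 0ℚ ≤ binomialMean F h
  go zero    h 0≤h = 0≤h 0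
  go (suc F) h 0≤h = 0≤+ (0≤* (nonNegative⁻¹ ½) (go F (h ∘ suc) (0≤h ∘ suc))) (0≤* (nonNegative⁻¹ ½) (go F h 0≤h))

0<binomial : ∀ F j → j ℕ.≤ F → 0ℚ < binomial F j
0<binomial zero    zero    _  = positive⁻¹ 1ℚ
0<binomial (suc F) zero    _  = subst (0ℚ <_) (sym (binomial-zero F)) (pos*pos 0<½ (0<binomial F 0 ℕ.z≤n))
0<binomial (suc F) (suc j) (ℕ.s≤s j≤F) = subst (0ℚ <_) (sym (binomial-suc F j))
  (pos*pos 0<½ (+-mono-<-≤ (0<binomial F j j≤F) (0≤binomial F (suc j))))

-- The quotient of neighbouring binomial coefficients, derived from Pascal's rule alone. It needs no
-- bound on `j`, since both sides vanish from `j = F` on.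
binomial-ratio : ∀ F j → fromNat (suc j) * binomial F (suc j) ≡ (fromNat F - fromNat j) * binomial F j
binomial-ratio zero    zero    = refl
binomial-ratio zero    (suc j) = trans (*-zeroʳ (fromNat (suc (suc j)))) (sym (*-zeroʳ (0ℚ - fromNat (suc j))))
binomial-ratio (suc F) zero    = trans (cong ((1ℚ + 0ℚ) *_) (binomial-suc F 0))
  (trans (lemma ½ (binomial F 0) (binomial F 1))
  (trans (cong (λ t → ½ * (binomial F 0 + t)) (binomial-ratio F 0))
  (trans (lemma′ ½ (fromNat F) (binomial F 0)) (cong ((1ℚ + fromNat F - 0ℚ) *_) (sym (binomial-zero F))))))
  where
  lemma : ∀ h a b → (1ℚ + 0ℚ) * (h * (a + b)) ≡ h * (a + (1ℚ + 0ℚ) * b)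
  lemma = solve-∀ ℚ-ring
  lemma′ : ∀ h f a → h * (a + (f - 0ℚ) * a) ≡ (1ℚ + f - 0ℚ) * (h * a)
  lemma′ = solve-∀ ℚ-ring
binomial-ratio (suc F) (suc j) = begin
  (1ℚ + (1ℚ + I)) * binomial (suc F) (suc (suc j)) ≡⟨ cong ((1ℚ + (1ℚ + I)) *_) (binomial-suc F (suc j)) ⟩
  (1ℚ + (1ℚ + I)) * (½ * (b₁ + b₂)) ≡⟨ lemma ½ I b₁ b₂ ⟩
  ½ * ((1ℚ + (1ℚ + I)) * b₁ + (1ℚ + (1ℚ + I)) * b₂) ≡⟨ cong (λ t → ½ * ((1ℚ + (1ℚ + I)) * b₁ + t)) (binomial-ratio F (suc j)) ⟩
  ½ * ((1ℚ + (1ℚ + I)) * b₁ + (N - (1ℚ + I)) * b₁) ≡⟨ lemma′ ½ I N b₁ ⟩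
  ½ * ((1ℚ + I) * b₁ + (N - I) * b₁) ≡⟨ cong (λ t → ½ * (t + (N - I) * b₁)) (binomial-ratio F j) ⟩
  ½ * ((N - I) * b₀ + (N - I) * b₁) ≡⟨ lemma″ ½ I N b₀ b₁ ⟩
  (1ℚ + N - (1ℚ + I)) * (½ * (b₀ + b₁)) ≡⟨ cong ((1ℚ + N - (1ℚ + I)) *_) (binomial-suc F j) ⟨
  (1ℚ + N - (1ℚ + I)) * binomial (suc F) (suc j) ∎
  where
  open ≡-Reasoning
  I = fromNat j
  N = fromNat F
  b₀ = binomial F j
  b₁ = binomial F (suc j)
  b₂ = binomial F (suc (suc j))
  lemma : ∀ h I a b → (1ℚ + (1ℚ + I)) * (h * (a + b)) ≡ h * ((1ℚ + (1ℚ + I)) * a + (1ℚ + (1ℚ + I)) * b)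
  lemma = solve-∀ ℚ-ring
  lemma′ : ∀ h I N a → h * ((1ℚ + (1ℚ + I)) * a + (N - (1ℚ + I)) * a) ≡ h * ((1ℚ + I) * a + (N - I) * a)
  lemma′ = solve-∀ ℚ-ring
  lemma″ : ∀ h I N a b → h * ((N - I) * a + (N - I) * b) ≡ (1ℚ + N - (1ℚ + I)) * (h * (a + b))
  lemma″ = solve-∀ ℚ-ring

module Central (M : ℕ) where

  private
    N = fromNat M

  central : ℕ → ℚ
  central d = binomial (M ℕ.+ M) (M ℕ.+ d)

  central-ratio : ∀ d → (1ℚ + (N + fromNat d)) * central (suc d) ≡ (N - fromNat d) * central d
  central-ratio d = trans
    (cong₂ (λ t j → t * binomial (M ℕ.+ M) j) (cong (1ℚ +_) (sym (fromNat-+ M d))) (ℕ.+-suc M d))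
    (trans (binomial-ratio (M ℕ.+ M) (M ℕ.+ d))
           (cong (_* central d) (trans (cong₂ _-_ (fromNat-+ M M) (fromNat-+ M d)) (lemma N (fromNat d)))))
    where
    lemma : ∀ N d → (N + N) - (N + d) ≡ N - d
    lemma = solve-∀ ℚ-ring

  private
    0<step : ∀ d → 0ℚ < 1ℚ + (N + fromNat d)
    0<step d = +-mono-<-≤ (positive⁻¹ 1ℚ) (0≤+ (0≤fromNat M) (0≤fromNat d))

  central-decreasing : ∀ d → central (suc d) ≤ central d
  central-decreasing d = *-cancelˡ-≤-pos (1ℚ + (N + D)) {{positive (0<step d)}}
    (subst (_≤ (1ℚ + (N + D)) * central d) (sym (central-ratio d))
      (≤-by ((1ℚ + D + D) * central d)
        (0≤* (0≤+ (0≤fromNat (suc d)) (0≤fromNat d)) (0≤binomial (M ℕ.+ M) (M ℕ.+ d))) (lemma N D (central d))))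
    where
    D = fromNat d
    lemma : ∀ N d b → (N - d) * b + (1ℚ + d + d) * b ≡ (1ℚ + (N + d)) * b
    lemma = solve-∀ ℚ-ring

  central≤ : ∀ d → central d ≤ central 0
  central≤ zero    = ≤-refl
  central≤ (suc d) = ≤-trans (central-decreasing d) (central≤ d)

  -- By `central-ratio`, the step from `e` to `e + 1` loses the fraction `(2e + 1) / (N + e + 1)`,
  -- at most `(2e + 1) / N`, and the first `d` odd numbers sum to `d * d`.
  central≥ : ∀ d → d ℕ.≤ M → (N - fromNat d * fromNat d) * central 0 ≤ N * central d
  central≥ zero    _   = ≤-reflexive (lemma N (central 0))
    where
    lemma : ∀ N b → (N - 0ℚ * 0ℚ) * b ≡ N * b
    lemma = solve-∀ ℚ-ring
  central≥ (suc d) d<M = *-cancelˡ-≤-pos (1ℚ + (N + D)) {{positive (0<step d)}} (begin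
    (1ℚ + (N + D)) * ((N - (1ℚ + D) * (1ℚ + D)) * B)
      -- The discarded factor of `B` is `(1 + D)³ + D³`, written out.
      ≤⟨ ≤-by ((1ℚ + (D + D + D) + (D * D + D * D + D * D) + (D * D * D + D * D * D)) * B)
           (0≤* (0≤+ (0≤+ (0≤+ (nonNegative⁻¹ 1ℚ) (0≤+ (0≤+ 0≤D 0≤D) 0≤D)) (0≤+ (0≤+ 0≤DD 0≤DD) 0≤DD)) (0≤+ 0≤DDD 0≤DDD))
                (0≤binomial (M ℕ.+ M) (M ℕ.+ 0)))
           (lemma N D B) ⟩
    (N - D) * ((N - D * D) * B)
      ≤⟨ *-monoˡ (0≤-diff (fromNat-mono (ℕ.<⇒≤ d<M))) (central≥ d (ℕ.<⇒≤ d<M)) ⟩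
    (N - D) * (N * central d)
      ≡⟨ swap (N - D) N (central d) ⟩
    N * ((N - D) * central d)
      ≡⟨ cong (N *_) (sym (central-ratio d)) ⟩
    N * ((1ℚ + (N + D)) * central (suc d))
      ≡⟨ swap N (1ℚ + (N + D)) (central (suc d)) ⟩
    (1ℚ + (N + D)) * (N * central (suc d)) ∎)
    where
    open ≤-Reasoning
    D = fromNat d
    B = central 0
    0≤D = 0≤fromNat d
    0≤DD = 0≤* 0≤D 0≤D
    0≤DDD = 0≤* 0≤DD 0≤D
    swap : ∀ a b c → a * (b * c) ≡ b * (a * c)
    swap = solve-∀ ℚ-ring
    lemma : ∀ N D B → (1ℚ + (N + D)) * ((N - (1ℚ + D) * (1ℚ + D)) * B)
      + (1ℚ + (D + D + D) + (D * D + D * D + D * D) + (D * D * D + D * D * D)) * B ≡ (N - D) * ((N - D * D) * B)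
    lemma = solve-∀ ℚ-ring

-- Instances with large gap

-- The indicator of `lo ≤ t < lo + u`, written as a sum of point masses so that its mean is a sum of
-- binomial weights.
interval : ℕ → ℕ → ℕ → ℚ
interval lo zero    t = 0ℚ
interval lo (suc u) t = δ lo t + interval (suc lo) u t

interval-outside : ∀ lo u t → (∀ j → j ℕ.< u → t ≢ lo ℕ.+ j) → interval lo u t ≡ 0ℚ
interval-outside lo zero    t out = refl
interval-outside lo (suc u) t out = cong₂ _+_
  (δ-≢ lo t λ lo≡t → out 0 ℕ.z<s (trans (sym lo≡t) (sym (ℕ.+-identityʳ lo))))
  (interval-outside (suc lo) u t λ j j<u eq → out (suc j) (ℕ.s≤s j<u) (trans eq (sym (ℕ.+-suc lo j))))

0≤interval : ∀ lo u t → 0ℚ ≤ interval lo u t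
0≤interval lo zero    t = ≤-refl
0≤interval lo (suc u) t = 0≤+ (0≤δ lo t) (0≤interval (suc lo) u t)

interval≤1 : ∀ lo u t → interval lo u t ≤ 1ℚ
interval≤1 lo zero    t = nonNegative⁻¹ 1ℚ
interval≤1 lo (suc u) t with lo ℕ.≟ t
... | yes refl = ≤-reflexive (cong₂ _+_ (δ-same lo)
  (interval-outside (suc lo) u lo λ j _ eq → ℕ.<-irrefl eq (ℕ.s≤s (ℕ.m≤m+n lo j))))
... | no ≢     = ≤-trans (≤-reflexive (trans (cong (_+ interval (suc lo) u t) (δ-≢ lo t ≢)) (+-identityˡ _)))
                         (interval≤1 (suc lo) u t)

interval-mean : ∀ F lo u w → (∀ j → j ℕ.< u → w ≤ binomial F (lo ℕ.+ j)) →
                w * fromNat u ≤ binomialMean F (interval lo u)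
interval-mean F lo zero    w w≤ = ≤-reflexive (trans (*-zeroʳ w) (sym (binomialMean-const F 0ℚ)))
interval-mean F lo (suc u) w w≤ = begin
  w * (1ℚ + fromNat u) ≡⟨ lemma w (fromNat u) ⟩
  w + w * fromNat u ≤⟨ +-mono-≤
    (subst (λ l → w ≤ binomial F l) (ℕ.+-identityʳ lo) (w≤ 0 ℕ.z<s))
    (interval-mean F (suc lo) u w λ j j<u → subst (λ l → w ≤ binomial F l) (ℕ.+-suc lo j) (w≤ (suc j) (ℕ.s≤s j<u))) ⟩
  binomial F lo + binomialMean F (interval (suc lo) u) ≡⟨ binomialMean-+ F (δ lo) (interval (suc lo) u) ⟨
  binomialMean F (interval lo (suc u)) ∎
  where
  open ≤-Reasoning
  lemma : ∀ w u → w * (1ℚ + u) ≡ w + w * u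
  lemma = solve-∀ ℚ-ring

agree : Bool → Bool → Bool
agree true  b = b
agree false b = not b

on-prefix : ∀ {m} R → Bool → (Vec Bool m → ℚ) → Vec Bool (R ℕ.+ m) → ℚ
on-prefix zero    b g x        = g x
on-prefix (suc R) b g (b′ ∷ x) = if agree b b′ then on-prefix R b g x else 0ℚ

on-prefix-0≤ : ∀ {m} R b {g : Vec Bool m → ℚ} → (∀ y → 0ℚ ≤ g y) → ∀ x → 0ℚ ≤ on-prefix R b g x
on-prefix-0≤ zero    b 0≤g x = 0≤g x
on-prefix-0≤ (suc R) b 0≤g (b′ ∷ x) with agree b b′
... | true  = on-prefix-0≤ R b 0≤g x
... | false = ≤-refl

on-prefix-≤1 : ∀ {m} R b {g : Vec Bool m → ℚ} → (∀ y → g y ≤ 1ℚ) → ∀ x → on-prefix R b g x ≤ 1ℚ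
on-prefix-≤1 zero    b g≤1 x = g≤1 x
on-prefix-≤1 (suc R) b g≤1 (b′ ∷ x) with agree b b′
... | true  = on-prefix-≤1 R b g≤1 x
... | false = nonNegative⁻¹ 1ℚ

on-prefix-elim : ∀ {m} R b {g : Vec Bool m → ℚ} (P : Vec Bool (R ℕ.+ m) → Set) →
  (∀ y → P (replicate R b ++ y) → g y ≤ 0ℚ) → ∀ x → P x → on-prefix R b g x ≤ 0ℚ
on-prefix-elim zero    b     P h x Px = h x Px
on-prefix-elim (suc R) true  P h (true ∷ x)  Px = on-prefix-elim R true (P ∘ (true ∷_)) h x Px
on-prefix-elim (suc R) true  P h (false ∷ x) Px = ≤-refl
on-prefix-elim (suc R) false P h (true ∷ x)  Px = ≤-refl
on-prefix-elim (suc R) false P h (false ∷ x) Px = on-prefix-elim R false (P ∘ (false ∷_)) h x Px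

likely : Bool → ℚ → ℚ
likely true  ε = 1ℚ - ε
likely false ε = ε

-- By Bernoulli's inequality, R independent variables all take their likely
-- value with probability at least 1 - R ε.
on-prefix-weight : ∀ {m} R b ε (rest : Vec ℚ m) (g : Vec Bool m → ℚ) → 0ℚ ≤ ε → ε ≤ 1ℚ →
  0ℚ ≤ 𝔼 (lookup rest) initial g →
  (1ℚ - fromNat R * ε) * 𝔼 (lookup rest) initial g ≤
  𝔼 (lookup (replicate R (likely b ε) ++ rest)) initial (on-prefix R b g)
on-prefix-weight zero b ε rest g 0≤ε ε≤1 0≤E = ≤-reflexive (lemma ε (𝔼 (lookup rest) initial g))
  where
  lemma : ∀ ε E → (1ℚ - 0ℚ * ε) * E ≡ E
  lemma = solve-∀ ℚ-ring
on-prefix-weight {m} (suc R) b ε rest g 0≤ε ε≤1 0≤E = begin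
  (1ℚ - (1ℚ + fromNat R) * ε) * E ≤⟨ ≤-by (fromNat R * (ε * ε) * E)
                                                        (0≤* (0≤* (0≤fromNat R) (0≤* 0≤ε 0≤ε)) 0≤E) (lemma (fromNat R) ε E) ⟩
  (1ℚ - ε) * ((1ℚ - fromNat R * ε) * E) ≤⟨ *-monoˡ (0≤-diff ε≤1) (on-prefix-weight R b ε rest g 0≤ε ε≤1 0≤E) ⟩
  (1ℚ - ε) * 𝔼 pv initial (on-prefix R b g) ≡⟨ head b ⟩
  𝔼 (lookup (replicate (suc R) (likely b ε) ++ rest)) initial (on-prefix (suc R) b g) ∎
  where
  open ≤-Reasoning
  E = 𝔼 (lookup rest) initial g
  pv = lookup (replicate R (likely b ε) ++ rest)
  lemma : ∀ R ε E → (1ℚ - (1ℚ + R) * ε) * E + R * (ε * ε) * E ≡ (1ℚ - ε) * ((1ℚ - R * ε) * E)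
  lemma = solve-∀ ℚ-ring
  first : ∀ ε a → (1ℚ - ε) * a ≡ (1ℚ - ε) * a + (1ℚ - (1ℚ - ε)) * 0ℚ
  first = solve-∀ ℚ-ring
  second : ∀ ε a → (1ℚ - ε) * a ≡ ε * 0ℚ + (1ℚ - ε) * a
  second = solve-∀ ℚ-ring
  head : ∀ b → (1ℚ - ε) * 𝔼 (lookup (replicate R (likely b ε) ++ rest)) initial (on-prefix R b g) ≡
         𝔼 (lookup (replicate (suc R) (likely b ε) ++ rest)) initial (on-prefix (suc R) b g)
  head true  = trans (first ε a) (cong (λ t → (1ℚ - ε) * a + (1ℚ - (1ℚ - ε)) * t) (sym (𝔼-const q initial 0ℚ)))
    where
    q = lookup (replicate R (1ℚ - ε) ++ rest)
    a = 𝔼 q initial (on-prefix R true g)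
  head false = trans (second ε a) (cong (λ t → ε * t + (1ℚ - ε) * a) (sym (𝔼-const q initial 0ℚ)))
    where
    q = lookup (replicate R ε ++ rest)
    a = 𝔼 q initial (on-prefix R false g)

front : ∀ {A : Set} {m} R → Vec A (R ℕ.+ m) → Vec A R
front zero    v       = []
front (suc R) (u ∷ v) = u ∷ front R v

back : ∀ {A : Set} {m} R → Vec A (R ℕ.+ m) → Vec A m
back zero    v       = v
back (suc R) (u ∷ v) = back R v

known-mask-++ : ∀ {m} R b (v : Vec Bool (R ℕ.+ m)) (xa : Vec Bool R) (x : Vec Bool m) →
  known b (mask v (xa ++ x)) ≡ known b (mask (front R v) xa) ℕ.+ known b (mask (back R v) x)
known-mask-++ zero    b v       []        x = refl
known-mask-++ (suc R) b (u ∷ v) (a ∷ xa) x = trans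
  (cong (h ℕ.+_) (known-mask-++ R b v xa x)) (sym (ℕ.+-assoc h _ _))
  where h = hits b (if u then nothing else just a)
          where open import Data.Maybe.Base using (nothing; just)

tested : ∀ {n} → Vec Bool n → ℕ
tested = Vec.countᵇ not

tested+marks : ∀ {n} (v : Vec Bool n) → tested v ℕ.+ marks v ≡ n
tested+marks []          = refl
tested+marks (true ∷ v)  = trans (ℕ.+-suc (tested v) (marks v)) (cong suc (tested+marks v))
tested+marks (false ∷ v) = cong suc (tested+marks v)

known-mask-same : ∀ {R} b (v : Vec Bool R) → known b (mask v (replicate R b)) ≡ tested v
known-mask-same b     []          = refl
known-mask-same true  (true ∷ v)  = known-mask-same true v
known-mask-same false (true ∷ v)  = known-mask-same false v
known-mask-same true  (false ∷ v) = cong suc (known-mask-same true v)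
known-mask-same false (false ∷ v) = cong suc (known-mask-same false v)

known-mask-not : ∀ {R} b (v : Vec Bool R) → known b (mask v (replicate R (not b))) ≡ 0
known-mask-not b     []          = refl
known-mask-not true  (true ∷ v)  = known-mask-not true v
known-mask-not false (true ∷ v)  = known-mask-not false v
known-mask-not true  (false ∷ v) = known-mask-not true v
known-mask-not false (false ∷ v) = known-mask-not false v

known-mask≤ : ∀ {n} b (v x : Vec Bool n) → known b (mask v x) ℕ.≤ count b x
known-mask≤ b     []          []      = ℕ.z≤n
known-mask≤ true  (true ∷ v)  (a ∷ x) = ℕ.m≤n⇒m≤o+n _ (known-mask≤ true v x)
known-mask≤ false (true ∷ v)  (a ∷ x) = ℕ.m≤n⇒m≤o+n _ (known-mask≤ false v x)
known-mask≤ b     (false ∷ v) (a ∷ x) = ℕ.+-monoʳ-≤ _ (known-mask≤ b v x)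

left-replicate : ∀ {F} q (v : Vec Bool F) → left (lookup (replicate F q)) v ≡ q * fromNat (marks v)
left-replicate q []          = sym (*-zeroʳ q)
left-replicate q (true ∷ v)  = trans (cong (q +_) (left-replicate q v)) (lemma q (fromNat (marks v)))
  where
  lemma : ∀ q t → q + q * t ≡ q * (1ℚ + t)
  lemma = solve-∀ ℚ-ring
left-replicate q (false ∷ v) = trans (+-identityˡ _) (left-replicate q v)

left-++ : ∀ {m} R q (rest : Vec ℚ m) (v : Vec Bool (R ℕ.+ m)) →
  left (lookup (replicate R q ++ rest)) v ≡ q * fromNat (marks (front R v)) + left (lookup rest) (back R v)
left-++ zero    q rest v           = sym (trans (cong (_+ left (lookup rest) v) (*-zeroʳ q)) (+-identityˡ _))
left-++ (suc R) q rest (true ∷ v)  = trans (cong (q +_) (left-++ R q rest v))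
  (lemma q (fromNat (marks (front R v))) (left (lookup rest) (back R v)))
  where
  lemma : ∀ q t l → q + (q * t + l) ≡ q * (1ℚ + t) + l
  lemma = solve-∀ ℚ-ring
left-++ (suc R) q rest (false ∷ v) = trans (+-identityˡ _) (left-++ R q rest v)

lookup-++-elim : ∀ {A : Set} {m n} (P : A → Set) (xs : Vec A m) (ys : Vec A n) →
  (∀ i → P (lookup xs i)) → (∀ i → P (lookup ys i)) → ∀ i → P (lookup (xs ++ ys) i)
lookup-++-elim P []       ys Pxs Pys i       = Pys i
lookup-++-elim P (x ∷ xs) ys Pxs Pys zero    = Pxs zero
lookup-++-elim P (x ∷ xs) ys Pxs Pys (suc i) = lookup-++-elim P xs ys (Pxs ∘ suc) Pys i

lookup-replicate-elim : ∀ {A : Set} (P : A → Set) n {a} → P a → ∀ i → P (lookup (replicate n a) i)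
lookup-replicate-elim P n {a} Pa i = subst P (sym (lookup-replicate i a)) Pa

-- R variables that are likely 1 and R variables that are likely 0, all of
-- cost 1, follow M + M fair coins of cost 0.  The coins leave a target that
-- is nearly uniform among the 2 R undetermined ones.
module Gap (R M : ℕ) (ε : ℚ) (0<ε : 0ℚ < ε) (ε<1 : ε < 1ℚ) where

  -- If `M + d` coins show 1 and `d < 2R`, then `2R - d` more ones or `d + 1` more zeros decide `f`.
  -- The smaller of these numbers lies between 1 and `R`, and each value arises from two choices of
  -- `d`.
  F n k k̄ : ℕ
  F = M ℕ.+ M
  n = R ℕ.+ (R ℕ.+ F)
  k = M ℕ.+ (R ℕ.+ R)
  k̄ = suc M

  k+k̄ : k ℕ.+ k̄ ≡ suc n
  k+k̄ = lemma M R
    where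
    lemma : ∀ M R → M ℕ.+ (R ℕ.+ R) ℕ.+ suc M ≡ suc (R ℕ.+ (R ℕ.+ (M ℕ.+ M)))
    lemma = ℕ-Solver.solve-∀

  pᵛ cᵛ : Vec ℚ n
  pᵛ = replicate R (1ℚ - ε) ++ (replicate R ε ++ replicate F ½)
  cᵛ = replicate R 1ℚ ++ (replicate R 1ℚ ++ replicate F 0ℚ)

  p c : Fin n → ℚ
  p = lookup pᵛ
  c = lookup cᵛ

  f : BoolFun n
  f = kOfN k

  p-elim : (P : ℚ → Set) → P (1ℚ - ε) → P ε → P ½ → ∀ i → P (p i)
  p-elim P P₁ P₂ P₃ = lookup-++-elim P (replicate R (1ℚ - ε)) _ (lookup-replicate-elim P R P₁)
    (lookup-++-elim P (replicate R ε) _ (lookup-replicate-elim P R P₂) (lookup-replicate-elim P F P₃))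

  c-elim : (P : ℚ → Set) → P 1ℚ → P 0ℚ → ∀ i → P (c i)
  c-elim P P₁ P₀ = lookup-++-elim P (replicate R 1ℚ) _ (lookup-replicate-elim P R P₁)
    (lookup-++-elim P (replicate R 1ℚ) _ (lookup-replicate-elim P R P₁) (lookup-replicate-elim P F P₀))

  0<p : ∀ i → 0ℚ < p i
  0<p = p-elim (0ℚ <_) (subst (_< 1ℚ - ε) (+-inverseʳ ε) (+-monoˡ-< (- ε) ε<1)) 0<ε 0<½

  p<1 : ∀ i → p i < 1ℚ
  p<1 = p-elim (_< 1ℚ) (subst (1ℚ - ε <_) (lemma ε) (subst (_< 1ℚ - ε + ε) (+-identityʳ (1ℚ - ε)) (+-monoʳ-< (1ℚ - ε) 0<ε)))
    ε<1 (subst (_< ½ + ½) (+-identityʳ ½) (+-monoʳ-< ½ 0<½))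
    where
    lemma : ∀ ε → 1ℚ - ε + ε ≡ 1ℚ
    lemma = solve-∀ ℚ-ring

  0≤p : ∀ i → 0ℚ ≤ p i
  0≤p i = <⇒≤ (0<p i)

  p≤1 : ∀ i → p i ≤ 1ℚ
  p≤1 i = <⇒≤ (p<1 i)

  0≤c : ∀ i → 0ℚ ≤ c i
  0≤c = c-elim (0ℚ ≤_) (nonNegative⁻¹ 1ℚ) ≤-refl

  c-idem : ∀ i → c i * c i ≡ c i
  c-idem = c-elim (λ q → q * q ≡ q) refl refl

  open KOfN {n} {k} {k̄} k+k̄

  likely-one likely-zero : Vec Bool n → Vec Bool R
  likely-one  v = front R v
  likely-zero v = front R (back R v)

  costly : Vec Bool n → ℕ
  costly v = marks (likely-one v) ℕ.+ marks (likely-zero v)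

  left-c : ∀ v → left c v ≡ fromNat (costly v)
  left-c v = trans (left-++ R 1ℚ _ v) (trans
    (cong (1ℚ * fromNat (marks (likely-one v)) +_) (trans (left-++ R 1ℚ _ (back R v))
      (cong (1ℚ * fromNat (marks (likely-zero v)) +_) (left-replicate 0ℚ (back R (back R v))))))
    (trans (lemma (fromNat (marks (likely-one v))) (fromNat (marks (likely-zero v))) (fromNat (marks (back R (back R v)))))
           (sym (fromNat-+ (marks (likely-one v)) (marks (likely-zero v))))))
    where
    lemma : ∀ a b t → 1ℚ * a + (1ℚ * b + 0ℚ * t) ≡ a + b
    lemma = solve-∀ ℚ-ring

  total-cost : ∑ℚ c ≡ fromNat (R ℕ.+ R)
  total-cost = trans (sym (left-all c)) (trans (left-c (replicate n true))
    (cong fromNat (cong₂ ℕ._+_ (front-marks R) (back-marks R))))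
    where
    front-marks : ∀ R {m} → marks (front R (replicate (R ℕ.+ m) true)) ≡ R
    front-marks zero    = refl
    front-marks (suc R) = cong suc (front-marks R)
    back-replicate : ∀ R {m} → back R (replicate (R ℕ.+ m) true) ≡ replicate m true
    back-replicate zero    = refl
    back-replicate (suc R) = back-replicate R
    back-marks : ∀ R {m} → marks (front R (back R (replicate (R ℕ.+ (R ℕ.+ m)) true))) ≡ R
    back-marks R = trans (cong (marks ∘ front R) (back-replicate R)) (front-marks R)

  -- Suppose the costly variables take their likely values and all coins are known, `t` of them
  -- being 1. Then `f` is undetermined exactly for `M + β ≤ t < M + 2R - α`, where `α` likely ones
  -- and `β` likely zeros have been tested. A costly test shortens this window by one, whichever
  -- pool it uses; untested coins only leave `f` less determined.
  window : Vec Bool n → Vec Bool F → ℚ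
  window v y = interval (M ℕ.+ tested (likely-zero v)) (costly v) (count true y)

  open-at : Vec Bool n → Vec Bool n → ℚ
  open-at v = on-prefix R true (on-prefix R false (window v))

  closed : ∀ v x → Determined f (mask v x) → open-at v x ≤ 0ℚ
  closed v = on-prefix-elim R true (λ x → Determined f (mask v x)) λ x → on-prefix-elim R false
    (λ x → Determined f (mask v (replicate R true ++ x))) (λ y det → ≤-reflexive
      (interval-outside (M ℕ.+ tested (likely-zero v)) (costly v) (count true y) (outside y det))) x
    where
    outside : ∀ y → Determined f (mask v (replicate R true ++ (replicate R false ++ y))) → ∀ j →
              j ℕ.< costly v → count true y ≢ M ℕ.+ tested (likely-zero v) ℕ.+ j
    outside y det j j<u eq with determined⁻¹ (mask v (replicate R true ++ (replicate R false ++ y))) det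
    ... | true , k≤ = contradiction (ℕ.+-cancelˡ-≤ (M ℕ.+ α ℕ.+ β) _ _ (begin
      M ℕ.+ α ℕ.+ β ℕ.+ costly v ≡⟨ regroup M α β (marks (likely-one v)) (marks (likely-zero v)) ⟩
      M ℕ.+ ((α ℕ.+ marks (likely-one v)) ℕ.+ (β ℕ.+ marks (likely-zero v)))
        ≡⟨ cong₂ (λ a b → M ℕ.+ (a ℕ.+ b)) (tested+marks (likely-one v)) (tested+marks (likely-zero v)) ⟩
      k ≤⟨ k≤ ⟩
      known true (mask v (replicate R true ++ (replicate R false ++ y)))
        ≡⟨ trans (known-mask-++ R true v (replicate R true) _) (cong₂ ℕ._+_ (known-mask-same true (likely-one v))
             (trans (known-mask-++ R true (back R v) (replicate R false) y)
               (cong (ℕ._+ known true (mask (back R (back R v)) y)) (known-mask-not true (likely-zero v))))) ⟩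
      α ℕ.+ known true (mask (back R (back R v)) y) ≤⟨ ℕ.+-monoʳ-≤ α (known-mask≤ true (back R (back R v)) y) ⟩
      α ℕ.+ count true y ≡⟨ cong (α ℕ.+_) eq ⟩
      α ℕ.+ (M ℕ.+ β ℕ.+ j) ≡⟨ regroup′ M α β j ⟩
      M ℕ.+ α ℕ.+ β ℕ.+ j ∎)) (ℕ.<⇒≱ j<u)
      where
      open ℕ.≤-Reasoning
      α = tested (likely-one v)
      β = tested (likely-zero v)
      regroup : ∀ M α β a b → M ℕ.+ α ℕ.+ β ℕ.+ (a ℕ.+ b) ≡ M ℕ.+ ((α ℕ.+ a) ℕ.+ (β ℕ.+ b))
      regroup = ℕ-Solver.solve-∀
      regroup′ : ∀ M α β j → α ℕ.+ (M ℕ.+ β ℕ.+ j) ≡ M ℕ.+ α ℕ.+ β ℕ.+ j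
      regroup′ = ℕ-Solver.solve-∀
    ... | false , k̄≤ = contradiction (begin
      suc (M ℕ.+ M ℕ.+ β ℕ.+ j) ≡⟨ regroup M β j ⟩
      (M ℕ.+ β ℕ.+ j) ℕ.+ suc M ≡⟨ cong (ℕ._+ suc M) eq ⟨
      count true y ℕ.+ suc M ≤⟨ ℕ.+-monoʳ-≤ (count true y) k̄≤ ⟩
      count true y ℕ.+ known false (mask v (replicate R true ++ (replicate R false ++ y)))
        ≡⟨ cong (count true y ℕ.+_) (trans (known-mask-++ R false v (replicate R true) _)
             (cong₂ ℕ._+_ (known-mask-not false (likely-one v))
             (trans (known-mask-++ R false (back R v) (replicate R false) y)
               (cong (ℕ._+ known false (mask (back R (back R v)) y)) (known-mask-same false (likely-zero v)))))) ⟩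
      count true y ℕ.+ (β ℕ.+ known false (mask (back R (back R v)) y))
        ≤⟨ ℕ.+-monoʳ-≤ (count true y) (ℕ.+-monoʳ-≤ β (known-mask≤ false (back R (back R v)) y)) ⟩
      count true y ℕ.+ (β ℕ.+ count false y) ≡⟨ regroup′ (count true y) β (count false y) ⟩
      (count true y ℕ.+ count false y) ℕ.+ β ≡⟨ cong (ℕ._+ β) (count-total y) ⟩
      M ℕ.+ M ℕ.+ β ≤⟨ ℕ.m≤m+n (M ℕ.+ M ℕ.+ β) j ⟩
      M ℕ.+ M ℕ.+ β ℕ.+ j ∎) (ℕ.<-irrefl refl)
      where
      open ℕ.≤-Reasoning
      β = tested (likely-zero v)
      regroup : ∀ M β j → suc (M ℕ.+ M ℕ.+ β ℕ.+ j) ≡ (M ℕ.+ β ℕ.+ j) ℕ.+ suc M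
      regroup = ℕ-Solver.solve-∀
      regroup′ : ∀ t β z → t ℕ.+ (β ℕ.+ z) ≡ (t ℕ.+ z) ℕ.+ β
      regroup′ = ℕ-Solver.solve-∀

  ν : ℚ
  ν = 1ℚ - fromNat R * ε

  module _ (w : ℚ) (0≤ν : 0ℚ ≤ ν) (w≤ : ∀ d → d ℕ.< R ℕ.+ R → w ≤ Central.central M d) where

    -- The window has `costly v` points, all less than `2R` above the centre, so each weighs at
    -- least `w`. Each of the two pools contributes one factor `ν` for taking its likely values.
    open-weight : ∀ v → ν * (ν * w) * left c v ≤ 𝔼 p initial (open-at v)
    open-weight v = begin
      ν * (ν * w) * left c v ≡⟨ cong (ν * (ν * w) *_) (left-c v) ⟩
      ν * (ν * w) * fromNat (costly v) ≡⟨ regroup ν w (fromNat (costly v)) ⟩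
      ν * (ν * (w * fromNat (costly v)))
        ≤⟨ *-monoˡ 0≤ν (*-monoˡ 0≤ν (≤-trans (interval-mean F _ (costly v) w heavy)
             (≤-reflexive (sym (𝔼-count F (interval (M ℕ.+ tested (likely-zero v)) (costly v))))))) ⟩
      ν * (ν * 𝔼 (lookup (½-vector F)) initial (window v))
        ≤⟨ *-monoˡ 0≤ν (on-prefix-weight R false ε (½-vector F) (window v) (<⇒≤ 0<ε) (<⇒≤ ε<1) 0≤inner) ⟩
      ν * 𝔼 (lookup (replicate R ε ++ ½-vector F)) initial (on-prefix R false (window v))
        ≤⟨ on-prefix-weight R true ε (replicate R ε ++ ½-vector F) _ (<⇒≤ 0<ε) (<⇒≤ ε<1)
             (≤-trans (0≤* 0≤ν 0≤inner) (on-prefix-weight R false ε (½-vector F) (window v) (<⇒≤ 0<ε) (<⇒≤ ε<1) 0≤inner)) ⟩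
      𝔼 p initial (open-at v) ∎
      where
      open ≤-Reasoning
      regroup : ∀ ν w t → ν * (ν * w) * t ≡ ν * (ν * (w * t))
      regroup = solve-∀ ℚ-ring
      0≤inner : 0ℚ ≤ 𝔼 (lookup (½-vector F)) initial (window v)
      0≤inner = subst (_≤ 𝔼 (lookup (½-vector F)) initial (window v)) (𝔼-const (lookup (½-vector F)) initial 0ℚ)
        (𝔼-mono (lookup (½-vector F)) (lookup-replicate-elim (0ℚ ≤_) F (nonNegative⁻¹ ½))
          (lookup-replicate-elim (_≤ 1ℚ) F ½≤1) initial λ y _ → 0≤interval _ (costly v) (count true y))
      heavy : ∀ j → j ℕ.< costly v → w ≤ binomial F (M ℕ.+ tested (likely-zero v) ℕ.+ j)
      heavy j j<u = subst (λ l → w ≤ binomial F l) (sym (ℕ.+-assoc M (tested (likely-zero v)) j))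
        (w≤ (tested (likely-zero v) ℕ.+ j) within)
        where
        within : tested (likely-zero v) ℕ.+ j ℕ.< R ℕ.+ R
        within = ℕ.<-≤-trans (ℕ.+-monoʳ-< (tested (likely-zero v)) j<u) (subst (ℕ._≤ R ℕ.+ R)
          (regroup′ (marks (likely-one v)) (tested (likely-zero v)) (marks (likely-zero v)))
          (ℕ.+-mono-≤ (subst (marks (likely-one v) ℕ.≤_) (tested+marks (likely-one v)) (ℕ.m≤n+m _ _))
                      (ℕ.≤-reflexive (tested+marks (likely-zero v)))))
          where
          regroup′ : ∀ a β b → a ℕ.+ (β ℕ.+ b) ≡ β ℕ.+ (a ℕ.+ b)
          regroup′ = ℕ-Solver.solve-∀

    gap-nonAdaptive : ∀ π → NonAdaptive π →
      ν * (ν * w) * (½ * (fromNat (R ℕ.+ R) * (fromNat (R ℕ.+ R) + 1ℚ))) ≤ expected p c f π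
    gap-nonAdaptive π na = subst (λ C → ν * (ν * w) * (½ * (C * (C + 1ℚ))) ≤ expected p c f π) total-cost
      (NonAdaptiveBound.nonAdaptive-bound p c f 0≤p p≤1 0≤c c-idem (ν * (ν * w)) open-at
        (λ v → on-prefix-≤1 R true (on-prefix-≤1 R false λ y → interval≤1 _ (costly v) (count true y)))
        closed open-weight π na)

-- Adaptive cost of the gap instances

𝔼-congᵖ : ∀ {n} {p q : Fin n → ℚ} → (∀ i → p i ≡ q i) → ∀ s g → 𝔼 p s g ≡ 𝔼 q s g
𝔼-congᵖ p≗q []            g = refl
𝔼-congᵖ p≗q (just b ∷ s)  g = 𝔼-congᵖ (p≗q ∘ suc) s (g ∘ (b ∷_))
𝔼-congᵖ {p = p} {q} p≗q (nothing ∷ s) g = trans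
  (cong (λ t → mix t (𝔼 (p ∘ suc) s (g ∘ (true ∷_))) (𝔼 (p ∘ suc) s (g ∘ (false ∷_)))) (p≗q zero))
  (cong₂ (mix (q zero)) (𝔼-congᵖ (p≗q ∘ suc) s _) (𝔼-congᵖ (p≗q ∘ suc) s _))

-- A group of `m` variables inside a larger state whose other entries stay fixed. Tests within the
-- group commute with `plug`, so inductions can run over the small state.
record Block (m n : ℕ) : Set where
  field
    plug        : State m → State n
    index       : Fin m → Fin n
    lookup-plug : ∀ t i → lookup (plug t) (index i) ≡ lookup t i
    test-plug   : ∀ t i v → plug t [ index i ]≔ v ≡ plug (t [ i ]≔ v)

open Block

rest : ∀ {m n} → Block (suc m) n → Bool → Block m n
rest B b .plug t          = plug B (just b ∷ t)
rest B b .index           = index B ∘ suc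
rest B b .lookup-plug t i = lookup-plug B (just b ∷ t) (suc i)
rest B b .test-plug t i v = test-plug B (just b ∷ t) (suc i) v

heads : ∀ R → ℕ → Bool → State R
heads zero    j       b = []
heads (suc R) zero    b = nothing ∷ heads R zero b
heads (suc R) (suc j) b = just b ∷ heads R j b

heads-zero : ∀ R b → heads R 0 b ≡ initial
heads-zero zero    b = refl
heads-zero (suc R) b = cong (nothing ∷_) (heads-zero R b)

module Testing {n : ℕ} (p c : Fin n → ℚ) (f : BoolFun n)
  (0≤p : ∀ i → 0ℚ ≤ p i) (p≤1 : ∀ i → p i ≤ 1ℚ) (0≤c : ∀ i → 0ℚ ≤ c i) where

  open Optimum p c f 0≤p p≤1 0≤c

  0≤optimal : ∀ m s → 0ℚ ≤ optimal m s
  0≤optimal m s = ≤-trans (subst (_≤ spent c s) (zeros n) (∑ℚ-mono λ i → go (is-just (lookup s i)) i)) (spent≤optimal m s)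
    where
    zeros : ∀ n → ∑ℚ {n} (λ _ → 0ℚ) ≡ 0ℚ
    zeros zero    = refl
    zeros (suc n) = trans (+-identityˡ _) (zeros n)
    go : ∀ b i → 0ℚ ≤ (if b then c i else 0ℚ)
    go true  i = 0≤c i
    go false i = ≤-refl

  spent≤total : ∀ s → spent c s ≤ ∑ℚ c
  spent≤total s = ∑ℚ-mono λ i → go (is-just (lookup s i)) i
    where
    go : ∀ b i → (if b then c i else 0ℚ) ≤ c i
    go true  i = ≤-refl
    go false i = 0≤c i

  after-≤ : ∀ v q s i → v (s [ i ]≔ just true) ≤ q → v (s [ i ]≔ just false) ≤ q → after v s i ≤ q
  after-≤ v q s i ≤q ≤q′ = subst (after v s i ≤_) (mix-const (p i) q) (mix-mono (0≤p i) (p≤1 i) ≤q ≤q′)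

  optimal≤total : ∀ m s → optimal m s ≤ ∑ℚ c
  optimal≤total zero    s = spent≤total s
  optimal≤total (suc m) s with determined? f s
  ... | yes _   = spent≤total s
  ... | no ¬det = after-≤ (optimal m) (∑ℚ c) s (choose (greedy (after (optimal m))) s h)
                    (optimal≤total m _) (optimal≤total m _)
    where h = undetermined⇒incomplete f s ¬det

  optimal-plug : ∀ {k} (B : Block (suc k) n) m t → optimal (suc m) (plug B (nothing ∷ t)) ≤
    mix (p (index B zero)) (optimal m (plug B (just true ∷ t))) (optimal m (plug B (just false ∷ t)))
  optimal-plug B m t = subst₂ (λ s s′ → optimal (suc m) (plug B (nothing ∷ t)) ≤ mix (p (index B zero)) (optimal m s) (optimal m s′))
    (test-plug B (nothing ∷ t) zero (just true)) (test-plug B (nothing ∷ t) zero (just false))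
    (optimal-test m (plug B (nothing ∷ t)) (index B zero) (lookup-plug B (nothing ∷ t) zero))

  -- Revealing the whole block is one admissible way to spend the next `k` tests, by repeated use of
  -- `optimal-test`; it may continue after `f` is determined.
  test-all : ∀ {k} (B : Block k n) m →
    optimal (k ℕ.+ m) (plug B initial) ≤ 𝔼 (p ∘ index B) initial (λ y → optimal m (plug B (Vec.map just y)))
  test-all {zero}  B m = ≤-refl
  test-all {suc k} B m = ≤-trans (optimal-plug B (k ℕ.+ m) initial)
    (mix-mono (0≤p (index B zero)) (p≤1 (index B zero)) (test-all (rest B true) m) (test-all (rest B false) m))

  -- An unlikely outcome, of probability ε, costs at most the total.
  test-heads : ∀ {R} (B : Block R n) b ε → (∀ i → p (index B i) ≡ likely b ε) → 0ℚ ≤ ε → ε ≤ 1ℚ →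
    ∀ j m → j ℕ.≤ R →
    optimal (j ℕ.+ m) (plug B initial) ≤ optimal m (plug B (heads R j b)) + fromNat j * (ε * ∑ℚ c)
  test-heads {R} B b ε like 0≤ε ε≤1 zero m j≤R = ≤-reflexive (trans
    (cong (optimal m ∘ plug B) (sym (heads-zero R b))) (lemma (optimal m (plug B (heads R zero b))) (ε * ∑ℚ c)))
    where
    lemma : ∀ a t → a ≡ a + 0ℚ * t
    lemma = solve-∀ ℚ-ring
  test-heads {suc R} B b ε like 0≤ε ε≤1 (suc j) m (ℕ.s≤s j≤R) = begin
    optimal (suc (j ℕ.+ m)) (plug B (nothing ∷ initial)) ≤⟨ optimal-plug B (j ℕ.+ m) initial ⟩
    mix (p (index B zero)) (next true) (next false) ≡⟨ cong (λ q → mix q (next true) (next false)) (like zero) ⟩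
    mix (likely b ε) (next true) (next false) ≤⟨ pessimist b ⟩
    next b + ε * C ≤⟨ +-monoˡ-≤ (ε * C) (test-heads (rest B b) b ε (like ∘ suc) 0≤ε ε≤1 j m j≤R) ⟩
    optimal m (plug B (just b ∷ heads R j b)) + fromNat j * (ε * C) + ε * C
      ≡⟨ lemma (optimal m (plug B (just b ∷ heads R j b))) (fromNat j) (ε * C) ⟩
    optimal m (plug B (just b ∷ heads R j b)) + (1ℚ + fromNat j) * (ε * C) ∎
    where
    open ≤-Reasoning
    C = ∑ℚ c
    next : Bool → ℚ
    next b = optimal (j ℕ.+ m) (plug B (just b ∷ initial))
    lemma : ∀ a t e → a + t * e + e ≡ a + (1ℚ + t) * e
    lemma = solve-∀ ℚ-ring
    unlikely : ∀ b → ε * next b ≤ ε * C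
    unlikely b = *-monoˡ 0≤ε (optimal≤total (j ℕ.+ m) _)
    shrink : ∀ b → (1ℚ - ε) * next b ≤ next b
    shrink b = ≤-by (ε * next b) (0≤* 0≤ε (0≤optimal (j ℕ.+ m) _)) (lemma′ ε (next b))
      where
      lemma′ : ∀ ε a → (1ℚ - ε) * a + ε * a ≡ a
      lemma′ = solve-∀ ℚ-ring
    pessimist : ∀ b → mix (likely b ε) (next true) (next false) ≤ next b + ε * C
    pessimist true = subst (_≤ next true + ε * C) (lemma′ ε (next true) (next false))
      (+-mono-≤ (shrink true) (unlikely false))
      where
      lemma′ : ∀ ε a b → (1ℚ - ε) * a + ε * b ≡ (1ℚ - ε) * a + (1ℚ - (1ℚ - ε)) * b
      lemma′ = solve-∀ ℚ-ring
    pessimist false = subst (_≤ next false + ε * C) (+-comm ((1ℚ - ε) * next false) (ε * next true))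
      (+-mono-≤ (shrink false) (unlikely true))

∑< : ℕ → (ℕ → ℚ) → ℚ
∑< zero    h = 0ℚ
∑< (suc u) h = h u + ∑< u h

0≤∑< : ∀ u {h} → (∀ i → 0ℚ ≤ h i) → 0ℚ ≤ ∑< u h
0≤∑< zero    0≤h = ≤-refl
0≤∑< (suc u) 0≤h = 0≤+ (0≤h u) (0≤∑< u 0≤h)

term≤∑< : ∀ u {h} → (∀ i → 0ℚ ≤ h i) → ∀ i → i ℕ.< u → h i ≤ ∑< u h
term≤∑< (suc u) {h} 0≤h i i<1+u with i ℕ.≟ u
... | yes refl = ≤-by (∑< u h) (0≤∑< u 0≤h) refl
... | no i≢u   = ≤-trans (term≤∑< u 0≤h i (ℕ.≤∧≢⇒< (ℕ.s≤s⁻¹ i<1+u) i≢u))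
  (≤-by (h u) (0≤h u) (+-comm (∑< u h) (h u)))

∑<-mono : ∀ u {h g} → (∀ i → h i ≤ g i) → ∑< u h ≤ ∑< u g
∑<-mono zero    h≤g = ≤-refl
∑<-mono (suc u) h≤g = +-mono-≤ (h≤g u) (∑<-mono u h≤g)

binomialMean-∑< : ∀ F u (h : ℕ → ℕ → ℚ) →
  binomialMean F (λ t → ∑< u λ e → h e t) ≡ ∑< u λ e → binomialMean F (h e)
binomialMean-∑< F zero    h = binomialMean-const F 0ℚ
binomialMean-∑< F (suc u) h = trans (binomialMean-+ F (h u) λ t → ∑< u λ e → h e t)
  (cong (binomialMean F (h u) +_) (binomialMean-∑< F u h))

known-++ : ∀ {m n} b (s : State m) (t : State n) → known b (s ++ t) ≡ known b s ℕ.+ known b t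
known-++ b []      t = refl
known-++ b (v ∷ s) t = trans (cong (hits b v ℕ.+_) (known-++ b s t)) (sym (ℕ.+-assoc (hits b v) _ _))

known-map-just : ∀ {n} b (y : Vec Bool n) → known b (Vec.map just y) ≡ count b y
known-map-just b []      = refl
known-map-just b (a ∷ y) = cong (hits b (just a) ℕ.+_) (known-map-just b y)

known-heads : ∀ R j b → j ℕ.≤ R → known b (heads R j b) ≡ j
known-heads zero    zero    b     _ = refl
known-heads (suc R) zero    true  _ = known-heads R zero true ℕ.z≤n
known-heads (suc R) zero    false _ = known-heads R zero false ℕ.z≤n
known-heads (suc R) (suc j) true  (ℕ.s≤s j≤R) = cong suc (known-heads R j true j≤R)
known-heads (suc R) (suc j) false (ℕ.s≤s j≤R) = cong suc (known-heads R j false j≤R)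

tests : ∀ {n} → State n → ℕ
tests = Vec.countᵇ is-just

tests-initial : ∀ n → tests (initial {n}) ≡ 0
tests-initial zero    = refl
tests-initial (suc n) = tests-initial n

tests-heads : ∀ R j b → j ℕ.≤ R → tests (heads R j b) ≡ j
tests-heads zero    zero    b _ = refl
tests-heads (suc R) zero    b _ = tests-heads R zero b ℕ.z≤n
tests-heads (suc R) (suc j) b (ℕ.s≤s j≤R) = cong suc (tests-heads R j b j≤R)

spent-replicate : ∀ {F} q (s : State F) → spent (lookup (replicate F q)) s ≡ q * fromNat (tests s)
spent-replicate q []            = sym (*-zeroʳ q)
spent-replicate q (just _ ∷ s)  = trans (cong (q +_) (spent-replicate q s)) (lemma q (fromNat (tests s)))
  where
  lemma : ∀ q t → q + q * t ≡ q * (1ℚ + t)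
  lemma = solve-∀ ℚ-ring
spent-replicate q (nothing ∷ s) = trans (+-identityˡ _) (spent-replicate q s)

spent-++ : ∀ {m n} (v : Vec ℚ m) (w : Vec ℚ n) s t →
           spent (lookup (v ++ w)) (s ++ t) ≡ spent (lookup v) s + spent (lookup w) t
spent-++ []      w []      t = sym (+-identityˡ (spent (lookup w) t))
spent-++ (q ∷ v) w (u ∷ s) t = trans (cong (a +_) (spent-++ v w s t))
  (sym (+-assoc a (spent (lookup v) s) (spent (lookup w) t)))
  where a = if is-just u then q else 0ℚ

module GapOptimum (R M : ℕ) (ε : ℚ) (0<ε : 0ℚ < ε) (ε<1 : ε < 1ℚ) where

  open Gap R M ε 0<ε ε<1
  open KOfN {n} {k} {k̄} k+k̄
  open Optimum p c f 0≤p p≤1 0≤c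
  open Testing p c f 0≤p p≤1 0≤c

  private
    none : State R
    none = initial

    assemble : State R → State R → State F → State n
    assemble s₁ s₀ t = s₁ ++ (s₀ ++ t)

    spent-assemble : ∀ s₁ s₀ t → spent c (assemble s₁ s₀ t) ≡ fromNat (tests s₁) + fromNat (tests s₀)
    spent-assemble s₁ s₀ t = trans (spent-++ (replicate R 1ℚ) _ s₁ (s₀ ++ t))
      (trans (cong₂ _+_ (spent-replicate 1ℚ s₁) (trans (spent-++ (replicate R 1ℚ) _ s₀ t)
               (cong₂ _+_ (spent-replicate 1ℚ s₀) (spent-replicate 0ℚ t))))
             (lemma (fromNat (tests s₁)) (fromNat (tests s₀)) (fromNat (tests t))))
      where
      lemma : ∀ a b t → 1ℚ * a + (1ℚ * b + 0ℚ * t) ≡ a + b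
      lemma = solve-∀ ℚ-ring

    known-assemble : ∀ b s₁ s₀ t → known b (assemble s₁ s₀ t) ≡ known b s₁ ℕ.+ (known b s₀ ℕ.+ known b t)
    known-assemble b s₁ s₀ t = trans (known-++ b s₁ (s₀ ++ t)) (cong (known b s₁ ℕ.+_) (known-++ b s₀ t))

    coins : Block F n
    coins .plug        = assemble none none
    coins .index i     = R ↑ʳ (R ↑ʳ i)
    coins .lookup-plug t i = trans (lookup-++ʳ none (none ++ t) (R ↑ʳ i)) (lookup-++ʳ none t i)
    coins .test-plug t i v = trans ([]≔-++-↑ʳ none (none ++ t) (R ↑ʳ i))
      (cong (none ++_) ([]≔-++-↑ʳ none t i))

    block : Bool → Vec Bool F → Block R n
    block true  y .plug s = assemble s none (Vec.map just y)
    block false y .plug s = assemble none s (Vec.map just y)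
    block true  y .index i = i ↑ˡ (R ℕ.+ F)
    block false y .index i = R ↑ʳ (i ↑ˡ F)
    block true  y .lookup-plug t i = lookup-++ˡ t (none ++ Vec.map just y) i
    block false y .lookup-plug t i = trans (lookup-++ʳ none (t ++ Vec.map just y) (i ↑ˡ F)) (lookup-++ˡ t (Vec.map just y) i)
    block true  y .test-plug t i v = []≔-++-↑ˡ t (none ++ Vec.map just y) i
    block false y .test-plug t i v = trans ([]≔-++-↑ʳ none (t ++ Vec.map just y) (i ↑ˡ F))
      (cong (none ++_) ([]≔-++-↑ˡ t (Vec.map just y) i))

    block-likely : ∀ b y i → p (index (block b y) i) ≡ likely b ε
    block-likely true  y i = trans (lookup-++ˡ (replicate R (1ℚ - ε)) _ i) (lookup-replicate i (1ℚ - ε))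
    block-likely false y i = trans (lookup-++ʳ (replicate R (1ℚ - ε)) _ (i ↑ˡ F))
      (trans (lookup-++ˡ (replicate R ε) (½-vector F) i) (lookup-replicate i ε))

    coins-fair : ∀ i → p (index coins i) ≡ lookup (½-vector F) i
    coins-fair i = trans (lookup-++ʳ (replicate R (1ℚ - ε)) (replicate R ε ++ ½-vector F) (R ↑ʳ i)) (lookup-++ʳ (replicate R ε) (½-vector F) i)

  -- At most `R` tests in a pool can each go wrong with probability `ε`, and each such event is
  -- charged the total cost.
  slack : ℚ
  slack = fromNat R * (ε * ∑ℚ c)

  private
    0≤ε = <⇒≤ 0<ε
    ε≤1 = <⇒≤ ε<1

    0≤C : 0ℚ ≤ ∑ℚ c
    0≤C = ≤-trans (0≤optimal 0 initial) (optimal≤total 0 initial)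

    0≤slack : 0ℚ ≤ slack
    0≤slack = 0≤* (0≤fromNat R) (0≤* 0≤ε 0≤C)

    settled : Vec Bool F → ℚ
    settled y = optimal (R ℕ.+ R) (assemble none none (Vec.map just y))

    spent-block : ∀ b y j → j ℕ.≤ R → spent c (plug (block b y) (heads R j b)) ≡ fromNat j
    spent-block true  y j j≤R = trans (spent-assemble (heads R j true) none (Vec.map just y))
      (trans (cong₂ (λ a b → fromNat a + fromNat b) (tests-heads R j true j≤R) (tests-initial R)) (+-identityʳ (fromNat j)))
    spent-block false y j j≤R = trans (spent-assemble none (heads R j false) (Vec.map just y))
      (trans (cong₂ (λ a b → fromNat a + fromNat b) (tests-initial R) (tests-heads R j false j≤R)) (+-identityˡ (fromNat j)))

    known-block : ∀ b y j → j ℕ.≤ R → known b (plug (block b y) (heads R j b)) ≡ j ℕ.+ count b y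
    known-block true  y j j≤R = trans (known-assemble true (heads R j true) none (Vec.map just y))
      (cong₂ ℕ._+_ (known-heads R j true j≤R) (cong₂ ℕ._+_ (known-initial R true) (known-map-just true y)))
    known-block false y j j≤R = trans (known-assemble false none (heads R j false) (Vec.map just y))
      (cong₂ ℕ._+_ (known-initial R false) (cong₂ ℕ._+_ (known-heads R j false j≤R) (known-map-just false y)))

    plug-initial : ∀ b y → plug (block b y) initial ≡ assemble none none (Vec.map just y)
    plug-initial true  y = refl
    plug-initial false y = refl

    settled≤ : ∀ b y j → j ℕ.≤ R → select b k k̄ ℕ.≤ j ℕ.+ count b y → settled y ≤ fromNat j + slack
    settled≤ b y j j≤R enough = begin
      settled y
        ≡⟨ cong₂ optimal (sym (ℕ.m+[n∸m]≡n (ℕ.≤-trans j≤R (ℕ.m≤m+n R R)))) (sym (plug-initial b y)) ⟩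
      optimal (j ℕ.+ m) (plug (block b y) initial)
        ≤⟨ test-heads (block b y) b ε (block-likely b y) 0≤ε ε≤1 j m j≤R ⟩
      optimal m (plug (block b y) (heads R j b)) + fromNat j * (ε * ∑ℚ c)
        ≡⟨ cong (_+ fromNat j * (ε * ∑ℚ c)) (trans (optimal-determined m (plug (block b y) (heads R j b))
             (determined b (plug (block b y) (heads R j b)) (subst (select b k k̄ ℕ.≤_) (sym (known-block b y j j≤R)) enough)))
             (spent-block b y j j≤R)) ⟩
      fromNat j + fromNat j * (ε * ∑ℚ c)
        ≤⟨ +-monoʳ-≤ (fromNat j) (*-monoʳ-≤-nonNeg (ε * ∑ℚ c) {{nonNegative (0≤* 0≤ε 0≤C)}} (fromNat-mono j≤R)) ⟩
      fromNat j + slack ∎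
      where
      open ≤-Reasoning
      m = R ℕ.+ R ℕ.∸ j

    settled≡0 : ∀ b y → select b k k̄ ℕ.≤ count b y → settled y ≡ 0ℚ
    settled≡0 b y enough = trans (optimal-determined (R ℕ.+ R) (assemble none none (Vec.map just y))
      (determined b (assemble none none (Vec.map just y)) (subst (select b k k̄ ℕ.≤_) (sym (trans (known-assemble b none none (Vec.map just y))
        (cong₂ ℕ._+_ (known-initial R b) (cong₂ ℕ._+_ (known-initial R b) (known-map-just b y))))) enough)))
      (trans (spent-assemble none none (Vec.map just y))
        (cong₂ (λ a b → fromNat a + fromNat b) (tests-initial R) (tests-initial R)))

    -- The price of the two targets that lack `suc e` values: with `M + e` ones among the coins,
    -- `suc e` zeros are missing, and with `M + (2R - suc e)` ones, `suc e` ones are missing.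
    term : ℕ → ℕ → ℚ
    term e t = (fromNat (suc e) + slack) * (δ (M ℕ.+ e) t + δ (M ℕ.+ (R ℕ.+ R ℕ.∸ suc e)) t)

    0≤price : ∀ e → 0ℚ ≤ fromNat (suc e) + slack
    0≤price e = 0≤+ (0≤fromNat (suc e)) 0≤slack

    0≤term : ∀ t e → 0ℚ ≤ term e t
    0≤term t e = 0≤* (0≤price e) (0≤+ (0≤δ (M ℕ.+ e) t) (0≤δ (M ℕ.+ (R ℕ.+ R ℕ.∸ suc e)) t))

    price : ℕ → ℚ
    price t = ∑< R λ e → term e t

    price≥ : ∀ t e → e ℕ.< R → 1ℚ ≤ δ (M ℕ.+ e) t + δ (M ℕ.+ (R ℕ.+ R ℕ.∸ suc e)) t →
             fromNat (suc e) + slack ≤ price t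
    price≥ t e e<R 1≤ = ≤-trans (subst (_≤ term e t) (*-identityʳ (fromNat (suc e) + slack)) (*-monoˡ (0≤price e) 1≤))
      (term≤∑< R (0≤term t) e e<R)

    zeros : ∀ y {d} → count true y ≡ M ℕ.+ d → d ℕ.+ count false y ≡ M
    zeros y {d} eq = ℕ.+-cancelˡ-≡ M _ _ (trans (sym (ℕ.+-assoc M d _))
      (trans (cong (ℕ._+ count false y) (sym eq)) (count-total y)))

    few : ∀ y → count true y ℕ.< M → settled y ≤ price (count true y)
    few y t<M = ≤-trans (≤-reflexive (settled≡0 false y (ℕ.+-cancelˡ-≤ M (suc M) (count false y) (begin
      M ℕ.+ suc M ≡⟨ ℕ.+-suc M M ⟩
      suc (M ℕ.+ M) ≡⟨ cong suc (count-total y) ⟨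
      suc (count true y) ℕ.+ count false y ≤⟨ ℕ.+-monoˡ-≤ (count false y) t<M ⟩
      M ℕ.+ count false y ∎)))) (0≤∑< R (0≤term (count true y)))
      where open ℕ.≤-Reasoning

    many : ∀ y d → M ℕ.+ d ≡ count true y → R ℕ.+ R ℕ.≤ d → settled y ≤ price (count true y)
    many y d Md≡t 2R≤d = ≤-trans
      (≤-reflexive (settled≡0 true y (subst (k ℕ.≤_) Md≡t (ℕ.+-monoʳ-≤ M 2R≤d))))
      (0≤∑< R (0≤term (count true y)))

    near-zero : ∀ y d → M ℕ.+ d ≡ count true y → d ℕ.< R → settled y ≤ price (count true y)
    near-zero y d Md≡t d<R = ≤-trans
      (settled≤ false y (suc d) d<R (ℕ.≤-reflexive (cong suc (sym (zeros y (sym Md≡t))))))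
      (price≥ t d d<R (≤-by (δ (M ℕ.+ (R ℕ.+ R ℕ.∸ suc d)) t) (0≤δ (M ℕ.+ (R ℕ.+ R ℕ.∸ suc d)) t)
        (cong (_+ δ (M ℕ.+ (R ℕ.+ R ℕ.∸ suc d)) t)
          (sym (trans (cong (δ (M ℕ.+ d)) (sym Md≡t)) (δ-same (M ℕ.+ d)))))))
      where t = count true y

    near-one : ∀ y d → M ℕ.+ d ≡ count true y → R ℕ.≤ d → d ℕ.< R ℕ.+ R → settled y ≤ price (count true y)
    near-one y d Md≡t R≤d d<2R = ≤-trans
      (settled≤ true y (suc e) e<R (ℕ.≤-reflexive (trans (cong (M ℕ.+_) (sym sum-2R))
        (trans (regroup M d e) (cong (suc e ℕ.+_) Md≡t)))))
      (price≥ t e e<R (≤-by (δ (M ℕ.+ e) t) (0≤δ (M ℕ.+ e) t)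
        (trans (+-comm 1ℚ (δ (M ℕ.+ e) t)) (cong (δ (M ℕ.+ e) t +_)
          (sym (trans (cong₂ δ (cong (M ℕ.+_) back-to-d) (sym Md≡t)) (δ-same (M ℕ.+ d))))))))
      where
      t = count true y
      e = R ℕ.+ R ℕ.∸ suc d
      sum-2R : suc d ℕ.+ e ≡ R ℕ.+ R
      sum-2R = ℕ.m+[n∸m]≡n d<2R
      e<R : e ℕ.< R
      e<R = ℕ.+-cancelˡ-< d e R (subst (ℕ._≤ d ℕ.+ R) (sym sum-2R) (ℕ.+-monoˡ-≤ R R≤d))
      back-to-d : R ℕ.+ R ℕ.∸ suc e ≡ d
      back-to-d = trans (cong (ℕ._∸ suc e) (trans (sym sum-2R) (sym (ℕ.+-suc d e))))
        (ℕ.m+n∸n≡m d (suc e))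
      regroup : ∀ M d e → M ℕ.+ (suc d ℕ.+ e) ≡ suc e ℕ.+ (M ℕ.+ d)
      regroup = ℕ-Solver.solve-∀

    settled≤price : ∀ y → settled y ≤ price (count true y)
    settled≤price y = low (ℕ.<-≤-connex (count true y) M)
      where
      high : ∀ d → M ℕ.+ d ≡ count true y → R ℕ.≤ d → d ℕ.< R ℕ.+ R ⊎ R ℕ.+ R ℕ.≤ d →
             settled y ≤ price (count true y)
      high d eq R≤d (inj₁ d<2R) = near-one y d eq R≤d d<2R
      high d eq R≤d (inj₂ 2R≤d) = many y d eq 2R≤d
      middle : ∀ d → M ℕ.+ d ≡ count true y → d ℕ.< R ⊎ R ℕ.≤ d → settled y ≤ price (count true y)
      middle d eq (inj₁ d<R) = near-zero y d eq d<R
      middle d eq (inj₂ R≤d) = high d eq R≤d (ℕ.<-≤-connex d (R ℕ.+ R))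
      low : count true y ℕ.< M ⊎ M ℕ.≤ count true y → settled y ≤ price (count true y)
      low (inj₁ t<M) = few y t<M
      low (inj₂ M≤t) = middle (count true y ℕ.∸ M) (ℕ.m+[n∸m]≡n M≤t)
        (ℕ.<-≤-connex (count true y ℕ.∸ M) R)

    triangle : ∀ u s B → ∑< u (λ e → (fromNat (suc e) + s) * (B + B)) ≡ fromNat u * (1ℚ + fromNat u + s + s) * B
    triangle zero    s B = lemma s B
      where
      lemma : ∀ s B → 0ℚ ≡ 0ℚ * (1ℚ + 0ℚ + s + s) * B
      lemma = solve-∀ ℚ-ring
    triangle (suc u) s B = trans (cong ((fromNat (suc u) + s) * (B + B) +_) (triangle u s B)) (lemma (fromNat u) s B)
      where
      lemma : ∀ u s B → (1ℚ + u + s) * (B + B) + u * (1ℚ + u + s + s) * B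
                      ≡ (1ℚ + u) * (1ℚ + (1ℚ + u) + s + s) * B
      lemma = solve-∀ ℚ-ring

  -- All coins are tested for free, then only the pool that suits the target. Every weight is at
  -- most the central one, and the prices `1` to `R`, each taken twice, sum to `R * (R + 1)`, apart
  -- from the slack.
  gap-optimal : optimal n initial ≤ fromNat R * (1ℚ + fromNat R + slack + slack) * Central.central M 0
  gap-optimal = begin
    optimal n initial
      ≡⟨ cong₂ optimal (regroup R F) (sym (trans (cong (initial {R} ++_) (initial-++ R {F})) (initial-++ R {R ℕ.+ F}))) ⟩
    optimal (F ℕ.+ (R ℕ.+ R)) (plug coins initial)
      ≤⟨ test-all coins (R ℕ.+ R) ⟩
    𝔼 (p ∘ index coins) initial settled
      ≡⟨ 𝔼-congᵖ coins-fair initial settled ⟩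
    𝔼 (lookup (½-vector F)) initial settled
      ≤⟨ 𝔼-mono (lookup (½-vector F)) (lookup-replicate-elim (0ℚ ≤_) F (nonNegative⁻¹ ½))
           (lookup-replicate-elim (_≤ 1ℚ) F ½≤1) initial (λ y _ → settled≤price y) ⟩
    𝔼 (lookup (½-vector F)) initial (price ∘ count true)
      ≡⟨ 𝔼-count F price ⟩
    binomialMean F price
      ≡⟨ binomialMean-∑< F R term ⟩
    ∑< R (λ e → binomialMean F (term e))
      ≤⟨ ∑<-mono R term-mean ⟩
    ∑< R (λ e → (fromNat (suc e) + slack) * (B + B))
      ≡⟨ triangle R slack B ⟩
    fromNat R * (1ℚ + fromNat R + slack + slack) * B ∎
    where
    open ≤-Reasoning
    B = Central.central M 0
    regroup : ∀ R F → R ℕ.+ (R ℕ.+ F) ≡ F ℕ.+ (R ℕ.+ R)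
    regroup = ℕ-Solver.solve-∀
    initial-++ : ∀ R {m} → initial {R} ++ initial {m} ≡ initial
    initial-++ zero    = refl
    initial-++ (suc R) = cong (nothing ∷_) (initial-++ R)
    term-mean : ∀ e → binomialMean F (term e) ≤ (fromNat (suc e) + slack) * (B + B)
    term-mean e = ≤-trans (≤-reflexive (trans
      (binomialMean-* F (fromNat (suc e) + slack) λ t → δ (M ℕ.+ e) t + δ (M ℕ.+ (R ℕ.+ R ℕ.∸ suc e)) t)
      (cong ((fromNat (suc e) + slack) *_) (binomialMean-+ F (δ (M ℕ.+ e)) (δ (M ℕ.+ (R ℕ.+ R ℕ.∸ suc e)))))))
      (*-monoˡ (0≤price e) (+-mono-≤ (Central.central≤ M e) (Central.central≤ M (R ℕ.+ R ℕ.∸ suc e))))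

-- Choice of parameters and the limit of the ratios

2ℚ 4ℚ 7ℚ : ℚ
2ℚ = 1ℚ + 1ℚ
4ℚ = 2ℚ + 2ℚ
7ℚ = 4ℚ + 2ℚ + 1ℚ

-- The loss `d * d / M` of `central≥` is at most `1 / R` for all `d` below `2R`, which is why `M` is
-- `(2R)² R`. The bound `4 ≤ R` makes `C - 7ℚ` nonnegative.
module Estimate (R M : ℕ) (4≤R : 4 ℕ.≤ R) (M≡ : M ≡ (R ℕ.+ R) ℕ.* (R ℕ.+ R) ℕ.* R) where

  ρ C : ℚ
  ρ = fromNat R
  C = ρ + ρ

  0<R : 0 ℕ.< R
  0<R = ℕ.≤-trans (ℕ.s≤s ℕ.z≤n) 4≤R

  4≤ρ : 4ℚ ≤ ρ
  4≤ρ = fromNat-mono 4≤R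

  1≤ρ : 1ℚ ≤ ρ
  1≤ρ = fromNat-mono {1} {R} (ℕ.≤-trans (ℕ.s≤s ℕ.z≤n) 4≤R)

  0<ρ : 0ℚ < ρ
  0<ρ = <-≤-trans (positive⁻¹ 1ℚ) 1≤ρ

  0<C : 0ℚ < C
  0<C = +-mono-<-≤ 0<ρ (<⇒≤ 0<ρ)

  0<CC : 0ℚ < C * C
  0<CC = pos*pos 0<C 0<C

  -- The value `1 / (2R)²` turns `ν` into `1 - 1 / (4R)` and makes `slack + slack` exactly 1.
  ε : ℚ
  ε = (1/ (C * C)) {{>-nonZero 0<CC}}

  0<ε : 0ℚ < ε
  0<ε = 1/-pos 0<CC

  CCε : C * C * ε ≡ 1ℚ
  CCε = *-inverseʳ (C * C) {{>-nonZero 0<CC}}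

  ε<1 : ε < 1ℚ
  ε<1 = subst₂ _<_ (+-identityʳ ε) (trans (lemma ρ ε) CCε)
    (+-monoʳ-< ε (pos*pos (pos*pos (+-mono-<-≤ 0<C (nonNegative⁻¹ 1ℚ)) (+-mono-<-≤ 0<ρ (0≤-diff 1≤ρ))) 0<ε))
    where
    lemma : ∀ ρ ε → ε + (ρ + ρ + 1ℚ) * (ρ + (ρ - 1ℚ)) * ε ≡ (ρ + ρ) * (ρ + ρ) * ε
    lemma = solve-∀ ℚ-ring

  open Gap R M ε 0<ε ε<1 public
  open GapOptimum R M ε 0<ε ε<1
  open Optimum p c f 0≤p p≤1 0≤c public

  B w : ℚ
  B = Central.central M 0
  w = (ρ - 1ℚ) * B * (1/ ρ) {{>-nonZero 0<ρ}}

  0<B : 0ℚ < B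
  0<B = 0<binomial (M ℕ.+ M) (M ℕ.+ 0) (ℕ.+-monoʳ-≤ M ℕ.z≤n)

  ρw : ρ * w ≡ (ρ - 1ℚ) * B
  ρw = trans (lemma ρ ((ρ - 1ℚ) * B) ((1/ ρ) {{>-nonZero 0<ρ}}))
    (trans (cong ((ρ - 1ℚ) * B *_) (*-inverseʳ ρ {{>-nonZero 0<ρ}})) (*-identityʳ ((ρ - 1ℚ) * B)))
    where
    lemma : ∀ ρ b i → ρ * (b * i) ≡ b * (ρ * i)
    lemma = solve-∀ ℚ-ring

  fromNat-M : fromNat M ≡ C * C * ρ
  fromNat-M = trans (cong fromNat M≡) (trans (fromNat-* ((R ℕ.+ R) ℕ.* (R ℕ.+ R)) R) (cong (_* ρ)
    (trans (fromNat-* (R ℕ.+ R) (R ℕ.+ R)) (cong₂ _*_ (fromNat-+ R R) (fromNat-+ R R)))))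

  w≤central : ∀ d → d ℕ.< R ℕ.+ R → w ≤ Central.central M d
  w≤central d d<2R = *-cancelˡ-≤-pos (C * C * ρ) {{positive (pos*pos 0<CC 0<ρ)}} (begin
    C * C * ρ * w ≡⟨ *-assoc (C * C) ρ w ⟩
    C * C * (ρ * w) ≡⟨ cong (C * C *_) ρw ⟩
    C * C * ((ρ - 1ℚ) * B) ≤⟨ ≤-by ((C * C - D * D) * B) (0≤* 0≤CC-DD (<⇒≤ 0<B)) (lemma C ρ D B) ⟩
    (C * C * ρ - D * D) * B ≡⟨ cong (λ N → (N - D * D) * B) fromNat-M ⟨
    (fromNat M - D * D) * B ≤⟨ Central.central≥ M d d≤M ⟩
    fromNat M * Central.central M d ≡⟨ cong (_* Central.central M d) fromNat-M ⟩
    C * C * ρ * Central.central M d ∎)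
    where
    open ≤-Reasoning
    D = fromNat d
    D≤C : D ≤ C
    D≤C = subst (D ≤_) (fromNat-+ R R) (fromNat-mono (ℕ.<⇒≤ d<2R))
    0≤CC-DD : 0ℚ ≤ C * C - D * D
    0≤CC-DD = 0≤-diff (ℝ.*-mono-≤ (0≤fromNat d) (<⇒≤ 0<C) D≤C D≤C)
    d≤M : d ℕ.≤ M
    d≤M = subst (d ℕ.≤_) (sym M≡) (ℕ.≤-trans (ℕ.<⇒≤ d<2R)
      (ℕ.≤-trans (ℕ.m≤m*n (R ℕ.+ R) (R ℕ.+ R) {{R+R≢0}}) (ℕ.m≤m*n ((R ℕ.+ R) ℕ.* (R ℕ.+ R)) R {{R≢0}})))
      where
      R≢0 = ℕ.>-nonZero {R} 0<R
      R+R≢0 = ℕ.>-nonZero {R ℕ.+ R} (ℕ.≤-trans 0<R (ℕ.m≤m+n R R))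
    lemma : ∀ C ρ D B → C * C * ((ρ - 1ℚ) * B) + (C * C - D * D) * B ≡ (C * C * ρ - D * D) * B
    lemma = solve-∀ ℚ-ring

  2Cν : (C + C) * ν ≡ C + C - 1ℚ
  2Cν = trans (lemma ρ ε) (cong (λ t → C + C - t) CCε)
    where
    lemma : ∀ ρ ε → (ρ + ρ + (ρ + ρ)) * (1ℚ - ρ * ε) ≡ ρ + ρ + (ρ + ρ) - (ρ + ρ) * (ρ + ρ) * ε
    lemma = solve-∀ ℚ-ring

  0<ν : 0ℚ < ν
  0<ν = subst (0ℚ <_) (trans (lemma ρ ε) (cong (_- ρ * ε) CCε))
    (pos*pos (pos*pos 0<ρ (+-mono-<-≤ 0<ρ (0≤+ (0≤+ (<⇒≤ 0<ρ) (<⇒≤ 0<ρ)) (0≤-diff 1≤ρ)))) 0<ε)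
    where
    lemma : ∀ ρ ε → ρ * (ρ + (ρ + ρ + (ρ - 1ℚ))) * ε ≡ (ρ + ρ) * (ρ + ρ) * ε - ρ * ε
    lemma = solve-∀ ℚ-ring

  2slack : slack + slack ≡ 1ℚ
  2slack = trans (cong (λ t → ρ * (ε * t) + ρ * (ε * t)) (trans total-cost (fromNat-+ R R)))
    (trans (lemma ρ ε) CCε)
    where
    lemma : ∀ ρ ε → ρ * (ε * (ρ + ρ)) + ρ * (ε * (ρ + ρ)) ≡ (ρ + ρ) * (ρ + ρ) * ε
    lemma = solve-∀ ℚ-ring

  X : ℚ
  X = optimal n initial

  X≤ : X ≤ ρ * (ρ + 2ℚ) * B
  X≤ = subst (X ≤_) (cong (λ t → ρ * t * B)
    (trans (lemma ρ slack) (trans (cong (λ t → 1ℚ + ρ + t) 2slack) (lemma′ ρ)))) gap-optimal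
    where
    lemma : ∀ ρ s → 1ℚ + ρ + s + s ≡ 1ℚ + ρ + (s + s)
    lemma = solve-∀ ℚ-ring
    lemma′ : ∀ ρ → 1ℚ + ρ + 1ℚ ≡ ρ + (1ℚ + 1ℚ)
    lemma′ = solve-∀ ℚ-ring

  Y-bound : ℚ
  Y-bound = ν * (ν * w) * (ρ * (C + 1ℚ))

  Y≥ : ∀ π → NonAdaptive π → Y-bound ≤ expected p c f π
  Y≥ π na = subst (_≤ expected p c f π) (cong (ν * (ν * w) *_)
    (trans (cong (λ t → ½ * (t * (t + 1ℚ))) (fromNat-+ R R)) (trans (lemma ½ ρ) (*-identityˡ (ρ * (C + 1ℚ))))))
    (gap-nonAdaptive w (<⇒≤ 0<ν) w≤central π na)
    where
    lemma : ∀ h ρ → h * ((ρ + ρ) * (ρ + ρ + 1ℚ)) ≡ (h + h) * (ρ * (ρ + ρ + 1ℚ))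
    lemma = solve-∀ ℚ-ring

  0<w : 0ℚ < w
  0<w = pos*pos (pos*pos 0<ρ-1 0<B) (1/-pos 0<ρ)
    where
    0<ρ-1 : 0ℚ < ρ - 1ℚ
    0<ρ-1 = <-≤-trans (positive⁻¹ (4ℚ - 1ℚ)) (+-monoˡ-≤ (- 1ℚ) 4≤ρ)

  -- A positive bound is known only for fixed orders. The interleaved policy transfers it to the
  -- adaptive optimum, as it costs at least `Y-bound` and at most `2 X`.
  0<X : 0ℚ < X
  0<X = ≰⇒> λ X≤0 → <-irrefl refl (<-≤-trans 0<Y-bound (begin
    Y-bound ≤⟨ Y≥ interleaving interleaving-nonAdaptive ⟩
    expected p c f interleaving ≤⟨ two-approximation optimalPolicy ⟩
    (1ℚ + 1ℚ) * expected p c f optimalPolicy ≡⟨ cong ((1ℚ + 1ℚ) *_) (optimalPolicy-value n initial (unknowns-initial n)) ⟩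
    (1ℚ + 1ℚ) * X ≤⟨ *-monoˡ (nonNegative⁻¹ (1ℚ + 1ℚ)) X≤0 ⟩
    (1ℚ + 1ℚ) * 0ℚ ≡⟨ *-zeroʳ (1ℚ + 1ℚ) ⟩
    0ℚ ∎))
    where
    open ≤-Reasoning
    open Interleaving {n} {k} {k̄} k+k̄ p c 0<p p<1 0≤c
    0<Y-bound : 0ℚ < Y-bound
    0<Y-bound = pos*pos (pos*pos 0<ν (pos*pos 0<ν 0<w)) (pos*pos 0<ρ (+-mono-<-≤ 0<C (nonNegative⁻¹ 1ℚ)))

  -- The quotient of the two bounds is `ν² (ρ - 1) (2ρ + 1) / (ρ (ρ + 2))` with `ν = 1 - 1 / (4ρ)`,
  -- which is `2 - 6 / ρ` up to terms of higher order. Replacing 6 by 7 absorbs those terms.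
  ratio-bound : (C - 7ℚ) * X ≤ ρ * Y-bound
  ratio-bound = *-cancelˡ-≤-pos K {{positive (pos*pos (+-mono-<-≤ 0<C (<⇒≤ 0<C)) (+-mono-<-≤ 0<C (<⇒≤ 0<C)))}} (begin
    K * ((C - 7ℚ) * X)
      ≤⟨ *-monoˡ 0≤K (*-monoˡ 0≤C-7 X≤) ⟩
    K * ((C - 7ℚ) * (ρ * (ρ + 2ℚ) * B))
      -- `K` clears the denominators of both factors `ν`. Up to the factor `ρ * B` the surplus is
      -- `16ρ³ + 218ρ² + 7ρ - 1`, whose end is split into `6ρ` and `ρ - 1` to be visibly
      -- nonnegative.
      ≤⟨ ≤-by (ρ * (D₃ + D₂ + D₁ + (ρ - 1ℚ)) * B)
           (0≤* (0≤* 0≤ρ (0≤+ (0≤+ (0≤+ (0≤* 0≤ρ³ (nonNegative⁻¹ d₃)) (0≤* 0≤ρ² (nonNegative⁻¹ d₂))) (0≤* 0≤ρ (nonNegative⁻¹ d₁))) (0≤-diff 1≤ρ))) (<⇒≤ 0<B))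
           (poly ρ B) ⟩
    (C + C - 1ℚ) * (C + C - 1ℚ) * ((ρ - 1ℚ) * B) * (ρ * (C + 1ℚ))
      ≡⟨ cong₂ (λ s t → s * s * t * (ρ * (C + 1ℚ))) (sym 2Cν) (sym ρw) ⟩
    (C + C) * ν * ((C + C) * ν) * (ρ * w) * (ρ * (C + 1ℚ))
      ≡⟨ regroup (C + C) ν ρ w (ρ * (C + 1ℚ)) ⟩
    K * (ρ * Y-bound) ∎)
    where
    open ≤-Reasoning
    K d₁ d₂ d₃ D₁ D₂ D₃ : ℚ
    d₃ = 4ℚ * 4ℚ
    d₂ = 2ℚ * (1ℚ + 4ℚ * (7ℚ * 4ℚ - 1ℚ))
    d₁ = 4ℚ + 2ℚ
    K = (C + C) * (C + C)
    0≤ρ = <⇒≤ 0<ρ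
    0≤ρ² = 0≤* 0≤ρ 0≤ρ
    0≤ρ³ = 0≤* 0≤ρ² 0≤ρ
    0≤K = <⇒≤ (pos*pos (+-mono-<-≤ 0<C (<⇒≤ 0<C)) (+-mono-<-≤ 0<C (<⇒≤ 0<C)))
    D₃ = ρ * ρ * ρ * d₃
    D₂ = ρ * ρ * d₂
    D₁ = ρ * d₁
    0≤C-7 : 0ℚ ≤ C - 7ℚ
    0≤C-7 = ≤-trans (nonNegative⁻¹ (4ℚ + 4ℚ - 7ℚ)) (+-monoˡ-≤ (- 7ℚ) (+-mono-≤ 4≤ρ 4≤ρ))
    poly : ∀ ρ B → (((ρ + ρ) + (ρ + ρ)) * ((ρ + ρ) + (ρ + ρ))) * (((ρ + ρ) - (((1ℚ + 1ℚ) + (1ℚ + 1ℚ)) + (1ℚ + 1ℚ) + 1ℚ)) * (ρ * (ρ + (1ℚ + 1ℚ)) * B)) + ρ * (ρ * ρ * ρ * (((1ℚ + 1ℚ) + (1ℚ + 1ℚ)) * ((1ℚ + 1ℚ) + (1ℚ + 1ℚ))) + ρ * ρ * ((1ℚ + 1ℚ) * (1ℚ + ((1ℚ + 1ℚ) + (1ℚ + 1ℚ)) * ((((1ℚ + 1ℚ) + (1ℚ + 1ℚ)) + (1ℚ + 1ℚ) + 1ℚ) * ((1ℚ + 1ℚ) + (1ℚ + 1ℚ)) - 1ℚ))) + ρ * (((1ℚ + 1ℚ) + (1ℚ + 1ℚ)) + (1ℚ + 1ℚ)) + (ρ - 1ℚ)) * B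
      ≡ ((ρ + ρ) + (ρ + ρ) - 1ℚ) * ((ρ + ρ) + (ρ + ρ) - 1ℚ) * ((ρ - 1ℚ) * B) * (ρ * ((ρ + ρ) + 1ℚ))
    poly = solve-∀ ℚ-ring
    regroup : ∀ K ν ρ w t → K * ν * (K * ν) * (ρ * w) * t ≡ K * K * (ρ * (ν * (ν * w) * t))
    regroup = solve-∀ ℚ-ring

  gap : ∀ π → NonAdaptive π → (C - 7ℚ) * X ≤ ρ * expected p c f π
  gap π na = ≤-trans ratio-bound (*-monoˡ (<⇒≤ 0<ρ) (Y≥ π na))

  gapInstance : Instance
  gapInstance = record
    { n = n ; k = k
    ; 1≤k = ℕ.≤-trans 0<R (ℕ.≤-trans (ℕ.m≤m+n R R) (ℕ.m≤n+m (R ℕ.+ R) M))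
    ; k≤n = subst (k ℕ.≤_) (regroup M R) (ℕ.m≤m+n k M)
    ; c = fromℚ ∘ c
    ; 0≤c = λ i η 0<η → 0 , λ _ _ → 0≤+ (0≤c i) (<⇒≤ 0<η)
    ; p = fromℚ ∘ p
    ; 0<p = λ i → p i , 0<p i , 0 , λ _ _ → ≤-reflexive (+-identityˡ (p i))
    ; p<1 = λ i → 1ℚ - p i , subst (_< 1ℚ - p i) (+-inverseʳ (p i)) (+-monoˡ-< (- p i) (p<1 i)) ,
              0 , λ _ _ → ≤-reflexive (cancel (p i))
    }
    where
    regroup : ∀ M R → M ℕ.+ (R ℕ.+ R) ℕ.+ M ≡ R ℕ.+ (R ℕ.+ (M ℕ.+ M))
    regroup = ℕ-Solver.solve-∀
    cancel : ∀ p → p + (1ℚ - p) ≡ 1ℚ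
    cancel = solve-∀ ℚ-ring

  private module I = Instance gapInstance

  seq-gap : ∀ π m → seq (I.expectedCost π) m ≡ expected p c f π
  seq-gap π m = seq-expectedCost gapInstance π m

  expected⇒≤ : ∀ π π′ → expected p c f π ≤ expected p c f π′ → I.expectedCost π ℝ.≤ I.expectedCost π′
  expected⇒≤ π π′ le η 0<η = 0 , λ m _ →
    subst₂ (λ a b → a ≤ b + η) (sym (seq-gap π m)) (sym (seq-gap π′ m)) (≤-trans le (≤-by η (<⇒≤ 0<η) refl))

  optimum : ∃[ π ] (expected p c f π ≡ X × (∀ π′ → expected p c f π ≤ expected p c f π′))
  optimum = optimalPolicy , eq , λ π → ≤-trans (≤-reflexive eq) (optimal≤value π n initial)
    where
    eq : expected p c f optimalPolicy ≡ X
    eq = optimalPolicy-value n initial (unknowns-initial n)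

  optimum-NA : ∃[ π ] (NonAdaptive π × (∀ π′ → NonAdaptive π′ → expected p c f π ≤ expected p c f π′))
  optimum-NA = nonAdaptive-optimum (ℕ.≤-trans 0<R (ℕ.m≤m+n R (R ℕ.+ F))) p c f

  module Ratio (opt : Policy n) (opt≡X : expected p c f opt ≡ X)
    (least : ∀ π → expected p c f opt ≤ expected p c f π)
    (optNA : Policy n) (isNA : NonAdaptive optNA)
    (leastNA : ∀ π → NonAdaptive π → expected p c f optNA ≤ expected p c f π) where

    positiveCost : 0ℝ ℝ.< I.expectedCost opt
    positiveCost = X , 0<X , 0 , λ m _ → ≤-reflexive
      (trans (+-identityˡ X) (sym (trans (seq-gap opt m) opt≡X)))

    gapRatio : ℝ
    gapRatio = ratio (I.expectedCost optNA) (I.expectedCost opt) positiveCost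

    isRatio : AdaptivityRatio gapRatio
    isRatio = gapInstance , opt , optNA ,
        (tt , λ π _ → expected⇒≤ opt π (least π)) , (isNA , λ π na → expected⇒≤ optNA π (leastNA π na)) , positiveCost ,
      λ η 0<η → 0 , λ m _ → ≤-trans (≤-reflexive (cong ∣_∣ (+-inverseʳ (seq gapRatio m)))) (<⇒≤ 0<η)

    gapRatio≥ : ∀ η → 7ℚ ≤ ρ * η → ∀ m → 2ℚ ≤ seq gapRatio m + η
    gapRatio≥ η 7≤ m = *-cancelˡ-≤-pos ρ {{positive 0<ρ}} (begin
      ρ * 2ℚ ≡⟨ double ρ ⟩
      C - 7ℚ + 7ℚ ≡⟨ cong (_+ 7ℚ) (sym (trans (cong ((C - 7ℚ) *_) inverse) (*-identityʳ (C - 7ℚ)))) ⟩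
      (C - 7ℚ) * (x * i) + 7ℚ ≤⟨ +-monoʳ-≤ ((C - 7ℚ) * (x * i)) 7≤ ⟩
      (C - 7ℚ) * (x * i) + ρ * η ≡⟨ cong (_+ ρ * η) (sym (*-assoc (C - 7ℚ) x i)) ⟩
      (C - 7ℚ) * x * i + ρ * η ≤⟨ +-monoˡ-≤ (ρ * η) (*-monoʳ-≤-nonNeg i {{nonNegative 0≤i}} gap′) ⟩
      ρ * y * i + ρ * η ≡⟨ collect ρ y i η ⟩
      ρ * (y * i + η) ∎)
      where
      open ≤-Reasoning
      x = seq (I.expectedCost opt) m
      y = seq (I.expectedCost optNA) m
      i = cut-1/ X 0<X x
      x≡X : x ≡ X
      x≡X = trans (seq-gap opt m) opt≡X
      inverse : x * i ≡ 1ℚ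
      inverse = cut-inverse X 0<X x (≤-reflexive (sym x≡X))
      0≤i : 0ℚ ≤ i
      0≤i = <⇒≤ (1/-pos (0<⊔ x 0<X))
      gap′ : (C - 7ℚ) * x ≤ ρ * y
      gap′ = subst₂ (λ x y → (C - 7ℚ) * x ≤ ρ * y) (sym x≡X) (sym (seq-gap optNA m))
        (gap optNA isNA)
      double′ : ∀ ρ s → ρ * (1ℚ + 1ℚ) ≡ ρ + ρ - s + s
      double′ = solve-∀ ℚ-ring
      double : ∀ ρ → ρ * 2ℚ ≡ ρ + ρ - 7ℚ + 7ℚ
      double ρ = double′ ρ 7ℚ
      collect : ∀ ρ y i η → ρ * y * i + ρ * η ≡ ρ * (y * i + η)
      collect = solve-∀ ℚ-ring

  large-ratio : ∃[ x ] (AdaptivityRatio x × (∀ η → 7ℚ ≤ ρ * η → ∀ m → 2ℚ ≤ seq x m + η))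
  large-ratio = conclude optimum optimum-NA
    where
    conclude : ∃[ π ] (expected p c f π ≡ X × (∀ π′ → expected p c f π ≤ expected p c f π′)) →
      ∃[ π ] (NonAdaptive π × (∀ π′ → NonAdaptive π′ → expected p c f π ≤ expected p c f π′)) →
      ∃[ x ] (AdaptivityRatio x × (∀ η → 7ℚ ≤ ρ * η → ∀ m → 2ℚ ≤ seq x m + η))
    conclude (opt , opt≡X , least) (optNA , isNA , leastNA) = gapRatio , isRatio , gapRatio≥
      where open Ratio opt opt≡X least optNA isNA leastNA

adaptivity-lower : ∀ u → UpperBound AdaptivityRatio u → 2ℝ ℝ.≤ u
adaptivity-lower u bounds ε 0<ε = conclude (Estimate.large-ratio R ((R ℕ.+ R) ℕ.* (R ℕ.+ R) ℕ.* R) (ℕ.m≤m+n 4 (proj₁ a)) refl)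
  where
  η : ℚ
  η = ½ * ε
  0<η : 0ℚ < η
  0<η = pos*pos 0<½ 0<ε
  η⁻¹ : ℚ
  η⁻¹ = (1/ η) {{>-nonZero 0<η}}
  a : ∃[ a ] 7ℚ * η⁻¹ ≤ fromNat a
  a = archimedean (7ℚ * η⁻¹)
  R : ℕ
  -- The summand 4 meets the assumption of `Estimate`, and `proj₁ a ≥ 7 / η` makes the deficit
  -- `7 / R` at most `η`, half of `ε`; the other half goes to the bound by `u`.
  R = 4 ℕ.+ proj₁ a
  7≤ : 7ℚ ≤ fromNat R * η
  7≤ = subst (_≤ fromNat R * η) (*-cancel-1/ η 7ℚ {{>-nonZero 0<η}})
    (*-monoʳ-≤-nonNeg η {{nonNegative (<⇒≤ 0<η)}} (≤-trans (proj₂ a) (fromNat-mono (ℕ.m≤n+m (proj₁ a) 4))))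
  conclude : ∃[ x ] (AdaptivityRatio x × (∀ η → 7ℚ ≤ fromNat R * η → ∀ m → 2ℚ ≤ seq x m + η)) →
             Eventually λ m → 2ℚ ≤ seq u m + ε
  conclude (x , isRatio , x≥) = eventually-map {λ m → seq x m ≤ seq u m + η} {λ m → 2ℚ ≤ seq u m + ε}
    (λ m le → ≤-trans (x≥ η 7≤ m) (≤-trans (+-monoˡ-≤ η le)
      (≤-reflexive (trans (+-assoc (seq u m) η η) (cong (seq u m +_) (half+half ε))))))
    (bounds x isRatio η 0<η)

theorem1 : IsSupremum AdaptivityRatio 2ℝ
theorem1 = adaptivity-upper , adaptivity-lower
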